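{- There is a deterministic algorithm $\mathcal{A}_{\mathrm{InstanceOpt}}$ with the following guarantee. Given as input a randomized $q$-query algorithm $R:\{0,1\}^n\times\{0,1\}^m\to[0,1]$ with description length $N$ and an error parameter $\varepsilon\in(0,\frac12)$, let $q^\star_R$ denote the minimum query complexity of any deterministic query algorithm that $\varepsilon$-approximates $R$: $$q^\star_R:=\min\{\,q' : \text{there is a } q'\text{ -query deterministic decision tree } D \text{ that } \varepsilon\text{ -approximates } R\,\}.$$ Then $\mathcal{A}_{\mathrm{InstanceOpt}}$ runs in time $\mathrm{poly}(N)\cdot n^{O(q^\star_R)}$ and returns a deterministic $q^\star_R$-query algorithm $D:\{0,1\}^n\to[0,1]$ satisfying $$\mathop{\mathbb{E}}_{x}\Big[\big(D(x)-\mathop{\mathbb{E}}_{r}[R(x,r)]\big)^2\Big]\le\varepsilon,$$ where $x\sim\{0,1\}^n$ and $r\sim\{0,1\}^m$ are uniformly random.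
   Context: Query algorithms are represented as binary decision trees. An $n$-variable randomized decision tree (RDT) is a binary tree with two types of internal nodes: decision nodes, which branch on the value of one of the boolean variables $x_1,\dots,x_n$, and stochastic nodes, which branch on the outcome of an independent $\mathrm{Bernoulli}(\frac12)$ random bit. Leaves are labelled by values in $[0,1]$. Its query complexity is the maximum number of decision nodes on any root-to-leaf path, and its randomness complexity is the maximum number $m$ of stochastic nodes on any root-to-leaf path. The RDT computes a function $R:\{0,1\}^n\times\{0,1\}^m\to[0,1]$, where $R(x,r)$ is the label of the leaf reached on input $x$ when the stochastic nodes encountered branch according to the bits of $r$. A randomized $q$-query algorithm is an RDT of query complexity at most $q$. A deterministic decision tree (DDT), or deterministic query algorithm, is an RDT with no stochastic nodes. The description length is the length of the description of the tree. A DDT $D:\{0,1\}^n\to[0,1]$ $\varepsilon$-approximates $R$ if $\mathbb{E}_{x}[(D(x)-\mathbb{E}_{r}[R(x,r)])^2]\le\varepsilon$ for uniform $x\sim\{0,1\}^n$, $r\sim\{0,1\}^m$. Constants in $O(\cdot)$ and $\mathrm{poly}(\cdot)$ are absolute.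
   Formalization: Leaf labels (of R, of D and of the trees defining q*_R) and ε are rational, given as fractions in binary, and N counts the length of the description of ε as well as that of R. -}

module Defs where

open import Data.Bool using (Bool; true; false; if_then_else_)
open import Data.Fin using (Fin; zero; toℕ)
open import Data.Integer using (+_; ∣_∣)
open import Data.Nat using (ℕ; zero; suc; _+_; _^_; _⊔_; _≤_; s≤s)
open import Data.Nat.Binary using (ℕᵇ; zero; 2[1+_]; 1+[2_]; fromℕ)
open import Data.Nat.Properties
  using (≤-refl; ≤-reflexive; m⊔n≤o⇒m≤o; m⊔n≤o⇒n≤o; m^n≢0)
open import Data.Product using (_×_; _,_; ∃-syntax)
open import Data.Rational.Unnormalised as ℚᵘ using (ℚᵘ; ↥_; ↧ₙ_; 0ℚᵘ; 1ℚᵘ)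
open import Data.Vec using (Vec; []; _∷_; lookup)
open import Relation.Binary.PropositionalEquality using (_≡_; refl)

-- Leaf labels are fractions, not necessarily in lowest terms: a label is part
-- of the description of a tree, and 1/2 and 2/4 are different descriptions.
record Label : Set where
  constructor mkLabel
  field
    value   : ℚᵘ
    0≤value : 0ℚᵘ ℚᵘ.≤ value
    value≤1 : value ℚᵘ.≤ 1ℚᵘ

open Label public

-- In `query i t₀ t₁` and `flip t₀ t₁` the subtree t₀ is taken on outcome 0
-- and t₁ on outcome 1.
data RDT (n : ℕ) : Set where
  leaf  : Label → RDT n
  query : Fin n → RDT n → RDT n → RDT n
  flip  : RDT n → RDT n → RDT n

queryComplexity : ∀ {n} → RDT n → ℕ
queryComplexity (leaf _)        = 0
queryComplexity (query _ t₀ t₁) = suc (queryComplexity t₀ ⊔ queryComplexity t₁)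
queryComplexity (flip t₀ t₁)    = queryComplexity t₀ ⊔ queryComplexity t₁

randomness : ∀ {n} → RDT n → ℕ
randomness (leaf _)        = 0
randomness (query _ t₀ t₁) = randomness t₀ ⊔ randomness t₁
randomness (flip t₀ t₁)    = suc (randomness t₀ ⊔ randomness t₁)

-- The j-th stochastic node on the path followed branches on the j-th random bit.
eval : ∀ {n m} (t : RDT n) → randomness t ≤ m → Vec Bool n → Vec Bool m → ℚᵘ
eval (leaf v) _ x r = value v
eval (query i t₀ t₁) p x r =
  if lookup x i
  then eval t₁ (m⊔n≤o⇒n≤o (randomness t₀) (randomness t₁) p) x r
  else eval t₀ (m⊔n≤o⇒m≤o (randomness t₀) (randomness t₁) p) x r
eval (flip t₀ t₁) (s≤s p) x (b ∷ r) =
  if b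
  then eval t₁ (m⊔n≤o⇒n≤o (randomness t₀) (randomness t₁) p) x r
  else eval t₀ (m⊔n≤o⇒m≤o (randomness t₀) (randomness t₁) p) x r

⟦_⟧ : ∀ {n} (R : RDT n) → Vec Bool n → Vec Bool (randomness R) → ℚᵘ
⟦ R ⟧ = eval R ≤-refl

record DDT (n : ℕ) : Set where
  constructor mkDDT
  field
    tree         : RDT n
    noStochastic : randomness tree ≡ 0

open DDT public

⟦_⟧ᴰ : ∀ {n} → DDT n → Vec Bool n → ℚᵘ
⟦ D ⟧ᴰ x = eval (tree D) (≤-reflexive (noStochastic D)) x []

sumCube : ∀ k → (Vec Bool k → ℚᵘ) → ℚᵘ
sumCube zero    f = f []
sumCube (suc k) f =
  sumCube k (λ x → f (false ∷ x)) ℚᵘ.+ sumCube k (λ x → f (true ∷ x))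

𝔼 : ∀ {k} → (Vec Bool k → ℚᵘ) → ℚᵘ
𝔼 {k} f = ℚᵘ._/_ (+ 1) (2 ^ k) {{m^n≢0 2 k}} ℚᵘ.* sumCube k f

square : ℚᵘ → ℚᵘ
square a = a ℚᵘ.* a

sqError : ∀ {n} → DDT n → RDT n → ℚᵘ
sqError D R = 𝔼 (λ x → square (⟦ D ⟧ᴰ x ℚᵘ.- 𝔼 (λ r → ⟦ R ⟧ x r)))

Approximates : ∀ {n} → ℚᵘ → DDT n → RDT n → Set
Approximates ε D R = sqError D R ℚᵘ.≤ ε

Approximable : ∀ {n} → ℚᵘ → RDT n → ℕ → Set
Approximable {n} ε R q′ =
  ∃[ D ] (queryComplexity (tree {n} D) ≤ q′ × Approximates ε D R)

IsLeast : (ℕ → Set) → ℕ → Set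
IsLeast P k = P k × (∀ j → P j → k ≤ j)

-- The machine model: first-order recursive functions over binary trees, with
-- unit cost per evaluation step.  Values are shared, never copied, so a step is
-- a constant number of pointer operations; the model simulates, and is simulated
-- by, Turing machines with polynomial overhead once the output is charged for.
data 𝔻 : Set where
  nil  : 𝔻
  cons : 𝔻 → 𝔻 → 𝔻

-- One bit per node in prefix notation, so this is the length of d as a bit string.
size : 𝔻 → ℕ
size nil        = 1
size (cons d e) = suc (size d + size e)

-- Expressions over F unary functions with V variables in scope.
data Exp (F V : ℕ) : Set where
  var   : Fin V → Exp F V
  nil   : Exp F V
  cons  : Exp F V → Exp F V → Exp F V
  case  : Exp F V → Exp F V → Exp F (2 + V) → Exp F V
  let′  : Exp F V → Exp F (1 + V) → Exp F V
  call  : Fin F → Exp F V → Exp F V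

-- Function 0 is the entry point.
record Program : Set where
  constructor program
  field
    auxiliaries : ℕ
    bodies      : Vec (Exp (suc auxiliaries) 1) (suc auxiliaries)

open Program public

infix 4 _∣_⊢_⇓_⟨_⟩

-- P ∣ ρ ⊢ e ⇓ d ⟨ t ⟩: in environment ρ, e evaluates to d in t steps.
data _∣_⊢_⇓_⟨_⟩ (P : Program) {V} (ρ : Vec 𝔻 V) :
                 Exp (suc (auxiliaries P)) V → 𝔻 → ℕ → Set where
  var : ∀ i → P ∣ ρ ⊢ var i ⇓ lookup ρ i ⟨ 1 ⟩
  nil : P ∣ ρ ⊢ nil ⇓ nil ⟨ 1 ⟩
  cons : ∀ {e₁ e₂ d₁ d₂ t₁ t₂} →
         P ∣ ρ ⊢ e₁ ⇓ d₁ ⟨ t₁ ⟩ →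
         P ∣ ρ ⊢ e₂ ⇓ d₂ ⟨ t₂ ⟩ →
         P ∣ ρ ⊢ cons e₁ e₂ ⇓ cons d₁ d₂ ⟨ suc (t₁ + t₂) ⟩
  case-nil : ∀ {e e₁ e₂ d t t₁} →
         P ∣ ρ ⊢ e ⇓ nil ⟨ t ⟩ →
         P ∣ ρ ⊢ e₁ ⇓ d ⟨ t₁ ⟩ →
         P ∣ ρ ⊢ case e e₁ e₂ ⇓ d ⟨ suc (t + t₁) ⟩
  case-cons : ∀ {e e₁ e₂ h l d t t₂} →
         P ∣ ρ ⊢ e ⇓ cons h l ⟨ t ⟩ →
         P ∣ h ∷ l ∷ ρ ⊢ e₂ ⇓ d ⟨ t₂ ⟩ →
         P ∣ ρ ⊢ case e e₁ e₂ ⇓ d ⟨ suc (t + t₂) ⟩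
  let′ : ∀ {e₁ e₂ d₁ d₂ t₁ t₂} →
         P ∣ ρ ⊢ e₁ ⇓ d₁ ⟨ t₁ ⟩ →
         P ∣ d₁ ∷ ρ ⊢ e₂ ⇓ d₂ ⟨ t₂ ⟩ →
         P ∣ ρ ⊢ let′ e₁ e₂ ⇓ d₂ ⟨ suc (t₁ + t₂) ⟩
  call : ∀ {f e d₁ d₂ t₁ t₂} →
         P ∣ ρ ⊢ e ⇓ d₁ ⟨ t₁ ⟩ →
         P ∣ d₁ ∷ [] ⊢ lookup (bodies P) f ⇓ d₂ ⟨ t₂ ⟩ →
         P ∣ ρ ⊢ call f e ⇓ d₂ ⟨ suc (t₁ + t₂) ⟩

⇓-deterministic : ∀ {P V} {ρ : Vec 𝔻 V} {e d d′ t t′} →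
                  P ∣ ρ ⊢ e ⇓ d ⟨ t ⟩ → P ∣ ρ ⊢ e ⇓ d′ ⟨ t′ ⟩ → d ≡ d′ × t ≡ t′
⇓-deterministic (var i) (var .i) = refl , refl
⇓-deterministic nil nil = refl , refl
⇓-deterministic (cons p q) (cons p′ q′)
  with refl , refl ← ⇓-deterministic p p′ | refl , refl ← ⇓-deterministic q q′ = refl , refl
⇓-deterministic (case-nil p q) (case-nil p′ q′)
  with refl , refl ← ⇓-deterministic p p′ | refl , refl ← ⇓-deterministic q q′ = refl , refl
⇓-deterministic (case-nil p _) (case-cons p′ _) with () , _ ← ⇓-deterministic p p′
⇓-deterministic (case-cons p _) (case-nil p′ _) with () , _ ← ⇓-deterministic p p′
⇓-deterministic (case-cons p q) (case-cons p′ q′)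
  with refl , refl ← ⇓-deterministic p p′
  with refl , refl ← ⇓-deterministic q q′ = refl , refl
⇓-deterministic (let′ p q) (let′ p′ q′)
  with refl , refl ← ⇓-deterministic p p′
  with refl , refl ← ⇓-deterministic q q′ = refl , refl
⇓-deterministic (call p q) (call p′ q′)
  with refl , refl ← ⇓-deterministic p p′
  with refl , refl ← ⇓-deterministic q q′ = refl , refl

-- The time includes writing the output in full: sharing lets t steps build a
-- tree with exponentially many nodes.
Returns_On_Output_Within_ : Program → 𝔻 → 𝔻 → ℕ → Set
Returns P On d Output d′ Within T =
  ∃[ t ] (P ∣ d ∷ [] ⊢ lookup (bodies P) zero ⇓ d′ ⟨ t ⟩ × t + size d′ ≤ T)

-- Bijective base 2, least significant digit first: every natural number has
-- exactly one encoding, of logarithmic size.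
encodeℕᵇ : ℕᵇ → 𝔻
encodeℕᵇ zero     = nil
encodeℕᵇ 1+[2 b ] = cons nil (encodeℕᵇ b)
encodeℕᵇ 2[1+ b ] = cons (cons nil nil) (encodeℕᵇ b)

encodeℕ : ℕ → 𝔻
encodeℕ k = encodeℕᵇ (fromℕ k)

-- Only nonnegative fractions are ever encoded, so no sign is recorded.
encodeℚ : ℚᵘ → 𝔻
encodeℚ a = cons (encodeℕ ∣ ↥ a ∣) (encodeℕ (↧ₙ a))

encodeRDT : ∀ {n} → RDT n → 𝔻
encodeRDT (leaf v) = cons nil (encodeℚ (value v))
encodeRDT (flip t₀ t₁) =
  cons (cons nil nil) (cons (encodeRDT t₀) (encodeRDT t₁))
encodeRDT (query i t₀ t₁) =
  cons (cons (cons nil nil) nil)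
       (cons (encodeℕ (toℕ i)) (cons (encodeRDT t₀) (encodeRDT t₁)))

encodeInput : ∀ {n} → RDT n → ℚᵘ → 𝔻
encodeInput R ε = cons (encodeRDT R) (encodeℚ ε)

module Submission where

-- Write g x for the expected output of R on x.  A leaf of a decision tree that
-- is reached on some subcube is best labelled by the mean μ of g there, and then
-- contributes the variance of g on the subcube to the error.  Hence the error of
-- such a tree is the second moment of g minus a score, the sum of 2^(-depth) μ²
-- over the leaves (best-error), and a best tree of depth q is one of maximal
-- score.  Scores obey a recursion: either stop, or query some variable and
-- average the best scores of depth q - 1 on the two halves.  Only variables that
-- occur in R need to be tried, as any other query leaves g unchanged
-- (best-optimal).  The algorithm evaluates this recursion for q = 0, 1, 2, ...
-- and stops when the second moment is at most ε plus the score, which happens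
-- first at q⋆ and at the latest at q = n (Approximable-n).
--
-- The means and the second moment are computed exactly by walking through R, or
-- through two copies of R at once, while restricting the variables that are
-- queried (walk-correct).  All numbers are fractions whose denominators are
-- products of denominators occurring in R and powers of 2, so their bit lengths
-- only add up (walk-fits, best-fits), and arithmetic in binary takes polynomial
-- time.
--
-- For the running time it suffices to count calls of recursive functions (timed),
-- since each body takes boundedly many steps of its own.  The recursion for the
-- best tree with k ≤ n variables makes at most (1 + 3 k)^q calls up to a factor
-- that is polynomial in the bit lengths (best-runs), and the bit lengths are at
-- most 2^q times a polynomial in the input size.  So everything is bounded by a
-- power of the product of the input size and (1 + 3 n)^q⋆.  As q⋆ ≤ n, the second
-- factor is at most 4 n^(3 q⋆), also for n ≤ 1 (branching≤).

open import Defs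
open import Data.Bool using (Bool; true; false; if_then_else_; T)
open import Data.Empty using (⊥-elim)
open import Data.Fin using (Fin; zero; suc; toℕ; #_)
open import Data.Fin.Properties using (_≟_; toℕ-injective; injective⇒≤)
open import Data.Integer as ℤ using (+_)
import Data.Integer.Properties as ℤ
open import Data.List using (List; []; _∷_; length)
open import Data.List.Relation.Unary.All using (All; []; _∷_)
open import Data.Maybe using (Maybe; just; nothing; fromMaybe)
open import Data.Nat using (ℕ; zero; suc; _+_; _*_; _^_; _⊔_; _≤_; _<_; _≤ᵇ_; NonZero; >-nonZero; z≤n; s≤s)
open import Data.Nat.Binary as ℕᵇ using (ℕᵇ; zero; 2[1+_]; 1+[2_]; fromℕ)
import Data.Nat.Binary.Properties as ℕᵇ
open import Data.Nat.Properties hiding (_≟_)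
open import Data.Nat.Tactic.RingSolver using (solve-∀)
open import Data.Product using (_×_; _,_; proj₁; proj₂; ∃-syntax)
open import Data.Rational.Unnormalised as ℚᵘ using (ℚᵘ; mkℚᵘ; 0ℚᵘ; 1ℚᵘ; ½; _≃_; *≡*; *≤*)
  renaming (_+_ to _⊕_; _*_ to _⊗_; _-_ to _⊖_)
import Data.Rational.Unnormalised.Properties as ℚᵘ
open import Data.Rational.Unnormalised.Solver using (module +-*-Solver)
open import Data.Sum using (_⊎_; inj₁; inj₂)
open import Data.Unit using (⊤; tt)
open import Data.Vec using (Vec; []; _∷_; lookup; _[_]≔_)
open import Data.Vec.Properties using (lookup∘update; lookup∘update′)
open import Function using (_∘_)
open import Function.Definitions using (Injective)
open import Relation.Binary.PropositionalEquality
open import Relation.Nullary using (yes; no; contradiction)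
open import Relation.Nullary.Decidable using (⌊_⌋)

-- Fractions between 0 and 1

-- Fractions are never reduced: arithmetic then needs addition and
-- multiplication only, and the bit length of a denominator is at most the sum
-- of the bit lengths of the denominators that went into it.
record Frac : Set where
  constructor frac
  field
    num     : ℕ
    den-1   : ℕ
    num≤den : num ≤ suc den-1

  den : ℕ
  den = suc den-1

open Frac

toℚ : Frac → ℚᵘ
toℚ f = mkℚᵘ (+ num f) (den-1 f)

average : Frac → Frac → Frac
average f@(frac _ d-1 p≤d) g@(frac _ e-1 r≤e) = record
  { num     = num f * den g + num g * den f
  ; den-1   = (e-1 + d-1 * den g) + den f * den g
  ; num≤den = +-mono-≤ (*-monoˡ-≤ (den g) p≤d)
                       (≤-trans (*-monoˡ-≤ (den f) r≤e) (≤-reflexive (*-comm (den g) (den f)))) }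

times : Frac → Frac → Frac
times f@(frac _ d-1 p≤d) g@(frac _ e-1 r≤e) = record
  { num     = num f * num g
  ; den-1   = e-1 + d-1 * den g
  ; num≤den = *-mono-≤ p≤d r≤e }

-- Averaging with this fraction halves.
nought : Frac
nought = frac 0 0 z≤n

leq : Frac → Frac → Bool
leq f g = num f * den g ≤ᵇ num g * den f

toLabel : Frac → Label
toLabel f = mkLabel (toℚ f)
  (*≤* (ℤ.≤-trans (ℤ.+≤+ z≤n) (ℤ.≤-reflexive (sym (ℤ.*-identityʳ (+ num f))))))
  (*≤* (subst₂ ℤ._≤_ (sym (ℤ.*-identityʳ (+ num f))) (sym (ℤ.*-identityˡ (+ den f))) (ℤ.+≤+ (num≤den f))))

-- The labels and ε are given as elements of ℚᵘ; their numerators are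
-- natural numbers because their values are nonnegative.
fraction : ∀ v → 0ℚᵘ ℚᵘ.≤ v → v ℚᵘ.≤ 1ℚᵘ → Frac
fraction (mkℚᵘ (+ p) d-1) _ (*≤* p≤d) =
  frac p d-1 (ℤ.drop‿+≤+ (subst₂ ℤ._≤_ (ℤ.*-identityʳ (+ p)) (ℤ.*-identityˡ (+ suc d-1)) p≤d))
fraction (mkℚᵘ (ℤ.-[1+ _ ]) _) (*≤* ()) _

toℚ-fraction : ∀ v 0≤v v≤1 → toℚ (fraction v 0≤v v≤1) ≡ v
toℚ-fraction (mkℚᵘ (+ p) d-1) _ (*≤* _) = refl
toℚ-fraction (mkℚᵘ (ℤ.-[1+ _ ]) _) (*≤* ()) _

fromLabel : Label → Frac
fromLabel v = fraction (value v) (0≤value v) (value≤1 v)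

toℚ-fromLabel : ∀ v → toℚ (fromLabel v) ≡ value v
toℚ-fromLabel v = toℚ-fraction (value v) (0≤value v) (value≤1 v)

toℚ-times : ∀ f g → toℚ (times f g) ≃ toℚ f ⊗ toℚ g
toℚ-times f g = *≡* (cong (ℤ._* + (den f * den g)) (ℤ.pos-* (num f) (num g)))

toℚ-average : ∀ f g → toℚ (average f g) ≃ ½ ⊗ (toℚ f ⊕ toℚ g)
toℚ-average f@(frac p d-1 _) g@(frac r e-1 _) = *≡* (begin
  + (p * e + r * d) ℤ.* + (2 * (d * e))
    ≡⟨ ℤ.pos-* (p * e + r * d) (2 * (d * e)) ⟨
  + ((p * e + r * d) * (2 * (d * e)))
    ≡⟨ cong +_ (rearrange (p * e + r * d) (d * e)) ⟩
  + ((p * e + r * d) * (d * e + d * e))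
    ≡⟨ ℤ.pos-* (p * e + r * d) (d * e + d * e) ⟩
  + (p * e + r * d) ℤ.* + (d * e + d * e)
    ≡⟨ cong (ℤ._* + (d * e + d * e)) (ℤ.pos-+ (p * e) (r * d)) ⟩
  (+ (p * e) ℤ.+ + (r * d)) ℤ.* + (d * e + d * e)
    ≡⟨ cong (ℤ._* + (d * e + d * e)) (cong₂ ℤ._+_ (ℤ.pos-* p e) (ℤ.pos-* r d)) ⟩
  (+ p ℤ.* + e ℤ.+ + r ℤ.* + d) ℤ.* + (d * e + d * e)
    ≡⟨ cong (ℤ._* + (d * e + d * e)) (ℤ.*-identityˡ (+ p ℤ.* + e ℤ.+ + r ℤ.* + d)) ⟨
  (+ 1 ℤ.* (+ p ℤ.* + e ℤ.+ + r ℤ.* + d)) ℤ.* + (d * e + d * e) ∎)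
  where
  open ≡-Reasoning
  d = suc d-1
  e = suc e-1
  rearrange : ∀ a b → a * (2 * b) ≡ a * (b + b)
  rearrange = solve-∀

≤⇒toℚ≤ : ∀ f g → num f * den g ≤ num g * den f → toℚ f ℚᵘ.≤ toℚ g
≤⇒toℚ≤ f g p = *≤* (subst₂ ℤ._≤_ (ℤ.pos-* (num f) (den g)) (ℤ.pos-* (num g) (den f)) (ℤ.+≤+ p))

toℚ≤⇒≤ : ∀ f g → toℚ f ℚᵘ.≤ toℚ g → num f * den g ≤ num g * den f
toℚ≤⇒≤ f g (*≤* p) =
  ℤ.drop‿+≤+ (subst₂ ℤ._≤_ (sym (ℤ.pos-* (num f) (den g))) (sym (ℤ.pos-* (num g) (den f))) p)

-- Averages over the cube

average-cong : ∀ {a a′ b b′} → a ≃ a′ → b ≃ b′ → ½ ⊗ (a ⊕ b) ≃ ½ ⊗ (a′ ⊕ b′)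
average-cong p q = ℚᵘ.*-congˡ {½} (ℚᵘ.+-cong p q)

average-mono : ∀ {a a′ b b′} → a ℚᵘ.≤ a′ → b ℚᵘ.≤ b′ → ½ ⊗ (a ⊕ b) ℚᵘ.≤ ½ ⊗ (a′ ⊕ b′)
average-mono p q = ℚᵘ.*-monoʳ-≤-nonNeg ½ (ℚᵘ.+-mono-≤ p q)

average-self : ∀ c → ½ ⊗ (c ⊕ c) ≃ c
average-self c = ℚᵘ.≃-trans
  (solve 2 (λ h c → h :* (c :+ c) := (h :+ h) :* c) ℚᵘ.≃-refl ½ c)
  (ℚᵘ.≃-trans (ℚᵘ.*-congʳ {c} {½ ⊕ ½} {1ℚᵘ} (*≡* refl)) (ℚᵘ.*-identityˡ c))
  where open +-*-Solver

-- 𝔼 computed one coordinate at a time, which is the form that inductions use.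
mean : ∀ k → (Vec Bool k → ℚᵘ) → ℚᵘ
mean zero    f = f []
mean (suc k) f = ½ ⊗ (mean k (λ x → f (false ∷ x)) ⊕ mean k (λ x → f (true ∷ x)))

mean-cong : ∀ k {f g : Vec Bool k → ℚᵘ} → (∀ x → f x ≃ g x) → mean k f ≃ mean k g
mean-cong zero    f≃g = f≃g []
mean-cong (suc k) f≃g =
  average-cong (mean-cong k (λ x → f≃g (false ∷ x))) (mean-cong k (λ x → f≃g (true ∷ x)))

mean-const : ∀ k c → mean k (λ _ → c) ≃ c
mean-const zero    c = ℚᵘ.≃-refl
mean-const (suc k) c = ℚᵘ.≃-trans (average-cong (mean-const k c) (mean-const k c)) (average-self c)

mean-+ : ∀ k (f g : Vec Bool k → ℚᵘ) → mean k (λ x → f x ⊕ g x) ≃ mean k f ⊕ mean k g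
mean-+ zero    f g = ℚᵘ.≃-refl
mean-+ (suc k) f g = ℚᵘ.≃-trans
  (average-cong (mean-+ k (λ x → f (false ∷ x)) (λ x → g (false ∷ x)))
                (mean-+ k (λ x → f (true ∷ x)) (λ x → g (true ∷ x))))
  (solve 5 (λ h a b c d → h :* ((a :+ b) :+ (c :+ d)) := h :* (a :+ c) :+ h :* (b :+ d))
     ℚᵘ.≃-refl ½ (mean k (λ x → f (false ∷ x))) (mean k (λ x → g (false ∷ x)))
               (mean k (λ x → f (true ∷ x))) (mean k (λ x → g (true ∷ x))))
  where open +-*-Solver

mean-* : ∀ k c (f : Vec Bool k → ℚᵘ) → mean k (λ x → c ⊗ f x) ≃ c ⊗ mean k f
mean-* zero    c f = ℚᵘ.≃-refl
mean-* (suc k) c f = ℚᵘ.≃-trans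
  (average-cong (mean-* k c (λ x → f (false ∷ x))) (mean-* k c (λ x → f (true ∷ x))))
  (solve 4 (λ h c a b → h :* (c :* a :+ c :* b) := c :* (h :* (a :+ b)))
     ℚᵘ.≃-refl ½ c (mean k (λ x → f (false ∷ x))) (mean k (λ x → f (true ∷ x))))
  where open +-*-Solver

-- Overwriting coordinate i forgets its old value, so the two settings
-- together run twice over the cube.
mean-split : ∀ {k} (f : Vec Bool k → ℚᵘ) i →
  mean k f ≃ ½ ⊗ (mean k (λ x → f (x [ i ]≔ false)) ⊕ mean k (λ x → f (x [ i ]≔ true)))
mean-split {suc k} f zero = average-cong
  (ℚᵘ.≃-sym (average-self (mean k (λ x → f (false ∷ x)))))
  (ℚᵘ.≃-sym (average-self (mean k (λ x → f (true ∷ x)))))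
mean-split {suc k} f (suc i) = ℚᵘ.≃-trans
  (average-cong (mean-split (λ x → f (false ∷ x)) i) (mean-split (λ x → f (true ∷ x)) i))
  (solve 5 (λ h a b c d → h :* (h :* (a :+ b) :+ h :* (c :+ d))
                     := h :* (h :* (a :+ c) :+ h :* (b :+ d))) ℚᵘ.≃-refl ½
    (mean k (λ x → f (false ∷ x [ i ]≔ false))) (mean k (λ x → f (false ∷ x [ i ]≔ true)))
    (mean k (λ x → f (true ∷ x [ i ]≔ false))) (mean k (λ x → f (true ∷ x [ i ]≔ true))))
  where open +-*-Solver

half-unit : ∀ m .{{_ : NonZero m}} .{{_ : NonZero (2 * m)}} → (+ 1) ℚᵘ./ (2 * m) ≃ ½ ⊗ ((+ 1) ℚᵘ./ m)
half-unit (suc m) = ℚᵘ.≃-refl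

𝔼≃mean : ∀ k (f : Vec Bool k → ℚᵘ) → 𝔼 f ≃ mean k f
𝔼≃mean zero    f = ℚᵘ.*-identityˡ (f [])
𝔼≃mean (suc k) f = ℚᵘ.≃-trans
  (ℚᵘ.*-congʳ {sumCube (suc k) f} (half-unit (2 ^ k) {{m^n≢0 2 k}} {{m^n≢0 2 (suc k)}}))
  (ℚᵘ.≃-trans
    (solve 4 (λ h u a b → (h :* u) :* (a :+ b) := h :* (u :* a :+ u :* b)) ℚᵘ.≃-refl ½
      (ℚᵘ._/_ (+ 1) (2 ^ k) {{m^n≢0 2 k}}) (sumCube k (λ x → f (false ∷ x))) (sumCube k (λ x → f (true ∷ x))))
    (average-cong (𝔼≃mean k (λ x → f (false ∷ x))) (𝔼≃mean k (λ x → f (true ∷ x)))))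
  where open +-*-Solver

-- The expected output of a tree

output : ∀ {n} → RDT n → Vec Bool n → ℚᵘ
output (leaf v)        x = value v
output (query i t₀ t₁) x = if lookup x i then output t₁ x else output t₀ x
output (flip t₀ t₁)    x = ½ ⊗ (output t₀ x ⊕ output t₁ x)

-- Bits beyond those that the tree reads average out, so the lemma holds for
-- every m large enough; this generality is what the induction needs, since the
-- two subtrees of a node read different numbers of bits.
mean-eval : ∀ {n} m (t : RDT n) (p : randomness t ≤ m) x → mean m (eval t p x) ≃ output t x
mean-eval m (leaf v) p x = mean-const m (value v)
mean-eval m (query i t₀ t₁) p x with lookup x i
... | true  = mean-eval m t₁ (m⊔n≤o⇒n≤o (randomness t₀) (randomness t₁) p) x
... | false = mean-eval m t₀ (m⊔n≤o⇒m≤o (randomness t₀) (randomness t₁) p) x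
mean-eval (suc m) (flip t₀ t₁) (s≤s p) x = average-cong
  (mean-eval m t₀ (m⊔n≤o⇒m≤o (randomness t₀) (randomness t₁) p) x)
  (mean-eval m t₁ (m⊔n≤o⇒n≤o (randomness t₀) (randomness t₁) p) x)

square-cong : ∀ {a b} → a ≃ b → square a ≃ square b
square-cong p = ℚᵘ.*-cong p p

sqError-output : ∀ {n} (D : DDT n) (R : RDT n) →
  sqError D R ≃ mean n (λ x → square (output (tree D) x ⊖ output R x))
sqError-output {n} D R = ℚᵘ.≃-trans
  (𝔼≃mean n (λ x → square (⟦ D ⟧ᴰ x ⊖ 𝔼 (λ r → ⟦ R ⟧ x r))))
  (mean-cong n (λ x → square-cong (ℚᵘ.+-cong (mean-eval 0 (tree D) (≤-reflexive (noStochastic D)) x)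
    (ℚᵘ.-‿cong (ℚᵘ.≃-trans (𝔼≃mean (randomness R) (λ r → ⟦ R ⟧ x r)) (mean-eval (randomness R) R ≤-refl x))))))

-- Restrictions

Restriction : ℕ → Set
Restriction n = List (Fin n × Bool)

-- If a variable occurs twice, the older entry, deeper in the list, wins.
-- With this convention the means over the restrictions by (i , false) and
-- (i , true) on top of σ average to the mean under σ, even if σ fixes i.
fixedTo : ∀ {n} → Restriction n → Fin n → Maybe Bool
fixedTo []            j = nothing
fixedTo ((i , b) ∷ σ) j with fixedTo σ j
... | just c  = just c
... | nothing = if ⌊ i ≟ j ⌋ then just b else nothing

restrict : ∀ {n} → Restriction n → Vec Bool n → Vec Bool n
restrict []            x = x
restrict ((i , b) ∷ σ) x = restrict σ (x [ i ]≔ b)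

lookup-restrict : ∀ {n} (σ : Restriction n) x j →
                  lookup (restrict σ x) j ≡ fromMaybe (lookup x j) (fixedTo σ j)
lookup-restrict []            x j = refl
lookup-restrict ((i , b) ∷ σ) x j with fixedTo σ j | lookup-restrict σ (x [ i ]≔ b) j
... | just c  | eq = eq
... | nothing | eq with i ≟ j
...   | yes refl = trans eq (lookup∘update i x b)
...   | no  i≢j  = trans eq (lookup∘update′ (i≢j ∘ sym) x b)

fixedTo-head : ∀ {n} (σ : Restriction n) {i b} → fixedTo σ i ≡ nothing → fixedTo ((i , b) ∷ σ) i ≡ just b
fixedTo-head σ {i} free rewrite free with i ≟ i
... | yes _ = refl
... | no  ≢ = contradiction refl ≢

fixedTo-cons-cong : ∀ {n} {σ τ : Restriction n} {i b} j →
                    fixedTo σ j ≡ fixedTo τ j → fixedTo ((i , b) ∷ σ) j ≡ fixedTo ((i , b) ∷ τ) j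
fixedTo-cons-cong j eq rewrite eq = refl

lookup-fixed : ∀ {n} (σ : Restriction n) x {i b} → fixedTo σ i ≡ just b → lookup (restrict σ x) i ≡ b
lookup-fixed σ x {i} eq = trans (lookup-restrict σ x i) (cong (fromMaybe (lookup x i)) eq)

-- Moments of the expected output

-- The mean, over x and over independent coins for every tree, of the product
-- of the outputs of t and of all trees in ts on the same restricted input.
-- When one tree reaches a leaf the next one is started under the restriction
-- collected so far, so that all of them see the same x.  The mean of the
-- output is walk R [] and its second moment is walk R (R ∷ []).
walk : ∀ {n} → RDT n → List (RDT n) → Restriction n → Frac
walk (leaf v)        []       σ = fromLabel v
walk (leaf v)        (t ∷ ts) σ = times (fromLabel v) (walk t ts σ)
walk (flip t₀ t₁)    ts       σ = average (walk t₀ ts σ) (walk t₁ ts σ)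
walk (query i t₀ t₁) ts       σ with fixedTo σ i
... | just false = walk t₀ ts σ
... | just true  = walk t₁ ts σ
... | nothing    = average (walk t₀ ts ((i , false) ∷ σ)) (walk t₁ ts ((i , true) ∷ σ))

product : ∀ {n} → List (RDT n) → Vec Bool n → ℚᵘ
product []       x = 1ℚᵘ
product (t ∷ ts) x = output t x ⊗ product ts x

output-query : ∀ {n} i (t₀ t₁ : RDT n) x {b} → lookup x i ≡ b →
               output (query i t₀ t₁) x ≡ (if b then output t₁ x else output t₀ x)
output-query i t₀ t₁ x refl = refl

walk-correct : ∀ {n} (t : RDT n) ts σ →
  toℚ (walk t ts σ) ≃ mean n (λ x → output t (restrict σ x) ⊗ product ts (restrict σ x))
walk-correct {n} (leaf v) [] σ = ℚᵘ.≃-trans (ℚᵘ.≃-reflexive (toℚ-fromLabel v))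
  (ℚᵘ.≃-sym (ℚᵘ.≃-trans (mean-const n (value v ⊗ 1ℚᵘ)) (ℚᵘ.*-identityʳ (value v))))
walk-correct {n} (leaf v) (t ∷ ts) σ = ℚᵘ.≃-trans (toℚ-times (fromLabel v) (walk t ts σ))
  (ℚᵘ.≃-trans
    (ℚᵘ.*-cong (ℚᵘ.≃-reflexive (toℚ-fromLabel v)) (walk-correct t ts σ))
    (ℚᵘ.≃-sym (mean-* n (value v) (λ x → product (t ∷ ts) (restrict σ x)))))
walk-correct {n} (flip t₀ t₁) ts σ = ℚᵘ.≃-trans (toℚ-average (walk t₀ ts σ) (walk t₁ ts σ))
  (ℚᵘ.≃-trans (average-cong (walk-correct t₀ ts σ) (walk-correct t₁ ts σ))
  (ℚᵘ.≃-trans (ℚᵘ.*-congˡ {½} (ℚᵘ.≃-sym (mean-+ n f₀ f₁)))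
  (ℚᵘ.≃-trans (ℚᵘ.≃-sym (mean-* n ½ (λ x → f₀ x ⊕ f₁ x)))
    (mean-cong n (λ x → solve 4 (λ h a b p → h :* (a :* p :+ b :* p) := (h :* (a :+ b)) :* p) ℚᵘ.≃-refl
      ½ (output t₀ (restrict σ x)) (output t₁ (restrict σ x)) (product ts (restrict σ x)))))))
  where
  open +-*-Solver
  f₀ f₁ : Vec Bool n → ℚᵘ
  f₀ x = output t₀ (restrict σ x) ⊗ product ts (restrict σ x)
  f₁ x = output t₁ (restrict σ x) ⊗ product ts (restrict σ x)
walk-correct {n} (query i t₀ t₁) ts σ with fixedTo σ i in eq
... | just false = ℚᵘ.≃-trans (walk-correct t₀ ts σ) (mean-cong n (λ x →
        ℚᵘ.≃-reflexive (cong (_⊗ product ts (restrict σ x)) (sym (output-query i t₀ t₁ (restrict σ x) (lookup-fixed σ x eq))))))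
... | just true  = ℚᵘ.≃-trans (walk-correct t₁ ts σ) (mean-cong n (λ x →
        ℚᵘ.≃-reflexive (cong (_⊗ product ts (restrict σ x)) (sym (output-query i t₀ t₁ (restrict σ x) (lookup-fixed σ x eq))))))
... | nothing    = ℚᵘ.≃-trans (toℚ-average (walk t₀ ts ((i , false) ∷ σ)) (walk t₁ ts ((i , true) ∷ σ)))
  (ℚᵘ.≃-trans
    (average-cong
      (ℚᵘ.≃-trans (walk-correct t₀ ts ((i , false) ∷ σ)) (mean-cong n (branch false)))
      (ℚᵘ.≃-trans (walk-correct t₁ ts ((i , true)  ∷ σ)) (mean-cong n (branch true))))
    (ℚᵘ.≃-sym (mean-split f i)))
  where
  f : Vec Bool n → ℚᵘ
  f x = output (query i t₀ t₁) (restrict σ x) ⊗ product ts (restrict σ x)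
  branch : ∀ b x → (if b then output t₁ (restrict σ (x [ i ]≔ b)) else output t₀ (restrict σ (x [ i ]≔ b)))
                   ⊗ product ts (restrict σ (x [ i ]≔ b)) ≃ f (x [ i ]≔ b)
  branch b x = ℚᵘ.≃-reflexive (cong (_⊗ product ts (restrict σ (x [ i ]≔ b)))
    (sym (output-query i t₀ t₁ (restrict σ (x [ i ]≔ b)) (lookup-fixed ((i , b) ∷ σ) x (fixedTo-head σ eq)))))

-- The variables of a tree

Listed : ∀ {n} → Restriction n → Fin n → Set
Listed V i = ∃[ b ] fixedTo V i ≡ just b

Covers : ∀ {n} → Restriction n → RDT n → Set
Covers V (leaf _)        = ⊤
Covers V (query i t₀ t₁) = Listed V i × Covers V t₀ × Covers V t₁
Covers V (flip t₀ t₁)    = Covers V t₀ × Covers V t₁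

Agree : ∀ {n} → Restriction n → Restriction n → Restriction n → Set
Agree V σ τ = ∀ j → Listed V j → fixedTo σ j ≡ fixedTo τ j

Agree-cons : ∀ {n} (V σ τ : Restriction n) ib → Agree V σ τ → Agree V (ib ∷ σ) (ib ∷ τ)
Agree-cons V σ τ (i , b) agree j j∈V = fixedTo-cons-cong {σ = σ} {τ} j (agree j j∈V)

walk-cong : ∀ {n} {V : Restriction n} t ts {σ τ} → Covers V t → All (Covers V) ts → Agree V σ τ →
            walk t ts σ ≡ walk t ts τ
walk-cong (leaf v) []       ct        cts        agree = refl
walk-cong (leaf v) (t ∷ ts) ct        (ct′ ∷ cts) agree = cong (times (fromLabel v)) (walk-cong t ts ct′ cts agree)
walk-cong (flip t₀ t₁) ts   (c₀ , c₁) cts        agree =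
  cong₂ average (walk-cong t₀ ts c₀ cts agree) (walk-cong t₁ ts c₁ cts agree)
walk-cong {V = V} (query i t₀ t₁) ts {σ} {τ} (i∈V , c₀ , c₁) cts agree with fixedTo σ i | fixedTo τ i | agree i i∈V
... | just false | _ | refl = walk-cong t₀ ts c₀ cts agree
... | just true  | _ | refl = walk-cong t₁ ts c₁ cts agree
... | nothing    | _ | refl = cong₂ average
  (walk-cong t₀ ts c₀ cts (Agree-cons V σ τ (i , false) agree))
  (walk-cong t₁ ts c₁ cts (Agree-cons V σ τ (i , true) agree))

-- A set of variables is stored as a restriction, with arbitrary values, so
-- that looking up a value and testing membership are the same procedure.
insert : ∀ {n} → Fin n → Restriction n → Restriction n
insert i V with fixedTo V i
... | just _  = V
... | nothing = (i , false) ∷ V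

variables : ∀ {n} → RDT n → Restriction n → Restriction n
variables (leaf _)        V = V
variables (flip t₀ t₁)    V = variables t₁ (variables t₀ V)
variables (query i t₀ t₁) V = variables t₁ (variables t₀ (insert i V))

Listed-cons : ∀ {n} {V : Restriction n} {ib j} → Listed V j → Listed (ib ∷ V) j
Listed-cons (b , eq) rewrite eq = b , refl

Listed-insert : ∀ {n} i (V : Restriction n) {j} → Listed V j → Listed (insert i V) j
Listed-insert i V j∈V with fixedTo V i
... | just _  = j∈V
... | nothing = Listed-cons {V = V} j∈V

insert-Listed : ∀ {n} i (V : Restriction n) → Listed (insert i V) i
insert-Listed i V with fixedTo V i in eq
... | just b  = b , eq
... | nothing = false , fixedTo-head V eq

Listed-variables : ∀ {n} (t : RDT n) V {j} → Listed V j → Listed (variables t V) j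
Listed-variables (leaf _)        V j∈V = j∈V
Listed-variables (flip t₀ t₁)    V j∈V = Listed-variables t₁ _ (Listed-variables t₀ V j∈V)
Listed-variables (query i t₀ t₁) V j∈V =
  Listed-variables t₁ _ (Listed-variables t₀ _ (Listed-insert i V j∈V))

Covers-mono : ∀ {n} {V W : Restriction n} → (∀ {j} → Listed V j → Listed W j) → ∀ t → Covers V t → Covers W t
Covers-mono V⊆W (leaf _)        _              = tt
Covers-mono V⊆W (flip t₀ t₁)    (c₀ , c₁)      = Covers-mono V⊆W t₀ c₀ , Covers-mono V⊆W t₁ c₁
Covers-mono V⊆W (query i t₀ t₁) (i∈V , c₀ , c₁) = V⊆W i∈V , Covers-mono V⊆W t₀ c₀ , Covers-mono V⊆W t₁ c₁

variables-Covers : ∀ {n} (t : RDT n) V → Covers (variables t V) t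
variables-Covers (leaf _)        V = tt
variables-Covers (flip t₀ t₁)    V =
  Covers-mono (Listed-variables t₁ (variables t₀ V)) t₀ (variables-Covers t₀ V) , variables-Covers t₁ _
variables-Covers (query i t₀ t₁) V =
  Listed-variables t₁ _ (Listed-variables t₀ _ (insert-Listed i V)) ,
  Covers-mono (Listed-variables t₁ _) t₀ (variables-Covers t₀ _) , variables-Covers t₁ _

-- The best tree of a given depth

-- A tree paired with its score: the sum of 2^(-depth) μ² over its leaves,
-- where μ is the mean of the expected output on the subcube of the leaf.  The
-- error of the tree is the second moment of the expected output minus the score.
Candidate : ℕ → Set
Candidate n = Frac × RDT n

better : ∀ {n} → Candidate n → Candidate n → Candidate n
better a b = if leq (proj₁ a) (proj₁ b) then b else a

branchOn : ∀ {n} → Fin n → Candidate n → Candidate n → Candidate n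
branchOn i (s₀ , t₀) (s₁ , t₁) = average s₀ s₁ , query i t₀ t₁

constantAt : ∀ {n} → Frac → Candidate n
constantAt μ = times μ μ , leaf (toLabel μ)

constant : ∀ {n} → RDT n → Restriction n → Candidate n
constant R σ = constantAt (walk R [] σ)

-- The best tree of depth at most q under the restriction σ.  The list vs
-- holds the variables to be tried at the root; V holds those to be tried below
-- the root.
best : ∀ {n} → RDT n → Restriction n → ℕ → Restriction n → Restriction n → Candidate n
best R V zero    vs             σ = constant R σ
best R V (suc q) []             σ = constant R σ
best R V (suc q) ((i , _) ∷ vs) σ =
  better (branchOn i (best R V q V ((i , false) ∷ σ)) (best R V q V ((i , true) ∷ σ)))
         (best R V (suc q) vs σ)

-- The recursion reads σ only through lookups of variables of R, when it
-- computes moments.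
best-cong : ∀ {n} {R : RDT n} {V} q vs {σ τ} → Covers V R → Agree V σ τ → best R V q vs σ ≡ best R V q vs τ
best-cong {R = R} zero    vs c agree = cong constantAt (walk-cong R [] c [] agree)
best-cong {R = R} (suc q) [] c agree = cong constantAt (walk-cong R [] c [] agree)
best-cong {V = V} (suc q) ((i , _) ∷ vs) {σ} {τ} c agree = cong₂ better
  (cong₂ (branchOn i) (best-cong q V c (Agree-cons V σ τ (i , false) agree))
                      (best-cong q V c (Agree-cons V σ τ (i , true) agree)))
  (best-cong (suc q) vs c agree)

better-elim : ∀ {n} (P : Candidate n → Set) a b → P a → P b → P (better a b)
better-elim P a b pa pb with leq (proj₁ a) (proj₁ b)
... | true  = pb
... | false = pa

leq-true : ∀ f g → leq f g ≡ true → toℚ f ℚᵘ.≤ toℚ g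
leq-true f g eq = ≤⇒toℚ≤ f g (≤ᵇ⇒≤ _ _ (subst T (sym eq) tt))

leq-complete : ∀ f g → toℚ f ℚᵘ.≤ toℚ g → leq f g ≡ true
leq-complete f g f≤g with leq f g in eq
... | true  = refl
... | false = ⊥-elim (subst T eq (≤⇒≤ᵇ (toℚ≤⇒≤ f g f≤g)))

leq-false : ∀ f g → leq f g ≡ false → toℚ g ℚᵘ.≤ toℚ f
leq-false f g eq with ≤-total (num f * den g) (num g * den f)
... | inj₂ g≤f = ≤⇒toℚ≤ g f g≤f
... | inj₁ f≤g = ⊥-elim (subst T eq (≤⇒≤ᵇ f≤g))

score : ∀ {n} → Candidate n → ℚᵘ
score c = toℚ (proj₁ c)

better-≥ˡ : ∀ {n} (a b : Candidate n) → score a ℚᵘ.≤ score (better a b)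
better-≥ˡ a b with leq (proj₁ a) (proj₁ b) in eq
... | true  = leq-true (proj₁ a) (proj₁ b) eq
... | false = ℚᵘ.≤-refl

better-≥ʳ : ∀ {n} (a b : Candidate n) → score b ℚᵘ.≤ score (better a b)
better-≥ʳ a b with leq (proj₁ a) (proj₁ b) in eq
... | true  = ℚᵘ.≤-refl
... | false = leq-false (proj₁ a) (proj₁ b) eq

best-≥-constant : ∀ {n} (R : RDT n) V q vs σ → score (constant R σ) ℚᵘ.≤ score (best R V q vs σ)
best-≥-constant R V zero    vs             σ = ℚᵘ.≤-refl
best-≥-constant R V (suc q) []             σ = ℚᵘ.≤-refl
best-≥-constant R V (suc q) ((i , _) ∷ vs) σ = ℚᵘ.≤-trans (best-≥-constant R V (suc q) vs σ)
  (better-≥ʳ (branchOn i (best R V q V ((i , false) ∷ σ)) (best R V q V ((i , true) ∷ σ)))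
             (best R V (suc q) vs σ))

best-≥-branch : ∀ {n} (R : RDT n) V q vs σ {i} → Listed vs i →
  ½ ⊗ (score (best R V q V ((i , false) ∷ σ)) ⊕ score (best R V q V ((i , true) ∷ σ)))
    ℚᵘ.≤ score (best R V (suc q) vs σ)
best-≥-branch R V q ((j , _) ∷ vs) σ {i} i∈vs with fixedTo vs i in eq
best-≥-branch R V q ((j , _) ∷ vs) σ {i} i∈vs | just c =
  ℚᵘ.≤-trans (best-≥-branch R V q vs σ (c , eq))
    (better-≥ʳ (branchOn j (best R V q V ((j , false) ∷ σ)) (best R V q V ((j , true) ∷ σ)))
               (best R V (suc q) vs σ))
best-≥-branch R V q ((j , _) ∷ vs) σ {i} i∈vs | nothing with j ≟ i
best-≥-branch R V q ((j , _) ∷ vs) σ {i} (_ , ()) | nothing | no _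
... | yes refl = ℚᵘ.≤-trans
    (ℚᵘ.≤-reflexive (ℚᵘ.≃-sym (toℚ-average (proj₁ (best R V q V ((j , false) ∷ σ))) (proj₁ (best R V q V ((j , true) ∷ σ))))))
    (better-≥ˡ (branchOn j (best R V q V ((j , false) ∷ σ)) (best R V q V ((j , true) ∷ σ)))
               (best R V (suc q) vs σ))

best-depth : ∀ {n} (R : RDT n) V q vs σ → queryComplexity (proj₂ (best R V q vs σ)) ≤ q
best-depth R V zero    vs             σ = z≤n
best-depth R V (suc q) []             σ = z≤n
best-depth R V (suc q) ((i , _) ∷ vs) σ =
  better-elim (λ c → queryComplexity (proj₂ c) ≤ suc q)
    (branchOn i (best R V q V ((i , false) ∷ σ)) (best R V q V ((i , true) ∷ σ)))
    (best R V (suc q) vs σ)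
    (s≤s (⊔-lub (best-depth R V q V _) (best-depth R V q V _)))
    (best-depth R V (suc q) vs σ)

best-deterministic : ∀ {n} (R : RDT n) V q vs σ → randomness (proj₂ (best R V q vs σ)) ≡ 0
best-deterministic R V zero    vs             σ = refl
best-deterministic R V (suc q) []             σ = refl
best-deterministic R V (suc q) ((i , _) ∷ vs) σ =
  better-elim (λ c → randomness (proj₂ c) ≡ 0)
    (branchOn i (best R V q V ((i , false) ∷ σ)) (best R V q V ((i , true) ∷ σ)))
    (best R V (suc q) vs σ)
    (cong₂ _⊔_ (best-deterministic R V q V _) (best-deterministic R V q V _))
    (best-deterministic R V (suc q) vs σ)

-- The error of the best tree

sqError↾ : ∀ {n} → RDT n → RDT n → Restriction n → ℚᵘ
sqError↾ {n} D R σ = mean n (λ x → square (output D (restrict σ x) ⊖ output R (restrict σ x)))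

secondMoment : ∀ {n} → RDT n → Restriction n → ℚᵘ
secondMoment {n} R σ = mean n (λ x → square (output R (restrict σ x)))

-- The decomposition into bias and variance: expand the square and use that
-- μ is the mean of the expected output.
leaf-error : ∀ {n} v (R : RDT n) σ → let μ = toℚ (walk R [] σ) in
  sqError↾ (leaf v) R σ ⊕ μ ⊗ μ ≃ secondMoment R σ ⊕ square (value v ⊖ μ)
leaf-error {n} v R σ = ℚᵘ.≃-trans (ℚᵘ.+-congˡ (μ ⊗ μ) expand)
  (solve 3 (λ c m w → ((c :* c) :+ ((:- c :+ :- c) :* m :+ w)) :+ m :* m := w :+ (c :- m) :* (c :- m))
     ℚᵘ.≃-refl c μ (secondMoment R σ))
  where
  open +-*-Solver
  c = value v
  μ = toℚ (walk R [] σ)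
  g : Vec Bool n → ℚᵘ
  g x = output R (restrict σ x)
  k = ℚᵘ.- c ⊕ ℚᵘ.- c
  μ-mean : μ ≃ mean n g
  μ-mean = ℚᵘ.≃-trans (walk-correct R [] σ) (mean-cong n (λ x → ℚᵘ.*-identityʳ (g x)))
  expand : sqError↾ (leaf v) R σ ≃ c ⊗ c ⊕ (k ⊗ μ ⊕ secondMoment R σ)
  expand = ℚᵘ.≃-trans
    (mean-cong n (λ x → solve 2 (λ c g → (c :- g) :* (c :- g) := c :* c :+ ((:- c :+ :- c) :* g :+ g :* g)) ℚᵘ.≃-refl c (g x)))
    (ℚᵘ.≃-trans (mean-+ n (λ _ → c ⊗ c) (λ x → k ⊗ g x ⊕ square (g x)))
    (ℚᵘ.+-cong (mean-const n (c ⊗ c))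
    (ℚᵘ.≃-trans (mean-+ n (λ x → k ⊗ g x) (λ x → square (g x)))
      (ℚᵘ.+-congˡ (secondMoment R σ) (ℚᵘ.≃-trans (mean-* n k g) (ℚᵘ.*-congˡ {k} (ℚᵘ.≃-sym μ-mean)))))))

0≤square : ∀ a → 0ℚᵘ ℚᵘ.≤ square a
0≤square a with ℚᵘ.≤-total 0ℚᵘ a
... | inj₁ 0≤a = ℚᵘ.≤-trans (ℚᵘ.≤-reflexive (ℚᵘ.≃-sym (ℚᵘ.*-zeroˡ a)))
                   (ℚᵘ.*-monoˡ-≤-nonNeg a {{ℚᵘ.nonNegative 0≤a}} 0≤a)
... | inj₂ a≤0 = ℚᵘ.≤-trans (ℚᵘ.≤-reflexive (ℚᵘ.≃-sym (ℚᵘ.*-zeroˡ a)))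
                   (ℚᵘ.*-monoˡ-≤-nonPos a {{ℚᵘ.nonPositive a≤0}} a≤0)

-- On the half of the cube where x_i is b, the query to i is answered by b,
-- unless σ fixes i to the other value; in that case the answer does not matter
-- if both subtrees are equal.
sqError-split : ∀ {n} i (t₀ t₁ : RDT n) R σ → fixedTo σ i ≡ nothing ⊎ t₀ ≡ t₁ →
  sqError↾ (query i t₀ t₁) R σ
    ≃ ½ ⊗ (sqError↾ t₀ R ((i , false) ∷ σ) ⊕ sqError↾ t₁ R ((i , true) ∷ σ))
sqError-split {n} i t₀ t₁ R σ cond = ℚᵘ.≃-trans
  (mean-split (λ x → square (output (query i t₀ t₁) (restrict σ x) ⊖ output R (restrict σ x))) i)
  (average-cong (mean-cong n (branch false)) (mean-cong n (branch true)))
  where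
  resolve : fixedTo σ i ≡ nothing ⊎ t₀ ≡ t₁ → ∀ b x → output (query i t₀ t₁) (restrict ((i , b) ∷ σ) x)
                    ≡ output (if b then t₁ else t₀) (restrict ((i , b) ∷ σ) x)
  resolve (inj₁ free) false x = output-query i t₀ t₁ _ (lookup-fixed ((i , false) ∷ σ) x (fixedTo-head σ free))
  resolve (inj₁ free) true  x = output-query i t₀ t₁ _ (lookup-fixed ((i , true) ∷ σ) x (fixedTo-head σ free))
  resolve (inj₂ refl) b     x with lookup (restrict ((i , b) ∷ σ) x) i
  resolve (inj₂ refl) false x | false = refl
  resolve (inj₂ refl) false x | true  = refl
  resolve (inj₂ refl) true  x | false = refl
  resolve (inj₂ refl) true  x | true  = refl
  branch : ∀ b x → square (output (query i t₀ t₁) (restrict ((i , b) ∷ σ) x) ⊖ output R (restrict ((i , b) ∷ σ) x))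
                 ≃ square (output (if b then t₁ else t₀) (restrict ((i , b) ∷ σ) x) ⊖ output R (restrict ((i , b) ∷ σ) x))
  branch b x = ℚᵘ.≃-reflexive (cong (λ y → square (y ⊖ output R (restrict ((i , b) ∷ σ) x))) (resolve cond b x))

interchange : ∀ a b c d → ½ ⊗ ((a ⊕ b) ⊕ (c ⊕ d)) ≃ ½ ⊗ (a ⊕ c) ⊕ ½ ⊗ (b ⊕ d)
interchange = solve 5 (λ h a b c d → h :* ((a :+ b) :+ (c :+ d)) := h :* (a :+ c) :+ h :* (b :+ d)) ℚᵘ.≃-refl ½
  where open +-*-Solver

secondMoment-split : ∀ {n} (R : RDT n) σ i →
  secondMoment R σ ≃ ½ ⊗ (secondMoment R ((i , false) ∷ σ) ⊕ secondMoment R ((i , true) ∷ σ))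
secondMoment-split R σ i = mean-split (λ x → square (output R (restrict σ x))) i

-- A variable that is fixed already keeps its value, so both extensions
-- restrict the cube in the same way.
refixed : ∀ {n} (σ : Restriction n) {i b} → fixedTo σ i ≡ just b → ∀ j →
          fixedTo ((i , false) ∷ σ) j ≡ fixedTo ((i , true) ∷ σ) j
refixed σ {i} eq j with fixedTo σ j in eqⱼ
... | just _  = refl
... | nothing with i ≟ j
...   | no _ = refl
...   | yes refl with () ← trans (sym eq) eqⱼ

-- At a leaf labelled by the mean only the variance remains, and at a query
-- both sides are averages over the two halves.  If the queried variable was
-- fixed before, the two subtrees are equal by best-cong.
best-error : ∀ {n} {R : RDT n} {V} → Covers V R → ∀ q vs σ →
  sqError↾ (proj₂ (best R V q vs σ)) R σ ⊕ score (best R V q vs σ) ≃ secondMoment R σ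
best-error {n} {R} {V} covers = go
  where
  open +-*-Solver
  Attains : Restriction n → Candidate n → Set
  Attains σ c = sqError↾ (proj₂ c) R σ ⊕ score c ≃ secondMoment R σ
  constant-attains : ∀ σ → Attains σ (constant R σ)
  constant-attains σ = ℚᵘ.≃-trans
    (ℚᵘ.+-congʳ (sqError↾ (leaf (toLabel μ)) R σ) (toℚ-times μ μ))
    (ℚᵘ.≃-trans (leaf-error (toLabel μ) R σ)
      (solve 2 (λ w m → w :+ (m :- m) :* (m :- m) := w) ℚᵘ.≃-refl (secondMoment R σ) (toℚ μ)))
    where μ = walk R [] σ
  go : ∀ q vs σ → Attains σ (best R V q vs σ)
  go zero    vs             σ = constant-attains σ
  go (suc q) []             σ = constant-attains σ
  go (suc q) ((i , _) ∷ vs) σ = better-elim (Attains σ) (branchOn i c₀ c₁) (best R V (suc q) vs σ)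
    (ℚᵘ.≃-trans (ℚᵘ.+-cong (sqError-split i (proj₂ c₀) (proj₂ c₁) R σ free-or-same) (toℚ-average (proj₁ c₀) (proj₁ c₁)))
      (ℚᵘ.≃-trans (ℚᵘ.≃-sym (interchange e₀ (score c₀) e₁ (score c₁)))
      (ℚᵘ.≃-trans (average-cong (go q V ((i , false) ∷ σ)) (go q V ((i , true) ∷ σ)))
        (ℚᵘ.≃-sym (secondMoment-split R σ i)))))
    (go (suc q) vs σ)
    where
    c₀ = best R V q V ((i , false) ∷ σ)
    c₁ = best R V q V ((i , true) ∷ σ)
    e₀ = sqError↾ (proj₂ c₀) R ((i , false) ∷ σ)
    e₁ = sqError↾ (proj₂ c₁) R ((i , true) ∷ σ)
    free-or-same : fixedTo σ i ≡ nothing ⊎ proj₂ c₀ ≡ proj₂ c₁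
    free-or-same with fixedTo σ i in eq
    ... | nothing = inj₁ refl
    ... | just _  = inj₂ (cong proj₂ (best-cong q V covers (λ j _ → refixed σ eq j)))

-- Induction on the competitor D.  A leaf errs by at least the variance.  A
-- query to a variable fixed by σ is replaced by the subtree to which it leads.
-- A free variable of R is among those that best tries at the root.  Any other
-- free variable does not influence R, so that by best-cong its two halves have
-- the same best score as the whole, and averaging the two bounds suffices.
best-optimal : ∀ {n} {R : RDT n} {V} → Covers V R → ∀ (D : RDT n) q σ → randomness D ≤ 0 → queryComplexity D ≤ q →
  secondMoment R σ ℚᵘ.≤ sqError↾ D R σ ⊕ score (best R V q V σ)
best-optimal {n} {R} {V} covers (leaf v) q σ _ _ =
  ℚᵘ.≤-trans bias-variance
    (ℚᵘ.+-monoʳ-≤ (sqError↾ (leaf v) R σ)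
      (ℚᵘ.≤-trans (ℚᵘ.≤-reflexive (ℚᵘ.≃-sym (toℚ-times μ μ))) (best-≥-constant R V q V σ)))
  where
  μ = walk R [] σ
  bias-variance : secondMoment R σ ℚᵘ.≤ sqError↾ (leaf v) R σ ⊕ toℚ μ ⊗ toℚ μ
  bias-variance = ℚᵘ.≤-trans
    (ℚᵘ.≤-respˡ-≃ (ℚᵘ.+-identityʳ (secondMoment R σ))
      (ℚᵘ.+-monoʳ-≤ (secondMoment R σ) (0≤square (value v ⊖ toℚ μ))))
    (ℚᵘ.≤-reflexive (ℚᵘ.≃-sym (leaf-error v R σ)))
best-optimal {n} {R} {V} covers (query i t₀ t₁) (suc q) σ det (s≤s depth) = split (fixedTo σ i) refl
  where
  S : Restriction n → ℚᵘ
  S τ = score (best R V (suc q) V τ)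
  det₀ = m⊔n≤o⇒m≤o (randomness t₀) (randomness t₁) det
  det₁ = m⊔n≤o⇒n≤o (randomness t₀) (randomness t₁) det
  depth₀ = m⊔n≤o⇒m≤o (queryComplexity t₀) (queryComplexity t₁) depth
  depth₁ = m⊔n≤o⇒n≤o (queryComplexity t₀) (queryComplexity t₁) depth
  σ₀ = (i , false) ∷ σ
  σ₁ = (i , true) ∷ σ
  known : ∀ {b} → fixedTo σ i ≡ just b → sqError↾ (if b then t₁ else t₀) R σ ≃ sqError↾ (query i t₀ t₁) R σ
  known {false} eq = mean-cong n (λ x → ℚᵘ.≃-reflexive
    (cong (λ y → square (y ⊖ output R (restrict σ x))) (sym (output-query i t₀ t₁ (restrict σ x) (lookup-fixed σ x eq)))))
  known {true}  eq = mean-cong n (λ x → ℚᵘ.≃-reflexive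
    (cong (λ y → square (y ⊖ output R (restrict σ x))) (sym (output-query i t₀ t₁ (restrict σ x) (lookup-fixed σ x eq)))))
  halves : fixedTo σ i ≡ nothing → ∀ {s₀ s₁} →
    secondMoment R σ₀ ℚᵘ.≤ sqError↾ t₀ R σ₀ ⊕ s₀ → secondMoment R σ₁ ℚᵘ.≤ sqError↾ t₁ R σ₁ ⊕ s₁ →
    secondMoment R σ ℚᵘ.≤ sqError↾ (query i t₀ t₁) R σ ⊕ ½ ⊗ (s₀ ⊕ s₁)
  halves free {s₀} {s₁} le₀ le₁ = ℚᵘ.≤-trans
    (ℚᵘ.≤-respˡ-≃ (ℚᵘ.≃-sym (secondMoment-split R σ i)) (average-mono le₀ le₁))
    (ℚᵘ.≤-reflexive (ℚᵘ.≃-trans (interchange (sqError↾ t₀ R σ₀) s₀ (sqError↾ t₁ R σ₁) s₁)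
      (ℚᵘ.+-congˡ (½ ⊗ (s₀ ⊕ s₁)) (ℚᵘ.≃-sym (sqError-split i t₀ t₁ R σ (inj₁ free))))))
  -- Both halves are compared with the whole at the same depth, as the query was
  -- of no use.
  unlisted : (∀ b → fixedTo V i ≢ just b) → ∀ b → S ((i , b) ∷ σ) ≡ S σ
  unlisted i∉V b = cong score (best-cong (suc q) V covers agree)
    where
    agree : Agree V ((i , b) ∷ σ) σ
    agree j (c , eq) with fixedTo σ j
    ... | just _  = refl
    ... | nothing with i ≟ j
    ...   | yes refl = ⊥-elim (i∉V c eq)
    ...   | no _     = refl
  split : ∀ m → fixedTo σ i ≡ m → secondMoment R σ ℚᵘ.≤ sqError↾ (query i t₀ t₁) R σ ⊕ S σ
  split (just false) eq = ℚᵘ.≤-trans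
    (best-optimal covers t₀ (suc q) σ det₀ (m≤n⇒m≤1+n depth₀))
    (ℚᵘ.≤-reflexive (ℚᵘ.+-congˡ (S σ) (known eq)))
  split (just true) eq = ℚᵘ.≤-trans
    (best-optimal covers t₁ (suc q) σ det₁ (m≤n⇒m≤1+n depth₁))
    (ℚᵘ.≤-reflexive (ℚᵘ.+-congˡ (S σ) (known eq)))
  split nothing free with fixedTo V i in inV
  ... | just b = ℚᵘ.≤-trans
    (halves free (best-optimal covers t₀ q σ₀ det₀ depth₀) (best-optimal covers t₁ q σ₁ det₁ depth₁))
    (ℚᵘ.+-monoʳ-≤ (sqError↾ (query i t₀ t₁) R σ) (best-≥-branch R V q V σ (b , inV)))
  ... | nothing = ℚᵘ.≤-trans
    (halves free
      (best-optimal covers t₀ (suc q) σ₀ det₀ (m≤n⇒m≤1+n depth₀))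
      (best-optimal covers t₁ (suc q) σ₁ det₁ (m≤n⇒m≤1+n depth₁)))
    (ℚᵘ.+-monoʳ-≤ (sqError↾ (query i t₀ t₁) R σ)
      (ℚᵘ.≤-reflexive (ℚᵘ.≃-trans
        (ℚᵘ.≃-reflexive (cong₂ (λ a b → ½ ⊗ (a ⊕ b)) (unlisted absent false) (unlisted absent true)))
        (average-self (S σ)))))
    where
    absent : ∀ b → fixedTo V i ≢ just b
    absent b eq with () ← trans (sym inV) eq

-- Exact trees

weaken : ∀ {n} → RDT n → RDT (suc n)
weaken (leaf v)        = leaf v
weaken (query i t₀ t₁) = query (suc i) (weaken t₀) (weaken t₁)
weaken (flip t₀ t₁)    = flip (weaken t₀) (weaken t₁)

table : ∀ n → (Vec Bool n → Label) → RDT n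
table zero    f = leaf (f [])
table (suc n) f = query zero (weaken (table n (λ x → f (false ∷ x)))) (weaken (table n (λ x → f (true ∷ x))))

output-weaken : ∀ {n} (t : RDT n) b x → output (weaken t) (b ∷ x) ≡ output t x
output-weaken (leaf v)        b x = refl
output-weaken (query i t₀ t₁) b x with lookup x i
... | true  = output-weaken t₁ b x
... | false = output-weaken t₀ b x
output-weaken (flip t₀ t₁)    b x = cong₂ (λ a c → ½ ⊗ (a ⊕ c)) (output-weaken t₀ b x) (output-weaken t₁ b x)

randomness-weaken : ∀ {n} (t : RDT n) → randomness (weaken t) ≡ randomness t
randomness-weaken (leaf v)        = refl
randomness-weaken (query i t₀ t₁) = cong₂ _⊔_ (randomness-weaken t₀) (randomness-weaken t₁)
randomness-weaken (flip t₀ t₁)    = cong suc (cong₂ _⊔_ (randomness-weaken t₀) (randomness-weaken t₁))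

queryComplexity-weaken : ∀ {n} (t : RDT n) → queryComplexity (weaken t) ≡ queryComplexity t
queryComplexity-weaken (leaf v)        = refl
queryComplexity-weaken (query i t₀ t₁) = cong suc (cong₂ _⊔_ (queryComplexity-weaken t₀) (queryComplexity-weaken t₁))
queryComplexity-weaken (flip t₀ t₁)    = cong₂ _⊔_ (queryComplexity-weaken t₀) (queryComplexity-weaken t₁)

output-table : ∀ n f x → output (table n f) x ≡ value (f x)
output-table zero    f []          = refl
output-table (suc n) f (false ∷ x) = trans (output-weaken (table n _) false x) (output-table n _ x)
output-table (suc n) f (true ∷ x)  = trans (output-weaken (table n _) true x) (output-table n _ x)

randomness-table : ∀ n f → randomness (table n f) ≡ 0
randomness-table zero    f = refl
randomness-table (suc n) f = cong₂ _⊔_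
  (trans (randomness-weaken (table n _)) (randomness-table n _))
  (trans (randomness-weaken (table n _)) (randomness-table n _))

queryComplexity-table : ∀ n f → queryComplexity (table n f) ≤ n
queryComplexity-table zero    f = z≤n
queryComplexity-table (suc n) f = s≤s (⊔-lub
  (≤-trans (≤-reflexive (queryComplexity-weaken (table n _))) (queryComplexity-table n _))
  (≤-trans (≤-reflexive (queryComplexity-weaken (table n _))) (queryComplexity-table n _)))

outputFraction : ∀ {n} → RDT n → Vec Bool n → Frac
outputFraction (leaf v)        x = fromLabel v
outputFraction (query i t₀ t₁) x = if lookup x i then outputFraction t₁ x else outputFraction t₀ x
outputFraction (flip t₀ t₁)    x = average (outputFraction t₀ x) (outputFraction t₁ x)

toℚ-outputFraction : ∀ {n} (t : RDT n) x → toℚ (outputFraction t x) ≃ output t x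
toℚ-outputFraction (leaf v)        x = ℚᵘ.≃-reflexive (toℚ-fromLabel v)
toℚ-outputFraction (query i t₀ t₁) x with lookup x i
... | true  = toℚ-outputFraction t₁ x
... | false = toℚ-outputFraction t₀ x
toℚ-outputFraction (flip t₀ t₁)    x =
  ℚᵘ.≃-trans (toℚ-average (outputFraction t₀ x) (outputFraction t₁ x))
             (average-cong (toℚ-outputFraction t₀ x) (toℚ-outputFraction t₁ x))

-- The tree that reads all variables has error zero.  Therefore the search
-- stops at some q⋆ ≤ n; for n ≤ 1, where powers of n are no larger than 1, the
-- time bound depends on this.
Approximable-n : ∀ {n} (R : RDT n) {ε} → 0ℚᵘ ℚᵘ.≤ ε → Approximable ε R n
Approximable-n {n} R {ε} 0≤ε = D , queryComplexity-table n f , ℚᵘ.≤-trans (ℚᵘ.≤-reflexive exact) 0≤ε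
  where
  f : Vec Bool n → Label
  f x = toLabel (outputFraction R x)
  D : DDT n
  D = mkDDT (table n f) (randomness-table n f)
  exact : sqError D R ≃ 0ℚᵘ
  exact = ℚᵘ.≃-trans (sqError-output D R) (ℚᵘ.≃-trans (mean-cong n zero-error) (mean-const n 0ℚᵘ))
    where
    open +-*-Solver
    zero-error : ∀ x → square (output (table n f) x ⊖ output R x) ≃ 0ℚᵘ
    zero-error x = ℚᵘ.≃-trans
      (square-cong (ℚᵘ.≃-trans (ℚᵘ.+-congˡ (ℚᵘ.- output R x)
        (ℚᵘ.≃-trans (ℚᵘ.≃-reflexive (output-table n f x)) (toℚ-outputFraction R x))) (ℚᵘ.+-inverseʳ (output R x))))
      (*≡* refl)

-- The stopping test

module Search {n} (R : RDT n) (ε : Frac) where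

  V : Restriction n
  V = variables R []

  candidate : ℕ → Candidate n
  candidate q = best R V q V []

  -- Acceptance means that the second moment is at most ε plus the score.
  -- Both sides are halved, so that they are fractions between 0 and 1 and the
  -- sum becomes an average.
  halfMoment : Frac
  halfMoment = average (walk R (R ∷ []) []) nought

  accepts : ℕ → Bool
  accepts q = leq halfMoment (average ε (proj₁ (candidate q)))

  tree-of : ℕ → DDT n
  tree-of q = mkDDT (proj₂ (candidate q)) (best-deterministic R V q V [])

  private
    m₂ = secondMoment R []

    covers : Covers V R
    covers = variables-Covers R []

    +-cancelʳ : ∀ {a b c} → a ⊕ c ℚᵘ.≤ b ⊕ c → a ℚᵘ.≤ b
    +-cancelʳ {a} {b} {c} le = ℚᵘ.≤-respˡ-≃ (undo a) (ℚᵘ.≤-respʳ-≃ (undo b) (ℚᵘ.+-monoˡ-≤ (ℚᵘ.- c) le))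
      where
      open +-*-Solver
      undo : ∀ a → (a ⊕ c) ⊖ c ≃ a
      undo a = solve 2 (λ a c → (a :+ c) :- c := a) ℚᵘ.≃-refl a c

    half-cancel : ∀ {a b} → ½ ⊗ (a ⊕ 0ℚᵘ) ℚᵘ.≤ ½ ⊗ b → a ℚᵘ.≤ b
    half-cancel {a} le = ℚᵘ.≤-respˡ-≃ (ℚᵘ.+-identityʳ a) (ℚᵘ.*-cancelˡ-≤-pos ½ le)

    toℚ-halfMoment : toℚ halfMoment ≃ ½ ⊗ (m₂ ⊕ 0ℚᵘ)
    toℚ-halfMoment = ℚᵘ.≃-trans (toℚ-average (walk R (R ∷ []) []) nought) (average-cong
      (ℚᵘ.≃-trans (walk-correct R (R ∷ []) []) (mean-cong n (λ x → ℚᵘ.*-congˡ {output R x} (ℚᵘ.*-identityʳ (output R x)))))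
      (ℚᵘ.≃-refl {0ℚᵘ}))

  accepts⇒ : ∀ q → accepts q ≡ true → m₂ ℚᵘ.≤ toℚ ε ⊕ score (candidate q)
  accepts⇒ q eq = half-cancel (ℚᵘ.≤-trans (ℚᵘ.≤-reflexive (ℚᵘ.≃-sym toℚ-halfMoment))
    (ℚᵘ.≤-trans (leq-true halfMoment (average ε (proj₁ (candidate q))) eq)
                (ℚᵘ.≤-reflexive (toℚ-average ε (proj₁ (candidate q))))))

  accepted-Approximates : ∀ q → accepts q ≡ true → Approximates (toℚ ε) (tree-of q) R
  accepted-Approximates q eq = ℚᵘ.≤-respˡ-≃ (ℚᵘ.≃-sym (sqError-output (tree-of q) R))
    (+-cancelʳ (ℚᵘ.≤-respˡ-≃ (ℚᵘ.≃-sym (best-error covers q V [])) (accepts⇒ q eq)))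

  Approximable-accepted : ∀ q → Approximable (toℚ ε) R q → accepts q ≡ true
  Approximable-accepted q (D , depth , approx) = leq-complete halfMoment (average ε (proj₁ (candidate q)))
    (ℚᵘ.≤-trans (ℚᵘ.≤-reflexive toℚ-halfMoment)
    (ℚᵘ.≤-trans (ℚᵘ.*-monoʳ-≤-nonNeg ½ (ℚᵘ.≤-respˡ-≃ (ℚᵘ.≃-sym (ℚᵘ.+-identityʳ m₂)) bound))
                (ℚᵘ.≤-reflexive (ℚᵘ.≃-sym (toℚ-average ε (proj₁ (candidate q)))))))
    where
    bound : m₂ ℚᵘ.≤ toℚ ε ⊕ score (candidate q)
    bound = ℚᵘ.≤-trans (best-optimal covers (tree D) q [] (≤-reflexive (noStochastic D)) depth)
      (ℚᵘ.+-monoˡ-≤ (score (candidate q)) (ℚᵘ.≤-respˡ-≃ (sqError-output D R) approx))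

-- Counting calls

-- Between two calls an evaluation takes at most as many steps as the body has
-- nodes, so counting calls bounds the time up to a constant factor.  The judgement
-- ρ ⊢ e ⇓ d # k ⟶ k′ threads a counter through the evaluation, from k before
-- to k′ after it; Runs f d₁ d₂ c says that f maps d₁ to d₂ with at most c
-- further calls.  The counter may exceed the true count, since the cost c of a
-- call is only an upper bound.
module CallCounting (P : Program) where

  mutual
    data _⊢_⇓_#_⟶_ {V} (ρ : Vec 𝔻 V) : Exp (suc (auxiliaries P)) V → 𝔻 → ℕ → ℕ → Set where
      var : ∀ {i k} → ρ ⊢ var i ⇓ lookup ρ i # k ⟶ k
      nil : ∀ {k} → ρ ⊢ nil ⇓ nil # k ⟶ k
      cons : ∀ {e₁ e₂ d₁ d₂ k k₁ k₂} →
             ρ ⊢ e₁ ⇓ d₁ # k ⟶ k₁ → ρ ⊢ e₂ ⇓ d₂ # k₁ ⟶ k₂ → ρ ⊢ cons e₁ e₂ ⇓ cons d₁ d₂ # k ⟶ k₂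
      case-nil : ∀ {e e₁ e₂ d k k₁ k₂} →
             ρ ⊢ e ⇓ nil # k ⟶ k₁ → ρ ⊢ e₁ ⇓ d # k₁ ⟶ k₂ → ρ ⊢ case e e₁ e₂ ⇓ d # k ⟶ k₂
      case-cons : ∀ {e e₁ e₂ h l d k k₁ k₂} →
             ρ ⊢ e ⇓ cons h l # k ⟶ k₁ → (h ∷ l ∷ ρ) ⊢ e₂ ⇓ d # k₁ ⟶ k₂ → ρ ⊢ case e e₁ e₂ ⇓ d # k ⟶ k₂
      let′ : ∀ {e₁ e₂ d₁ d₂ k k₁ k₂} →
             ρ ⊢ e₁ ⇓ d₁ # k ⟶ k₁ → (d₁ ∷ ρ) ⊢ e₂ ⇓ d₂ # k₁ ⟶ k₂ → ρ ⊢ let′ e₁ e₂ ⇓ d₂ # k ⟶ k₂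
      call : ∀ {f e d₁ d₂ k k₁ c} →
             ρ ⊢ e ⇓ d₁ # k ⟶ k₁ → Runs f d₁ d₂ c → ρ ⊢ call f e ⇓ d₂ # k ⟶ suc (k₁ + c)

    data Runs (f : Fin (suc (auxiliaries P))) (d₁ d₂ : 𝔻) (c : ℕ) : Set where
      runs : ∀ {k} → (d₁ ∷ []) ⊢ lookup (bodies P) f ⇓ d₂ # 0 ⟶ k → k ≤ c → Runs f d₁ d₂ c

  ∣_∣ᵉ : ∀ {F V} → Exp F V → ℕ
  ∣ var _ ∣ᵉ       = 1
  ∣ nil ∣ᵉ         = 1
  ∣ cons e e′ ∣ᵉ   = suc (∣ e ∣ᵉ + ∣ e′ ∣ᵉ)
  ∣ case e e₁ e₂ ∣ᵉ = suc (∣ e ∣ᵉ + (∣ e₁ ∣ᵉ + ∣ e₂ ∣ᵉ))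
  ∣ let′ e e′ ∣ᵉ   = suc (∣ e ∣ᵉ + ∣ e′ ∣ᵉ)
  ∣ call _ e ∣ᵉ    = suc ∣ e ∣ᵉ

  totalSize : ∀ {F V m} → Vec (Exp F V) m → ℕ
  totalSize []       = 0
  totalSize (e ∷ es) = ∣ e ∣ᵉ + totalSize es

  lookup≤totalSize : ∀ {F V m} (es : Vec (Exp F V) m) f → ∣ lookup es f ∣ᵉ ≤ totalSize es
  lookup≤totalSize (e ∷ es) zero    = m≤m+n ∣ e ∣ᵉ (totalSize es)
  lookup≤totalSize (e ∷ es) (suc f) = ≤-trans (lookup≤totalSize es f) (m≤n+m (totalSize es) ∣ e ∣ᵉ)

  -- The steps charged for one call, enough to evaluate any body.
  abstract
    callPrice : ℕ
    callPrice = totalSize (bodies P)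

    body≤callPrice : ∀ f → ∣ lookup (bodies P) f ∣ᵉ ≤ callPrice
    body≤callPrice = lookup≤totalSize (bodies P)

  private
    chain : ∀ t₁ t₂ {e₁ e₂ k k₁ k₂} →
            t₁ + callPrice * k ≤ e₁ + callPrice * k₁ → t₂ + callPrice * k₁ ≤ e₂ + callPrice * k₂ →
            suc (t₁ + t₂) + callPrice * k ≤ suc (e₁ + e₂) + callPrice * k₂
    chain t₁ t₂ {e₁} {e₂} {k} {k₁} {k₂} p q = s≤s (begin
      t₁ + t₂ + callPrice * k     ≡⟨ r₁ t₁ t₂ (callPrice * k) ⟩
      t₂ + (t₁ + callPrice * k)   ≤⟨ +-monoʳ-≤ t₂ p ⟩
      t₂ + (e₁ + callPrice * k₁)  ≡⟨ r₂ t₂ e₁ (callPrice * k₁) ⟩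
      e₁ + (t₂ + callPrice * k₁)  ≤⟨ +-monoʳ-≤ e₁ q ⟩
      e₁ + (e₂ + callPrice * k₂)  ≡⟨ +-assoc e₁ e₂ (callPrice * k₂) ⟨
      e₁ + e₂ + callPrice * k₂    ∎)
      where
      open ≤-Reasoning
      r₁ : ∀ a b c → a + b + c ≡ b + (a + c)
      r₁ = solve-∀
      r₂ : ∀ a b c → a + (b + c) ≡ b + (a + c)
      r₂ = solve-∀

  mutual
    -- Each construct adds one step and one node of the expression; a call adds
    -- the steps of a body, which the increment of the counter pays for.
    timed : ∀ {V} {ρ : Vec 𝔻 V} {e d k k′} → ρ ⊢ e ⇓ d # k ⟶ k′ →
            ∃[ t ] (P ∣ ρ ⊢ e ⇓ d ⟨ t ⟩ × t + callPrice * k ≤ ∣ e ∣ᵉ + callPrice * k′)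
    timed (var {i}) = 1 , var i , ≤-refl
    timed nil = 1 , nil , ≤-refl
    timed (cons p q) with t₁ , p′ , p≤ ← timed p | t₂ , q′ , q≤ ← timed q =
      _ , cons p′ q′ , chain t₁ t₂ p≤ q≤
    timed (case-nil {e₁ = e₁} {e₂} {k₂ = k₂} p q) with t₁ , p′ , p≤ ← timed p | t₂ , q′ , q≤ ← timed q =
      _ , case-nil p′ q′ , chain t₁ t₂ p≤ (≤-trans q≤ (+-monoˡ-≤ (callPrice * k₂) (m≤m+n ∣ e₁ ∣ᵉ ∣ e₂ ∣ᵉ)))
    timed (case-cons {e₁ = e₁} {e₂} {k₂ = k₂} p q) with t₁ , p′ , p≤ ← timed p | t₂ , q′ , q≤ ← timed q =
      _ , case-cons p′ q′ , chain t₁ t₂ p≤ (≤-trans q≤ (+-monoˡ-≤ (callPrice * k₂) (m≤n+m ∣ e₂ ∣ᵉ ∣ e₁ ∣ᵉ)))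
    timed (let′ p q) with t₁ , p′ , p≤ ← timed p | t₂ , q′ , q≤ ← timed q =
      _ , let′ p′ q′ , chain t₁ t₂ p≤ q≤
    timed (call {e = e} {k = k} {k₁} {c} p q) with t₁ , p′ , p≤ ← timed p | t₂ , q′ , q≤ ← timedCall q =
      _ , call p′ q′ , s≤s (begin
        t₁ + t₂ + callPrice * k                     ≡⟨ r t₁ t₂ (callPrice * k) ⟩
        t₁ + callPrice * k + t₂                     ≤⟨ +-mono-≤ p≤ q≤ ⟩
        ∣ e ∣ᵉ + callPrice * k₁ + callPrice * suc c ≡⟨ s ∣ e ∣ᵉ callPrice k₁ c ⟩
        ∣ e ∣ᵉ + callPrice * suc (k₁ + c)           ∎)
      where
      open ≤-Reasoning
      r : ∀ a b c → a + b + c ≡ a + c + b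
      r = solve-∀
      s : ∀ a p k c → a + p * k + p * (1 + c) ≡ a + p * (1 + (k + c))
      s = solve-∀

    timedCall : ∀ {f d₁ d₂ c} → Runs f d₁ d₂ c →
                ∃[ t ] (P ∣ d₁ ∷ [] ⊢ lookup (bodies P) f ⇓ d₂ ⟨ t ⟩ × t ≤ callPrice * suc c)
    timedCall {f} {c = c} (runs {k} p k≤c) with t , p′ , p≤ ← timed p = t , p′ , (begin
      t                                          ≤⟨ m≤m+n t (callPrice * 0) ⟩
      t + callPrice * 0                          ≤⟨ p≤ ⟩
      ∣ lookup (bodies P) f ∣ᵉ + callPrice * k   ≤⟨ +-mono-≤ (body≤callPrice f) (*-monoʳ-≤ callPrice k≤c) ⟩
      callPrice + callPrice * c                  ≡⟨ *-suc callPrice c ⟨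
      callPrice * suc c                          ∎)
      where open ≤-Reasoning

-- Encodings

encodeBool : Bool → 𝔻
encodeBool false = nil
encodeBool true  = cons nil nil

encodeMaybe : Maybe Bool → 𝔻
encodeMaybe nothing  = nil
encodeMaybe (just b) = cons (encodeBool b) nil

encodeRestriction : ∀ {n} → Restriction n → 𝔻
encodeRestriction []            = nil
encodeRestriction ((i , b) ∷ σ) = cons (cons (encodeℕ (toℕ i)) (encodeBool b)) (encodeRestriction σ)

encodeForest : ∀ {n} → List (RDT n) → 𝔻
encodeForest []       = nil
encodeForest (t ∷ ts) = cons (encodeRDT t) (encodeForest ts)

encodeFrac : Frac → 𝔻
encodeFrac f = encodeℚ (toℚ f)

encodeCandidate : ∀ {n} → Candidate n → 𝔻
encodeCandidate (s , t) = cons (encodeFrac s) (encodeRDT t)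

-- The depth bound is only counted down, so unary notation suffices.
encodeUnary : ℕ → 𝔻
encodeUnary zero    = nil
encodeUnary (suc q) = cons nil (encodeUnary q)

-- The program

fn-main fn-suc fn-add fn-mul fn-compare fn-average fn-times fn-leq fn-fixedTo fn-walk fn-variables
  fn-constant fn-best fn-search : Fin 14
fn-main      = # 0
fn-suc       = # 1
fn-add       = # 2
fn-mul       = # 3
fn-compare   = # 4
fn-average   = # 5
fn-times     = # 6
fn-leq       = # 7
fn-fixedTo   = # 8
fn-walk      = # 9
fn-variables = # 10
fn-constant  = # 11
fn-best      = # 12
fn-search    = # 13

private
  -- Variables are de Bruijn indices; split binds the head of a pair to index 0
  -- and its tail to index 1.  A function of several arguments takes nested pairs.
  -- Digits 1 and 2 are encoded as nil and one.
  Code : ℕ → Set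
  Code = Exp 14

  v : ∀ {V} (i : ℕ) {i<V : _} → Code V
  v {V} i {i<V} = var (#_ i {V} {i<V})

  split : ∀ {V} → Code V → Code (2 + V) → Code V
  split e b = case e nil b

  one : ∀ {V} → Code V
  one = cons nil nil

main-body suc-body add-body mul-body compare-body average-body times-body leq-body fixedTo-body walk-body
  variables-body constant-body best-body search-body : Exp 14 1

suc-body =
  case (v 0) one
    (case (v 0) (cons one (v 1))
      (cons nil (call fn-suc (v 3))))

-- (x , y) ↦ x + y, digit by digit; a carry is a call of the successor.
-- In the innermost branches the digits and remaining digits of y and of x are
-- at the indices 0 to 3, shifted by two for every case entered since.
add-body =
  split (v 0)
    (case (v 0) (v 1)
      (case (v 3) (v 2)
        (case (v 2)
          (case (v 0)
            (cons one (call fn-add (cons (v 3) (v 1))))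
            (cons nil (call fn-suc (call fn-add (cons (v 5) (v 3))))))
          (case (v 2)
            (cons nil (call fn-suc (call fn-add (cons (v 5) (v 3)))))
            (cons one (call fn-suc (call fn-add (cons (v 7) (v 5)))))))))

-- (x , y) ↦ x * y by Horner's scheme on the digits of x: with z the product of
-- the remaining digits of x and y, the result is y + 2 z if the first digit is 1
-- and 2 (y + z) if it is 2.
mul-body =
  split (v 0)
    (case (v 0) nil
      (let′ (call fn-mul (cons (v 1) (v 3)))
        (case (v 1)
          (call fn-add (cons (v 4) (call fn-add (cons (v 0) (v 0)))))
          (let′ (call fn-add (cons (v 6) (v 2)))
            (call fn-add (cons (v 0) (v 0)))))))

-- Less, equal and greater are returned as nil, one and cons one nil.  The
-- remaining, more significant digits are compared first; the least significant
-- ones decide if these agree.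
compare-body =
  split (v 0)
    (case (v 0)
      (case (v 1) one nil)
      (case (v 3) (cons one nil)
        (let′ (call fn-compare (cons (v 3) (v 1)))
          (case (v 0) nil
            (case (v 0)
              (case (v 5)
                (case (v 3) one nil)
                (case (v 5) (cons one nil) one))
              (v 4))))))

-- ((p , d) , (r , e)) ↦ (p e + r d , d e + d e)
average-body =
  split (v 0) (split (v 0) (split (v 3)
    (let′ (call fn-mul (cons (v 3) (v 1)))
      (cons (call fn-add (cons (call fn-mul (cons (v 3) (v 2))) (call fn-mul (cons (v 1) (v 4)))))
            (call fn-add (cons (v 0) (v 0)))))))

times-body =
  split (v 0) (split (v 0) (split (v 3)
    (cons (call fn-mul (cons (v 2) (v 0))) (call fn-mul (cons (v 3) (v 1))))))

-- ((p , d) , (r , e)) ↦ the truth value of p e ≤ r d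
leq-body =
  split (v 0) (split (v 0) (split (v 3)
    (case (call fn-compare (cons (call fn-mul (cons (v 2) (v 1))) (call fn-mul (cons (v 0) (v 3)))))
      one
      (case (v 0) one nil))))

-- (j , σ) ↦ the value to which σ fixes j.  The rest of the list is consulted
-- first, since older entries win.
fixedTo-body =
  split (v 0)
    (case (v 1) nil
      (let′ (call fn-fixedTo (cons (v 2) (v 1)))
        (case (v 0)
          (split (v 1)
            (case (call fn-compare (cons (v 0) (v 5))) nil
              (case (v 0) (cons (v 3) nil) nil)))
          (v 2))))

-- (t , (ts , σ)) ↦ walk t ts σ.  The tag of the node is nil for a leaf,
-- cons nil nil for a coin flip and cons one nil for a query.
walk-body =
  split (v 0) (split (v 1) (split (v 2)
    (case (v 0)
      (case (v 2) (v 1)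
        (call fn-times (cons (v 3) (call fn-walk (cons (v 0) (cons (v 1) (v 5)))))))
      (case (v 0)
        (split (v 3)
          (call fn-average (cons (call fn-walk (cons (v 0) (cons (v 6) (v 7))))
                                 (call fn-walk (cons (v 1) (cons (v 6) (v 7)))))))
        (split (v 5) (split (v 1)
          (case (call fn-fixedTo (cons (v 2) (v 11)))
            (call fn-average
              (cons (call fn-walk (cons (v 0) (cons (v 10) (cons (cons (v 2) nil) (v 11)))))
                    (call fn-walk (cons (v 1) (cons (v 10) (cons (cons (v 2) one) (v 11)))))))
            (case (v 0)
              (call fn-walk (cons (v 2) (cons (v 12) (v 13))))
              (call fn-walk (cons (v 5) (cons (v 14) (v 15))))))))))))

-- (t , V) ↦ variables t V
variables-body =
  split (v 0) (split (v 0)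
    (case (v 0) (v 3)
      (case (v 0)
        (split (v 3)
          (call fn-variables (cons (v 1) (call fn-variables (cons (v 0) (v 7))))))
        (split (v 5) (split (v 1)
          (call fn-variables (cons (v 1) (call fn-variables (cons (v 0)
            (case (call fn-fixedTo (cons (v 2) (v 11)))
              (cons (cons (v 2) nil) (v 11))
              (v 13)))))))))))

constant-body =
  split (v 0)
    (let′ (call fn-walk (cons (v 0) (cons nil (v 1))))
      (cons (call fn-times (cons (v 0) (v 0))) (cons nil (v 0))))

-- ((R , V) , (q , (vs , σ))) ↦ best R V q vs σ.  The three recursive calls
-- yield the candidate from the remaining variables and the candidates for the
-- two answers, in this order.
best-body =
  split (v 0) (split (v 1) (split (v 1) (split (v 4)
    (case (v 4)
      (call fn-constant (cons (v 0) (v 3)))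
      (case (v 4)
        (call fn-constant (cons (v 2) (v 5)))
        (split (v 0)
          (let′ (call fn-best (cons (v 12) (cons (v 10) (cons (v 3) (v 9)))))
          (let′ (call fn-best (cons (v 13) (cons (v 6) (cons (v 8) (cons (cons (v 1) nil) (v 10))))))
          (let′ (call fn-best (cons (v 14) (cons (v 7) (cons (v 9) (cons (cons (v 2) one) (v 11))))))
            (split (v 1) (split (v 2) (split (v 6)
              (let′ (call fn-average (cons (v 4) (v 2)))
                (case (call fn-leq (cons (v 0) (v 1)))
                  (cons (v 0) (cons (cons one nil) (cons (v 10) (cons (v 6) (v 4)))))
                  (v 11)))))))))))))))

-- ((R , V) , (q , (h , ε))) ↦ the best tree for the first accepted depth from
-- q on, where h is half the second moment
search-body =
  split (v 0) (split (v 1) (split (v 1) (split (v 4)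
    (let′ (call fn-best (cons (v 6) (cons (v 4) (cons (v 1) nil))))
      (split (v 0)
        (case (call fn-leq (cons (v 5) (call fn-average (cons (v 6) (v 0)))))
          (call fn-search (cons (v 9) (cons (cons nil (v 7)) (v 8))))
          (v 3)))))))

main-body =
  split (v 0)
    (let′ (call fn-variables (cons (v 0) nil))
      (let′ (call fn-average (cons (call fn-walk (cons (v 1) (cons (cons (v 1) nil) nil))) (cons nil one)))
        (call fn-search (cons (cons (v 2) (v 1)) (cons nil (cons (v 0) (v 3)))))))

instanceOpt : Program
instanceOpt = program 13
  (main-body ∷ suc-body ∷ add-body ∷ mul-body ∷ compare-body ∷ average-body ∷ times-body ∷ leq-body ∷
   fixedTo-body ∷ walk-body ∷ variables-body ∷ constant-body ∷ best-body ∷ search-body ∷ [])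

open CallCounting instanceOpt

-- Binary arithmetic

bits : ℕᵇ → ℕ
bits = ℕᵇ.size

bits-suc : ∀ x → bits (ℕᵇ.suc x) ≤ suc (bits x)
bits-suc zero     = ≤-refl
bits-suc 2[1+ x ] = s≤s (bits-suc x)
bits-suc 1+[2 x ] = n≤1+n _

bits-carry : ∀ x y → bits (x ℕᵇ.+ y) ≤ bits x + bits y → bits (ℕᵇ.suc (x ℕᵇ.+ y)) ≤ bits x + suc (bits y)
bits-carry x y p = ≤-trans (bits-suc (x ℕᵇ.+ y)) (≤-trans (s≤s p) (≤-reflexive (sym (+-suc (bits x) (bits y)))))

bits-+ : ∀ x y → bits (x ℕᵇ.+ y) ≤ bits x + bits y
bits-+ zero     y        = ≤-refl
bits-+ 2[1+ x ] zero     = m≤m+n _ 0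
bits-+ 1+[2 x ] zero     = m≤m+n _ 0
bits-+ 2[1+ x ] 2[1+ y ] = s≤s (bits-carry x y (bits-+ x y))
bits-+ 2[1+ x ] 1+[2 y ] = s≤s (bits-carry x y (bits-+ x y))
bits-+ 1+[2 x ] 2[1+ y ] = s≤s (bits-carry x y (bits-+ x y))
bits-+ 1+[2 x ] 1+[2 y ] = s≤s (≤-trans (bits-+ x y) (+-monoʳ-≤ (bits x) (n≤1+n (bits y))))

-- In bijective base 2, the numbers with b digits are those from 2^b - 1 to
-- 2^(b+1) - 2.
2^bits≤1+ : ∀ x → 2 ^ bits x ≤ suc (ℕᵇ.toℕ x)
2^bits≤1+ zero     = ≤-refl
2^bits≤1+ 2[1+ x ] = ≤-trans (*-monoʳ-≤ 2 (2^bits≤1+ x)) (n≤1+n _)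
2^bits≤1+ 1+[2 x ] = ≤-trans (*-monoʳ-≤ 2 (2^bits≤1+ x)) (≤-reflexive (r (ℕᵇ.toℕ x)))
  where
  r : ∀ a → 2 * (1 + a) ≡ 1 + (1 + 2 * a)
  r = solve-∀

<2^1+bits : ∀ x → 2 + ℕᵇ.toℕ x ≤ 2 ^ suc (bits x)
<2^1+bits zero     = ≤-refl
<2^1+bits 2[1+ x ] = ≤-trans (≤-reflexive (r (ℕᵇ.toℕ x))) (*-monoʳ-≤ 2 (<2^1+bits x))
  where
  r : ∀ a → 2 + 2 * (1 + a) ≡ 2 * (2 + a)
  r = solve-∀
<2^1+bits 1+[2 x ] = ≤-trans (≤-trans (n≤1+n _) (≤-reflexive (r (ℕᵇ.toℕ x)))) (*-monoʳ-≤ 2 (<2^1+bits x))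
  where
  r : ∀ a → 1 + (2 + (1 + 2 * a)) ≡ 2 * (2 + a)
  r = solve-∀

bits≤ : ∀ b x → ℕᵇ.toℕ x < 2 ^ b → bits x ≤ b
bits≤ b x x<2^b = ≮⇒≥ (λ b<bits → <-irrefl refl (begin-strict
  2 ^ b                  <⟨ ^-monoʳ-< 2 (s≤s (s≤s z≤n)) b<bits ⟩
  2 ^ bits x             ≤⟨ 2^bits≤1+ x ⟩
  suc (ℕᵇ.toℕ x)         ≤⟨ x<2^b ⟩
  2 ^ b                  ∎))
  where open ≤-Reasoning

suc-runs : ∀ x → Runs fn-suc (encodeℕᵇ x) (encodeℕᵇ (ℕᵇ.suc x)) (bits x)
suc-runs zero     = runs (case-nil var (cons nil nil)) z≤n
suc-runs 1+[2 x ] = runs (case-cons var (case-nil var (cons (cons nil nil) var))) z≤n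
suc-runs 2[1+ x ] = runs (case-cons var (case-cons var (cons nil (call var (suc-runs x))))) ≤-refl

add-smaller : ∀ x y {b} → suc (bits x) + suc (bits y) ≤ b → bits x + bits y ≤ b
add-smaller x y p = ≤-trans (+-mono-≤ (n≤1+n (bits x)) (n≤1+n (bits y))) p

add-carry : ∀ x y {b} → suc (bits x) + suc (bits y) ≤ b →
            suc (suc (bits x * (2 + b)) + bits (x ℕᵇ.+ y)) ≤ suc (bits x) * (2 + b)
add-carry x y {b} p = begin
  2 + (bits x * (2 + b) + bits (x ℕᵇ.+ y))  ≤⟨ s≤s (s≤s (+-monoʳ-≤ (bits x * (2 + b)) (≤-trans (bits-+ x y) (add-smaller x y p)))) ⟩
  2 + (bits x * (2 + b) + b)                ≡⟨ r (bits x * (2 + b)) b ⟩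
  suc (bits x) * (2 + b)                    ∎
  where
  open ≤-Reasoning
  r : ∀ m b → 2 + (m + b) ≡ (2 + b) + m
  r = solve-∀

weakenRuns : ∀ {f d d′ c c′} → c ≤ c′ → Runs f d d′ c → Runs f d d′ c′
weakenRuns c≤c′ (runs p k≤c) = runs p (≤-trans k≤c c≤c′)

-- A carry may run through all digits of a sum, so the cost is quadratic.
add-runs : ∀ x y {b} → bits x + bits y ≤ b →
           Runs fn-add (cons (encodeℕᵇ x) (encodeℕᵇ y)) (encodeℕᵇ (x ℕᵇ.+ y)) (bits x * (2 + b))
add-runs zero     y          _ = runs (case-cons var (case-nil var var)) z≤n
add-runs 2[1+ x ] zero       _ = runs (case-cons var (case-cons var (case-nil var var))) z≤n
add-runs 1+[2 x ] zero       _ = runs (case-cons var (case-cons var (case-nil var var))) z≤n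
add-runs 1+[2 x ] 1+[2 y ] {b} p =
  runs (case-cons var (case-cons var (case-cons var (case-nil var (case-nil var
         (cons (cons nil nil) (call (cons var var) (add-runs x y (add-smaller x y p)))))))))
       (s≤s (m≤n+m _ (suc b)))
add-runs 1+[2 x ] 2[1+ y ] {b} p =
  runs (case-cons var (case-cons var (case-cons var (case-nil var (case-cons var
         (cons nil (call (call (cons var var) (add-runs x y (add-smaller x y p))) (suc-runs (x ℕᵇ.+ y)))))))))
       (add-carry x y p)
add-runs 2[1+ x ] 1+[2 y ] {b} p =
  runs (case-cons var (case-cons var (case-cons var (case-cons var (case-nil var
         (cons nil (call (call (cons var var) (add-runs x y (add-smaller x y p))) (suc-runs (x ℕᵇ.+ y)))))))))
       (add-carry x y p)
add-runs 2[1+ x ] 2[1+ y ] {b} p =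
  runs (case-cons var (case-cons var (case-cons var (case-cons var (case-cons var
         (cons (cons nil nil) (call (call (cons var var) (add-runs x y (add-smaller x y p))) (suc-runs (x ℕᵇ.+ y)))))))))
       (add-carry x y p)

encodeℕ-toℕ : ∀ {x m} → ℕᵇ.toℕ x ≡ m → encodeℕᵇ x ≡ encodeℕ m
encodeℕ-toℕ {x} refl = cong encodeℕᵇ (sym (ℕᵇ.fromℕ-toℕ x))

addCost : ℕ → ℕ
addCost b = b * (2 + (b + b))

addᵇ-runs : ∀ b x y → ℕᵇ.toℕ x < 2 ^ b → ℕᵇ.toℕ y < 2 ^ b →
            Runs fn-add (cons (encodeℕᵇ x) (encodeℕᵇ y)) (encodeℕᵇ (x ℕᵇ.+ y)) (addCost b)
addᵇ-runs b x y x< y< =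
  weakenRuns (*-monoˡ-≤ (2 + (b + b)) (bits≤ b x x<)) (add-runs x y {b + b} (+-mono-≤ (bits≤ b x x<) (bits≤ b y y<)))

-- Multiplication with the recursion that the program uses.
mulᵇ : ℕᵇ → ℕᵇ → ℕᵇ
mulᵇ zero     y = zero
mulᵇ 1+[2 x ] y = y ℕᵇ.+ (mulᵇ x y ℕᵇ.+ mulᵇ x y)
mulᵇ 2[1+ x ] y = (y ℕᵇ.+ mulᵇ x y) ℕᵇ.+ (y ℕᵇ.+ mulᵇ x y)

toℕ-mulᵇ : ∀ x y → ℕᵇ.toℕ (mulᵇ x y) ≡ ℕᵇ.toℕ x * ℕᵇ.toℕ y
toℕ-mulᵇ zero     y = refl
toℕ-mulᵇ 1+[2 x ] y
  rewrite ℕᵇ.toℕ-homo-+ y (mulᵇ x y ℕᵇ.+ mulᵇ x y) | ℕᵇ.toℕ-homo-+ (mulᵇ x y) (mulᵇ x y) | toℕ-mulᵇ x y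
  = r (ℕᵇ.toℕ x) (ℕᵇ.toℕ y)
  where
  r : ∀ a b → b + (a * b + a * b) ≡ (1 + 2 * a) * b
  r = solve-∀
toℕ-mulᵇ 2[1+ x ] y
  rewrite ℕᵇ.toℕ-homo-+ (y ℕᵇ.+ mulᵇ x y) (y ℕᵇ.+ mulᵇ x y) | ℕᵇ.toℕ-homo-+ y (mulᵇ x y) | toℕ-mulᵇ x y
  = r (ℕᵇ.toℕ x) (ℕᵇ.toℕ y)
  where
  r : ∀ a b → (b + a * b) + (b + a * b) ≡ (2 * (1 + a)) * b
  r = solve-∀

mulCost : ℕ → ℕ
mulCost b = b * (3 + (addCost b + addCost b))

summandʳ< : ∀ b x y → ℕᵇ.toℕ (x ℕᵇ.+ y) < 2 ^ b → ℕᵇ.toℕ y < 2 ^ b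
summandʳ< b x y p = ≤-<-trans (m≤n+m (ℕᵇ.toℕ y) (ℕᵇ.toℕ x)) (subst (_< 2 ^ b) (ℕᵇ.toℕ-homo-+ x y) p)

-- All intermediate sums are at most the product, hence have at most b digits.
mulᵇ-runs : ∀ b x y → ℕᵇ.toℕ y < 2 ^ b → ℕᵇ.toℕ x * ℕᵇ.toℕ y < 2 ^ b →
  Runs fn-mul (cons (encodeℕᵇ x) (encodeℕᵇ y)) (encodeℕᵇ (mulᵇ x y)) (bits x * (3 + (addCost b + addCost b)))
mulᵇ-runs b zero     y _  _   = runs (case-cons var (case-nil var nil)) z≤n
mulᵇ-runs b 1+[2 x ] y y< xy< = runs
  (case-cons var (case-cons var (let′ (call (cons var var) (mulᵇ-runs b x y y< (subst (_< 2 ^ b) (toℕ-mulᵇ x y) z<)))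
    (case-nil var (call (cons var (call (cons var var) (addᵇ-runs b z z z< z<))) (addᵇ-runs b y (z ℕᵇ.+ z) y< z+z<))))))
  (≤-reflexive (r (bits x * (3 + (addCost b + addCost b))) (addCost b)))
  where
  z = mulᵇ x y
  r : ∀ m a → 1 + (1 + (1 + m + a) + a) ≡ 3 + (a + a) + m
  r = solve-∀
  total< : ℕᵇ.toℕ (mulᵇ 1+[2 x ] y) < 2 ^ b
  total< = subst (_< 2 ^ b) (sym (toℕ-mulᵇ 1+[2 x ] y)) xy<
  z+z< : ℕᵇ.toℕ (z ℕᵇ.+ z) < 2 ^ b
  z+z< = summandʳ< b y (z ℕᵇ.+ z) total<
  z< : ℕᵇ.toℕ z < 2 ^ b
  z< = summandʳ< b z z z+z<
mulᵇ-runs b 2[1+ x ] y y< xy< = runs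
  (case-cons var (case-cons var (let′ (call (cons var var) (mulᵇ-runs b x y y< (subst (_< 2 ^ b) (toℕ-mulᵇ x y) z<)))
    (case-cons var (let′ (call (cons var var) (addᵇ-runs b y z y< z<)) (call (cons var var) (addᵇ-runs b w w w< w<)))))))
  (≤-reflexive (r (bits x * (3 + (addCost b + addCost b))) (addCost b)))
  where
  z = mulᵇ x y
  w = y ℕᵇ.+ z
  r : ∀ m a → 1 + (1 + (1 + m + a) + a) ≡ 3 + (a + a) + m
  r = solve-∀
  w< : ℕᵇ.toℕ w < 2 ^ b
  w< = summandʳ< b w w (subst (_< 2 ^ b) (sym (toℕ-mulᵇ 2[1+ x ] y)) xy<)
  z< : ℕᵇ.toℕ z < 2 ^ b
  z< = summandʳ< b y z w<

data Order : Set where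
  less equal greater : Order

encodeOrder : Order → 𝔻
encodeOrder less = nil
encodeOrder equal = cons nil nil
encodeOrder greater = cons (cons nil nil) nil

-- The first comparison decides unless it is a tie.
_▷_ : Order → Order → Order
less ▷ _ = less
equal ▷ o = o
greater ▷ _ = greater

-- Digits come least significant first, so the comparison of the remaining
-- digits takes precedence over that of the first ones.
compare : ℕᵇ → ℕᵇ → Order
compare zero     zero     = equal
compare zero     1+[2 _ ] = less
compare zero     2[1+ _ ] = less
compare 1+[2 _ ] zero     = greater
compare 2[1+ _ ] zero     = greater
compare 1+[2 x ] 1+[2 y ] = compare x y ▷ equal
compare 1+[2 x ] 2[1+ y ] = compare x y ▷ less
compare 2[1+ x ] 1+[2 y ] = compare x y ▷ greater
compare 2[1+ x ] 2[1+ y ] = compare x y ▷ equal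

compare-runs : ∀ x y → Runs fn-compare (cons (encodeℕᵇ x) (encodeℕᵇ y)) (encodeOrder (compare x y)) (bits y)
compare-runs zero     zero     = runs (case-cons var (case-nil var (case-nil var (cons nil nil)))) z≤n
compare-runs zero     1+[2 _ ] = runs (case-cons var (case-nil var (case-cons var nil))) z≤n
compare-runs zero     2[1+ _ ] = runs (case-cons var (case-nil var (case-cons var nil))) z≤n
compare-runs 1+[2 _ ] zero     = runs (case-cons var (case-cons var (case-nil var (cons (cons nil nil) nil)))) z≤n
compare-runs 2[1+ _ ] zero     = runs (case-cons var (case-cons var (case-nil var (cons (cons nil nil) nil)))) z≤n
compare-runs 1+[2 x ] 1+[2 y ] with compare x y | compare-runs x y
... | less | p = runs (case-cons var (case-cons var (case-cons var (let′ (call (cons var var) p) (case-nil var nil))))) ≤-refl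
... | equal | p = runs (case-cons var (case-cons var (case-cons var (let′ (call (cons var var) p)
                 (case-cons var (case-nil var (case-nil var (case-nil var (cons nil nil))))))))) ≤-refl
... | greater | p = runs (case-cons var (case-cons var (case-cons var (let′ (call (cons var var) p) (case-cons var (case-cons var var)))))) ≤-refl
compare-runs 1+[2 x ] 2[1+ y ] with compare x y | compare-runs x y
... | less | p = runs (case-cons var (case-cons var (case-cons var (let′ (call (cons var var) p) (case-nil var nil))))) ≤-refl
... | equal | p = runs (case-cons var (case-cons var (case-cons var (let′ (call (cons var var) p)
                 (case-cons var (case-nil var (case-nil var (case-cons var nil)))))))) ≤-refl
... | greater | p = runs (case-cons var (case-cons var (case-cons var (let′ (call (cons var var) p) (case-cons var (case-cons var var)))))) ≤-refl
compare-runs 2[1+ x ] 1+[2 y ] with compare x y | compare-runs x y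
... | less | p = runs (case-cons var (case-cons var (case-cons var (let′ (call (cons var var) p) (case-nil var nil))))) ≤-refl
... | equal | p = runs (case-cons var (case-cons var (case-cons var (let′ (call (cons var var) p)
                 (case-cons var (case-nil var (case-cons var (case-nil var (cons (cons nil nil) nil))))))))) ≤-refl
... | greater | p = runs (case-cons var (case-cons var (case-cons var (let′ (call (cons var var) p) (case-cons var (case-cons var var)))))) ≤-refl
compare-runs 2[1+ x ] 2[1+ y ] with compare x y | compare-runs x y
... | less | p = runs (case-cons var (case-cons var (case-cons var (let′ (call (cons var var) p) (case-nil var nil))))) ≤-refl
... | equal | p = runs (case-cons var (case-cons var (case-cons var (let′ (call (cons var var) p)
                 (case-cons var (case-nil var (case-cons var (case-cons var (cons nil nil))))))))) ≤-refl
... | greater | p = runs (case-cons var (case-cons var (case-cons var (let′ (call (cons var var) p) (case-cons var (case-cons var var)))))) ≤-refl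

Decides : Order → ℕ → ℕ → Set
Decides less m n = m < n
Decides equal m n = m ≡ n
Decides greater m n = n < m

odd<even : ∀ {m n} → m ≤ n → suc (2 * m) < 2 * suc n
odd<even {m} {n} m≤n = ≤-trans (s≤s (s≤s (*-monoʳ-≤ 2 m≤n))) (≤-reflexive (r n))
  where
  r : ∀ n → 2 + 2 * n ≡ 2 * (1 + n)
  r = solve-∀

even<odd : ∀ {m n} → n < m → 2 * suc n < suc (2 * m)
even<odd n<m = s≤s (*-monoʳ-≤ 2 n<m)

compare-correct : ∀ x y → Decides (compare x y) (ℕᵇ.toℕ x) (ℕᵇ.toℕ y)
compare-correct zero     zero     = refl
compare-correct zero     1+[2 _ ] = s≤s z≤n
compare-correct zero     2[1+ _ ] = s≤s z≤n
compare-correct 1+[2 _ ] zero     = s≤s z≤n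
compare-correct 2[1+ _ ] zero     = s≤s z≤n
compare-correct 1+[2 x ] 1+[2 y ] with compare x y | compare-correct x y
... | less | p = s≤s (*-monoʳ-< 2 p)
... | equal | p = cong (λ m → suc (2 * m)) p
... | greater | p = s≤s (*-monoʳ-< 2 p)
compare-correct 1+[2 x ] 2[1+ y ] with compare x y | compare-correct x y
... | less | p = odd<even (<⇒≤ p)
... | equal | p = odd<even (≤-reflexive p)
... | greater | p = even<odd p
compare-correct 2[1+ x ] 1+[2 y ] with compare x y | compare-correct x y
... | less | p = even<odd p
... | equal | p = odd<even (≤-reflexive (sym p))
... | greater | p = odd<even (<⇒≤ p)
compare-correct 2[1+ x ] 2[1+ y ] with compare x y | compare-correct x y
... | less | p = *-monoʳ-< 2 (s≤s p)
... | equal | p = cong (λ m → 2 * suc m) p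
... | greater | p = *-monoʳ-< 2 (s≤s p)

-- Arithmetic of fractions

add-runsℕ : ∀ b m n → m < 2 ^ b → n < 2 ^ b → Runs fn-add (cons (encodeℕ m) (encodeℕ n)) (encodeℕ (m + n)) (addCost b)
add-runsℕ b m n m< n< = subst (λ d → Runs fn-add (cons (encodeℕ m) (encodeℕ n)) d (addCost b))
  (encodeℕ-toℕ (trans (ℕᵇ.toℕ-homo-+ (fromℕ m) (fromℕ n)) (cong₂ _+_ (ℕᵇ.toℕ-fromℕ m) (ℕᵇ.toℕ-fromℕ n))))
  (addᵇ-runs b (fromℕ m) (fromℕ n) (subst (_< 2 ^ b) (sym (ℕᵇ.toℕ-fromℕ m)) m<) (subst (_< 2 ^ b) (sym (ℕᵇ.toℕ-fromℕ n)) n<))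

mul-runsℕ : ∀ b m n → m < 2 ^ b → n < 2 ^ b → m * n < 2 ^ b →
            Runs fn-mul (cons (encodeℕ m) (encodeℕ n)) (encodeℕ (m * n)) (mulCost b)
mul-runsℕ b m n m< n< mn< = subst (λ d → Runs fn-mul (cons (encodeℕ m) (encodeℕ n)) d (mulCost b))
  (encodeℕ-toℕ (trans (toℕ-mulᵇ (fromℕ m) (fromℕ n)) m*n≡))
  (weakenRuns (*-monoˡ-≤ (3 + (addCost b + addCost b)) (bits≤ b (fromℕ m) (subst (_< 2 ^ b) (sym (ℕᵇ.toℕ-fromℕ m)) m<)))
    (mulᵇ-runs b (fromℕ m) (fromℕ n) (subst (_< 2 ^ b) (sym (ℕᵇ.toℕ-fromℕ n)) n<) (subst (_< 2 ^ b) (sym m*n≡) mn<)))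
  where
  m*n≡ : ℕᵇ.toℕ (fromℕ m) * ℕᵇ.toℕ (fromℕ n) ≡ m * n
  m*n≡ = cong₂ _*_ (ℕᵇ.toℕ-fromℕ m) (ℕᵇ.toℕ-fromℕ n)

-- Covers averages, products and comparisons of fractions: two or three products,
-- at most two sums and one comparison of numbers below 2^b.
opCost : ℕ → ℕ
opCost b = 5 + (3 * mulCost b + 2 * addCost b + b)

-- Numerators are at most denominators, so this bounds both.
FitsIn : ℕ → Frac → Set
FitsIn b f = den f < 2 ^ b

FitsIn-mono : ∀ {b c} f → b ≤ c → FitsIn b f → FitsIn c f
FitsIn-mono f b≤c p = <-≤-trans p (^-monoʳ-≤ 2 b≤c)

FitsIn-times : ∀ a b f g → FitsIn a f → FitsIn b g → FitsIn (a + b) (times f g)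
FitsIn-times a b f g f< g< = <-≤-trans (*-mono-< f< g<) (≤-reflexive (sym (^-distribˡ-+-* 2 a b)))

FitsIn-average : ∀ a b f g → FitsIn a f → FitsIn b g → FitsIn (suc (a + b)) (average f g)
FitsIn-average a b f g f< g< = begin-strict
  den f * den g + den f * den g   ≡⟨ cong (λ z → den f * den g + z) (+-identityʳ (den f * den g)) ⟨
  2 * (den f * den g)             <⟨ *-monoʳ-< 2 (FitsIn-times a b f g f< g<) ⟩
  2 * 2 ^ (a + b)                 ∎
  where open ≤-Reasoning

module _ (b : ℕ) (f g : Frac) where
  private
    p = num f
    d = den f
    r = num g
    e = den g
    d≤de : d ≤ d * e
    d≤de = m≤m*n d e
    e≤de : e ≤ d * e
    e≤de = m≤n*m e d
    pe≤de : p * e ≤ d * e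
    pe≤de = *-monoˡ-≤ e (num≤den f)
    rd≤de : r * d ≤ d * e
    rd≤de = ≤-trans (*-monoˡ-≤ d (num≤den g)) (≤-reflexive (*-comm e d))

  times-runs : FitsIn b (times f g) → Runs fn-times (cons (encodeFrac f) (encodeFrac g)) (encodeFrac (times f g)) (opCost b)
  times-runs de< = runs
    (case-cons var (case-cons var (case-cons var (cons
      (call (cons var var) (mul-runsℕ b p r (≤-<-trans (num≤den f) d<) (≤-<-trans (num≤den g) e<)
                                            (≤-<-trans (*-mono-≤ (num≤den f) (num≤den g)) de<)))
      (call (cons var var) (mul-runsℕ b d e d< e< de<))))))
    (≤-trans (m≤m+n _ _) (≤-reflexive (s (mulCost b) (addCost b) b)))
    where
    d< = ≤-<-trans d≤de de<
    e< = ≤-<-trans e≤de de<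
    s : ∀ m a b → 1 + (1 + m + m) + (3 + (m + 2 * a + b)) ≡ 5 + (3 * m + 2 * a + b)
    s = solve-∀

  average-runs : FitsIn b (average f g) →
                 Runs fn-average (cons (encodeFrac f) (encodeFrac g)) (encodeFrac (average f g)) (opCost b)
  average-runs 2de< = runs
    (case-cons var (case-cons var (case-cons var (let′
      (call (cons var var) (mul-runsℕ b d e d< e< de<))
      (cons (call (cons (call (cons var var) (mul-runsℕ b p e (≤-<-trans (num≤den f) d<) e< pe<))
                        (call (cons var var) (mul-runsℕ b r d (≤-<-trans (num≤den g) e<) d< rd<)))
                  (add-runsℕ b (p * e) (r * d) pe< rd<))
            (call (cons var var) (add-runsℕ b (d * e) (d * e) de< de<)))))))
    (≤-trans (m≤m+n _ _) (≤-reflexive (s (mulCost b) (addCost b) b)))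
    where
    de< : d * e < 2 ^ b
    de< = ≤-<-trans (m≤m+n (d * e) (d * e)) 2de<
    d< = ≤-<-trans d≤de de<
    e< = ≤-<-trans e≤de de<
    pe< = ≤-<-trans pe≤de de<
    rd< = ≤-<-trans rd≤de de<
    s : ∀ m a b → 1 + (1 + (1 + (1 + (1 + m + m) + m) + a) + a) + b ≡ 5 + (3 * m + 2 * a + b)
    s = solve-∀

  -- The numbers compared are numerators of the two fractions over the common
  -- denominator d e, which is the denominator of their product.
  leq-runs : FitsIn b (times f g) → Runs fn-leq (cons (encodeFrac f) (encodeFrac g)) (encodeBool (leq f g)) (opCost b)
  leq-runs de< = finish (compare x y) comparison
    (subst₂ (Decides (compare x y)) (ℕᵇ.toℕ-fromℕ (p * e)) (ℕᵇ.toℕ-fromℕ (r * d)) (compare-correct x y))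
    where
    x = fromℕ (p * e)
    y = fromℕ (r * d)
    d< = ≤-<-trans d≤de de<
    e< = ≤-<-trans e≤de de<
    rd< = ≤-<-trans rd≤de de<
    bound : suc (suc (suc (mulCost b) + mulCost b) + b) ≤ opCost b
    bound = ≤-trans (m≤m+n _ _) (≤-reflexive (s (mulCost b) (addCost b) b))
      where
      s : ∀ m a b → 1 + (1 + (1 + m) + m + b) + (2 + (m + 2 * a)) ≡ 5 + (3 * m + 2 * a + b)
      s = solve-∀
    comparison : Runs fn-compare (cons (encodeℕ (p * e)) (encodeℕ (r * d))) (encodeOrder (compare x y)) b
    comparison = weakenRuns (bits≤ b y (subst (_< 2 ^ b) (sym (ℕᵇ.toℕ-fromℕ (r * d))) rd<)) (compare-runs x y)
    holds : p * e ≤ r * d → leq f g ≡ true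
    holds le = leq-complete f g (≤⇒toℚ≤ f g le)
    fails : r * d < p * e → leq f g ≡ false
    fails q<p with leq f g in ok
    ... | false = refl
    ... | true  = contradiction (≤ᵇ⇒≤ _ _ (subst T (sym ok) tt)) (<⇒≱ q<p)
    ρ = encodeℕ r ∷ encodeℕ e ∷ encodeℕ p ∷ encodeℕ d ∷ encodeFrac f ∷ encodeFrac g ∷ cons (encodeFrac f) (encodeFrac g) ∷ []
    operands : ρ ⊢ cons (call fn-mul (cons (v 2) (v 1))) (call fn-mul (cons (v 0) (v 3)))
                 ⇓ cons (encodeℕ (p * e)) (encodeℕ (r * d)) # 0 ⟶ suc (suc (mulCost b) + mulCost b)
    operands = cons (call (cons var var) (mul-runsℕ b p e (≤-<-trans (num≤den f) d<) e< (≤-<-trans pe≤de de<)))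
                    (call (cons var var) (mul-runsℕ b r d (≤-<-trans (num≤den g) e<) d< rd<))
    finish : ∀ o → Runs fn-compare (cons (encodeℕ (p * e)) (encodeℕ (r * d))) (encodeOrder o) b →
             Decides o (p * e) (r * d) → Runs fn-leq (cons (encodeFrac f) (encodeFrac g)) (encodeBool (leq f g)) (opCost b)
    finish less c p<q rewrite holds (<⇒≤ p<q) =
      runs (case-cons var (case-cons var (case-cons var (case-nil (call operands c) (cons nil nil))))) bound
    finish equal c p≡q rewrite holds (≤-reflexive p≡q) =
      runs (case-cons var (case-cons var (case-cons var (case-cons (call operands c) (case-nil var (cons nil nil)))))) bound
    finish greater c q<p rewrite fails q<p =
      runs (case-cons var (case-cons var (case-cons var (case-cons (call operands c) (case-cons var nil))))) bound

-- Looking up a variable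

fixedToCost : ℕ → ℕ
fixedToCost M = M * (2 + M)

compare-equal : ∀ x y → compare x y ≡ equal → ℕᵇ.toℕ x ≡ ℕᵇ.toℕ y
compare-equal x y o≡ with compare x y | compare-correct x y
compare-equal x y refl | equal | p = p

compare-refl : ∀ x → compare x x ≡ equal
compare-refl x with compare x x | compare-correct x x
... | less | p = contradiction p (<-irrefl refl)
... | equal | p = refl
... | greater | p = contradiction p (<-irrefl refl)

fixedTo-runs : ∀ {n} b (σ : Restriction n) j → bits (fromℕ (toℕ j)) ≤ b →
  Runs fn-fixedTo (cons (encodeℕ (toℕ j)) (encodeRestriction σ)) (encodeMaybe (fixedTo σ j)) (length σ * (2 + b))
fixedTo-runs b []            j _ = runs (case-cons var (case-nil var nil)) z≤n
fixedTo-runs b ((i , c) ∷ σ) j j≤b with fixedTo σ j | fixedTo-runs b σ j j≤b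
... | just _  | p = runs (case-cons var (case-cons var (let′ (call (cons var var) p) (case-cons var var)))) (s≤s (m≤n+m _ (suc b)))
... | nothing | p = decide (i ≟ j)
  where
  bound : suc (suc (length σ * (2 + b)) + bits (fromℕ (toℕ j))) ≤ 2 + b + length σ * (2 + b)
  bound = s≤s (s≤s (≤-trans (+-monoʳ-≤ _ j≤b) (≤-reflexive (+-comm _ b))))
  x = fromℕ (toℕ i)
  y = fromℕ (toℕ j)
  comparison : Runs fn-compare (cons (encodeℕ (toℕ i)) (encodeℕ (toℕ j))) (encodeOrder (compare x y)) (bits y)
  comparison = compare-runs x y
  decide : ∀ i≟j → Runs fn-fixedTo (cons (encodeℕ (toℕ j)) (cons (cons (encodeℕ (toℕ i)) (encodeBool c)) (encodeRestriction σ)))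
             (encodeMaybe (if ⌊ i≟j ⌋ then just c else nothing)) _
  decide (yes refl) with compare x x | comparison | compare-refl x
  ... | _ | q | refl = runs (case-cons var (case-cons var (let′ (call (cons var var) p)
        (case-nil var (case-cons var (case-cons (call (cons var var) q) (case-nil var (cons var nil)))))))) bound
  decide (no i≢j) with compare x y | comparison | compare-equal x y
  ... | less | q | _ = runs (case-cons var (case-cons var (let′ (call (cons var var) p)
        (case-nil var (case-cons var (case-nil (call (cons var var) q) nil)))))) bound
  ... | greater | q | _ = runs (case-cons var (case-cons var (let′ (call (cons var var) p)
        (case-nil var (case-cons var (case-cons (call (cons var var) q) (case-cons var nil))))))) bound
  ... | equal | _ | same = contradiction (toℕ-injective (trans (sym (ℕᵇ.toℕ-fromℕ (toℕ i))) (trans (same refl) (ℕᵇ.toℕ-fromℕ (toℕ j))))) i≢j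

-- Sizes of encodings

bits<size : ∀ x → suc (bits x) ≤ size (encodeℕᵇ x)
bits<size zero     = ≤-refl
bits<size 1+[2 x ] = s≤s (≤-trans (bits<size x) (n≤1+n _))
bits<size 2[1+ x ] = s≤s (≤-trans (bits<size x) (m≤n+m _ 3))

size≤bits : ∀ x → size (encodeℕᵇ x) ≤ 1 + 4 * bits x
size≤bits zero     = ≤-refl
size≤bits 1+[2 x ] = ≤-trans (s≤s (s≤s (size≤bits x))) (≤-trans (m≤m+n _ 2) (≤-reflexive (r (bits x))))
  where
  r : ∀ a → 2 + (1 + 4 * a) + 2 ≡ 1 + 4 * (1 + a)
  r = solve-∀
size≤bits 2[1+ x ] = ≤-trans (+-monoʳ-≤ 4 (size≤bits x)) (≤-reflexive (r (bits x)))
  where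
  r : ∀ a → 4 + (1 + 4 * a) ≡ 1 + 4 * (1 + a)
  r = solve-∀

size-encodeℕ : ∀ b m → m < 2 ^ b → size (encodeℕ m) ≤ 1 + 4 * b
size-encodeℕ b m m< = ≤-trans (size≤bits (fromℕ m))
  (s≤s (*-monoʳ-≤ 4 (bits≤ b (fromℕ m) (subst (_< 2 ^ b) (sym (ℕᵇ.toℕ-fromℕ m)) m<))))

FitsIn-size : ∀ f → FitsIn (size (encodeFrac f)) f
FitsIn-size f = ≤-trans (n≤1+n _) (subst (λ m → 2 + m ≤ 2 ^ size (encodeFrac f)) (ℕᵇ.toℕ-fromℕ (den f))
  (≤-trans (<2^1+bits (fromℕ (den f)))
    (^-monoʳ-≤ 2 (≤-trans (bits<size (fromℕ (den f))) (≤-trans (m≤n+m _ (size (encodeℕ (num f)))) (n≤1+n _))))))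

-- Running time of the moments

labelSize : Label → ℕ
labelSize v = 2 + size (encodeℚ (value v))

-- Bounds two things at once, for every σ: the bit length of the denominator
-- of walk t ts σ, because denominators multiply, and the number of nodes that
-- the computation visits.
weight : ∀ {n} → RDT n → List (RDT n) → ℕ
weight (leaf v)        []       = labelSize v
weight (leaf v)        (t ∷ ts) = labelSize v + weight t ts
weight (flip t₀ t₁)    ts       = suc (weight t₀ ts + weight t₁ ts)
weight (query i t₀ t₁) ts       = suc (size (encodeℕ (toℕ i)) + (weight t₀ ts + weight t₁ ts))

fromLabel-fits : ∀ v → FitsIn (labelSize v) (fromLabel v)
fromLabel-fits v = FitsIn-mono (fromLabel v)
  (≤-trans (≤-reflexive (cong (λ a → size (encodeℚ a)) (toℚ-fromLabel v))) (m≤n+m _ 2)) (FitsIn-size (fromLabel v))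

walk-fits : ∀ {n} (t : RDT n) ts σ → FitsIn (weight t ts) (walk t ts σ)
walk-fits (leaf v) []       σ = fromLabel-fits v
walk-fits (leaf v) (t ∷ ts) σ =
  FitsIn-times (labelSize v) (weight t ts) (fromLabel v) (walk t ts σ) (fromLabel-fits v) (walk-fits t ts σ)
walk-fits (flip t₀ t₁) ts σ =
  FitsIn-average (weight t₀ ts) (weight t₁ ts) (walk t₀ ts σ) (walk t₁ ts σ) (walk-fits t₀ ts σ) (walk-fits t₁ ts σ)
walk-fits (query i t₀ t₁) ts σ with fixedTo σ i
... | just false = FitsIn-mono (walk t₀ ts σ) (≤-trans (m≤m+n w₀ w₁) (≤-trans (m≤n+m _ s) (n≤1+n _))) (walk-fits t₀ ts σ)
  where w₀ = weight t₀ ts ; w₁ = weight t₁ ts ; s = size (encodeℕ (toℕ i))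
... | just true  = FitsIn-mono (walk t₁ ts σ) (≤-trans (m≤n+m w₁ w₀) (≤-trans (m≤n+m _ s) (n≤1+n _))) (walk-fits t₁ ts σ)
  where w₀ = weight t₀ ts ; w₁ = weight t₁ ts ; s = size (encodeℕ (toℕ i))
... | nothing    = FitsIn-mono (average a₀ a₁) (s≤s (m≤n+m _ s))
    (FitsIn-average w₀ w₁ a₀ a₁ (walk-fits t₀ ts ((i , false) ∷ σ)) (walk-fits t₁ ts ((i , true) ∷ σ)))
  where
  w₀ = weight t₀ ts ; w₁ = weight t₁ ts ; s = size (encodeℕ (toℕ i))
  a₀ = walk t₀ ts ((i , false) ∷ σ) ; a₁ = walk t₁ ts ((i , true) ∷ σ)

weight≤size : ∀ {n} (t : RDT n) → weight t [] ≤ size (encodeRDT t)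
weight≤size (leaf v)        = ≤-refl
weight≤size (flip t₀ t₁)    = s≤s (≤-trans (+-mono-≤ (weight≤size t₀) (weight≤size t₁)) (m≤n+m _ 4))
weight≤size (query i t₀ t₁) = s≤s (≤-trans (+-monoʳ-≤ s (≤-trans (+-mono-≤ (weight≤size t₀) (weight≤size t₁)) (n≤1+n _))) (m≤n+m _ 6))
  where s = size (encodeℕ (toℕ i))

weight≤size* : ∀ {n} (t t′ : RDT n) → weight t (t′ ∷ []) ≤ size (encodeRDT t) * suc (size (encodeRDT t′))
weight≤size* (leaf v) t′ = ≤-trans (+-monoʳ-≤ a (≤-trans (weight≤size t′) (m≤n*m _ a))) (≤-reflexive (sym (*-suc a (size (encodeRDT t′)))))
  where a = labelSize v
weight≤size* (flip t₀ t₁) t′ = begin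
  suc (weight t₀ _ + weight t₁ _)      ≤⟨ s≤s (+-mono-≤ (weight≤size* t₀ t′) (weight≤size* t₁ t′)) ⟩
  1 + (a * suc c + b * suc c)          ≤⟨ m≤m+n _ (4 + 5 * c) ⟩
  1 + (a * suc c + b * suc c) + (4 + 5 * c)  ≡⟨ r a b c ⟩
  (5 + (a + b)) * suc c                ∎
  where
  open ≤-Reasoning
  a = size (encodeRDT t₀) ; b = size (encodeRDT t₁) ; c = size (encodeRDT t′)
  r : ∀ a b c → 1 + (a * (1 + c) + b * (1 + c)) + (4 + 5 * c) ≡ (5 + (a + b)) * (1 + c)
  r = solve-∀
weight≤size* (query i t₀ t₁) t′ = begin
  suc (s + (weight t₀ _ + weight t₁ _))    ≤⟨ s≤s (+-monoʳ-≤ s (+-mono-≤ (weight≤size* t₀ t′) (weight≤size* t₁ t′))) ⟩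
  1 + (s + (a * suc c + b * suc c))        ≤⟨ m≤m+n _ (7 + 8 * c + s * c) ⟩
  1 + (s + (a * suc c + b * suc c)) + (7 + 8 * c + s * c)  ≡⟨ r a b c s ⟩
  (7 + (s + (1 + (a + b)))) * suc c        ∎
  where
  open ≤-Reasoning
  a = size (encodeRDT t₀) ; b = size (encodeRDT t₁) ; c = size (encodeRDT t′) ; s = size (encodeℕ (toℕ i))
  r : ∀ a b c s → 1 + (s + (a * (1 + c) + b * (1 + c))) + (7 + 8 * c + s * c) ≡ (7 + (s + (1 + (a + b)))) * (1 + c)
  r = solve-∀

nodeCost : ℕ → ℕ
nodeCost M = 4 + (fixedToCost M + opCost M)

bits-index : ∀ {n} (i : Fin n) M → size (encodeℕ (toℕ i)) ≤ M → bits (fromℕ (toℕ i)) ≤ M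
bits-index i M = ≤-trans (≤-trans (n≤1+n _) (bits<size (fromℕ (toℕ i))))

walk-runs : ∀ {n} M (t : RDT n) ts σ → length σ + weight t ts ≤ M →
  Runs fn-walk (cons (encodeRDT t) (cons (encodeForest ts) (encodeRestriction σ))) (encodeFrac (walk t ts σ))
       (weight t ts * nodeCost M)
walk-runs M (leaf v) [] σ fits = subst
  (λ a → Runs fn-walk (cons (cons nil (encodeℚ a)) (cons nil (encodeRestriction σ)))
              (encodeFrac (fromLabel v)) (labelSize v * nodeCost M))
  (toℚ-fromLabel v)
  (runs (case-cons var (case-cons var (case-cons var (case-nil var (case-nil var var))))) z≤n)
walk-runs M (leaf v) (t ∷ ts) σ fits = subst
  (λ a → Runs fn-walk (cons (cons nil (encodeℚ a)) (cons (encodeForest (t ∷ ts)) (encodeRestriction σ)))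
              (encodeFrac (walk (leaf v) (t ∷ ts) σ)) ((labelSize v + weight t ts) * nodeCost M))
  (toℚ-fromLabel v)
  (runs (case-cons var (case-cons var (case-cons var (case-nil var (case-cons var
     (call (cons var (call (cons var (cons var var)) (walk-runs M t ts σ (≤-trans (+-monoʳ-≤ (length σ) (m≤n+m _ s)) fits))))
           (times-runs M (fromLabel v) (walk t ts σ)
             (FitsIn-mono (times (fromLabel v) (walk t ts σ)) (≤-trans (m≤n+m _ (length σ)) fits) (walk-fits (leaf v) (t ∷ ts) σ))))))))) bound)
  where
  s = labelSize v
  w = weight t ts * nodeCost M
  bound : suc (suc w + opCost M) ≤ (s + weight t ts) * nodeCost M
  bound = begin
    2 + (w + opCost M)              ≡⟨ cong (λ z → 2 + z) (+-comm w (opCost M)) ⟩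
    2 + opCost M + w                ≤⟨ +-monoˡ-≤ w (s≤s (s≤s (≤-trans (m≤n+m _ (fixedToCost M)) (m≤n+m _ 2)))) ⟩
    nodeCost M + w                  ≤⟨ *-monoˡ-≤ (nodeCost M) (+-monoˡ-≤ (weight t ts) (s≤s (z≤n {suc (size (encodeℚ (value v)))}))) ⟩
    (s + weight t ts) * nodeCost M  ∎
    where open ≤-Reasoning
walk-runs M (flip t₀ t₁) ts σ fits =
  runs (case-cons var (case-cons var (case-cons var (case-cons var (case-nil var (case-cons var
    (call (cons (call (cons var (cons var var)) (walk-runs M t₀ ts σ (≤-trans (+-monoʳ-≤ (length σ) (m≤n⇒m≤1+n (m≤m+n w₀ w₁))) fits)))
                (call (cons var (cons var var)) (walk-runs M t₁ ts σ (≤-trans (+-monoʳ-≤ (length σ) (m≤n⇒m≤1+n (m≤n+m w₁ w₀))) fits))))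
          (average-runs M (walk t₀ ts σ) (walk t₁ ts σ)
            (FitsIn-mono (average (walk t₀ ts σ) (walk t₁ ts σ)) (≤-trans (m≤n+m _ (length σ)) fits) (walk-fits (flip t₀ t₁) ts σ))))))))))
    (≤-trans (m≤m+n _ (1 + fixedToCost M)) (≤-reflexive (r w₀ w₁ (fixedToCost M) (opCost M))))
  where
  w₀ = weight t₀ ts
  w₁ = weight t₁ ts
  r : ∀ a b f o → 1 + (1 + (1 + a * (4 + (f + o)) + b * (4 + (f + o))) + o) + (1 + f) ≡ (1 + (a + b)) * (4 + (f + o))
  r = solve-∀
walk-runs {n} M (query i t₀ t₁) ts σ fits = go (fixedTo σ i) refl lookup-runs
  where
  s = size (encodeℕ (toℕ i))
  w₀ = weight t₀ ts
  w₁ = weight t₁ ts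
  F = fixedToCost M
  N = nodeCost M
  shorter : ∀ {w} → w ≤ w₀ + w₁ → suc (length σ) + w ≤ M
  shorter {w} w≤ = ≤-trans (≤-reflexive (sym (+-suc (length σ) w))) (≤-trans (+-monoʳ-≤ (length σ) (s≤s (≤-trans w≤ (m≤n+m _ s)))) fits)
  σ₀ σ₁ : Restriction n
  σ₀ = (i , false) ∷ σ
  σ₁ = (i , true) ∷ σ
  lookup-runs : Runs fn-fixedTo (cons (encodeℕ (toℕ i)) (encodeRestriction σ)) (encodeMaybe (fixedTo σ i)) F
  lookup-runs = weakenRuns (*-monoˡ-≤ (2 + M) (≤-trans (m≤m+n (length σ) _) fits))
    (fixedTo-runs M σ i (bits-index i M (≤-trans (≤-trans (m≤n⇒m≤1+n (m≤m+n s _)) (m≤n+m _ (length σ))) fits)))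
  bound : ∀ w → w ≤ w₀ + w₁ → suc (suc F + w * N) ≤ suc (s + (w₀ + w₁)) * N
  bound w w≤ = begin
    2 + (F + w * N)              ≤⟨ +-monoˡ-≤ (F + w * N) {2} {4} (s≤s (s≤s z≤n)) ⟩
    4 + (F + w * N)              ≤⟨ +-monoʳ-≤ 4 (+-monoˡ-≤ (w * N) (m≤m+n F (opCost M))) ⟩
    N + w * N                    ≤⟨ *-monoˡ-≤ N (s≤s (≤-trans w≤ (m≤n+m _ s))) ⟩
    suc (s + (w₀ + w₁)) * N      ∎
    where open ≤-Reasoning
  go : ∀ m → fixedTo σ i ≡ m → Runs fn-fixedTo (cons (encodeℕ (toℕ i)) (encodeRestriction σ)) (encodeMaybe m) F →
       Runs fn-walk (cons (encodeRDT (query i t₀ t₁)) (cons (encodeForest ts) (encodeRestriction σ)))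
            (encodeFrac (walk (query i t₀ t₁) ts σ)) (weight (query i t₀ t₁) ts * N)
  go (just false) eq p rewrite eq = runs
    (case-cons var (case-cons var (case-cons var (case-cons var (case-cons var (case-cons var (case-cons var
      (case-cons (call (cons var var) p) (case-nil var (call (cons var (cons var var))
        (walk-runs M t₀ ts σ (≤-trans (n≤1+n _) (shorter (m≤m+n w₀ w₁))))))))))))))
    (bound w₀ (m≤m+n w₀ w₁))
  go (just true) eq p rewrite eq = runs
    (case-cons var (case-cons var (case-cons var (case-cons var (case-cons var (case-cons var (case-cons var
      (case-cons (call (cons var var) p) (case-cons var (call (cons var (cons var var))
        (walk-runs M t₁ ts σ (≤-trans (n≤1+n _) (shorter (m≤n+m w₁ w₀))))))))))))))
    (bound w₁ (m≤n+m w₁ w₀))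
  go nothing eq p rewrite eq = runs
    (case-cons var (case-cons var (case-cons var (case-cons var (case-cons var (case-cons var (case-cons var
      (case-nil (call (cons var var) p)
        (call (cons (call (cons var (cons var (cons (cons var nil) var))) (walk-runs M t₀ ts σ₀ (shorter (m≤m+n w₀ w₁))))
                    (call (cons var (cons var (cons (cons var (cons nil nil)) var))) (walk-runs M t₁ ts σ₁ (shorter (m≤n+m w₁ w₀)))))
          (average-runs M (walk t₀ ts σ₀) (walk t₁ ts σ₁)
            (FitsIn-mono (average (walk t₀ ts σ₀) (walk t₁ ts σ₁)) (≤-trans (s≤s (m≤n+m (w₀ + w₁) (length σ))) (shorter ≤-refl))
              (FitsIn-average w₀ w₁ (walk t₀ ts σ₀) (walk t₁ ts σ₁) (walk-fits t₀ ts σ₀) (walk-fits t₁ ts σ₁)))))))))))))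
    (≤-trans (≤-reflexive (r w₀ w₁ F (opCost M))) (*-monoˡ-≤ N (s≤s (m≤n+m (w₀ + w₁) s))))
    where
    r : ∀ a b f o → 1 + (1 + (1 + (1 + f) + a * (4 + (f + o))) + b * (4 + (f + o)) + o) ≡ (1 + (a + b)) * (4 + (f + o))
    r = solve-∀

-- Running time of collecting the variables

length-insert : ∀ {n} i (V : Restriction n) → length (insert i V) ≤ suc (length V)
length-insert i V with fixedTo V i
... | just _  = n≤1+n _
... | nothing = ≤-refl

length-variables : ∀ {n} (t : RDT n) V → length (variables t V) ≤ length V + size (encodeRDT t)
length-variables (leaf _) V = m≤m+n _ _
length-variables (flip t₀ t₁) V = begin
  length (variables t₁ (variables t₀ V))  ≤⟨ length-variables t₁ (variables t₀ V) ⟩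
  length (variables t₀ V) + s₁            ≤⟨ +-monoˡ-≤ s₁ (length-variables t₀ V) ⟩
  length V + s₀ + s₁                      ≡⟨ +-assoc (length V) s₀ s₁ ⟩
  length V + (s₀ + s₁)                    ≤⟨ +-monoʳ-≤ (length V) (m≤n+m (s₀ + s₁) 5) ⟩
  length V + (5 + (s₀ + s₁))              ∎
  where
  open ≤-Reasoning
  s₀ = size (encodeRDT t₀) ; s₁ = size (encodeRDT t₁)
length-variables (query i t₀ t₁) V = begin
  length (variables t₁ (variables t₀ W))  ≤⟨ length-variables t₁ (variables t₀ W) ⟩
  length (variables t₀ W) + s₁            ≤⟨ +-monoˡ-≤ s₁ (length-variables t₀ W) ⟩
  length W + s₀ + s₁                      ≤⟨ +-monoˡ-≤ s₁ (+-monoˡ-≤ s₀ (length-insert i V)) ⟩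
  suc (length V) + s₀ + s₁                ≤⟨ m≤m+n _ (7 + s) ⟩
  suc (length V) + s₀ + s₁ + (7 + s)      ≡⟨ r (length V) s₀ s₁ s ⟩
  length V + (7 + (s + (1 + (s₀ + s₁))))  ∎
  where
  open ≤-Reasoning
  W = insert i V
  s₀ = size (encodeRDT t₀) ; s₁ = size (encodeRDT t₁) ; s = size (encodeℕ (toℕ i))
  r : ∀ l a b s → 1 + l + a + b + (7 + s) ≡ l + (7 + (s + (1 + (a + b))))
  r = solve-∀

variables-runs : ∀ {n} M (t : RDT n) V → length V + size (encodeRDT t) ≤ M →
  Runs fn-variables (cons (encodeRDT t) (encodeRestriction V)) (encodeRestriction (variables t V))
       (size (encodeRDT t) * (3 + fixedToCost M))
variables-runs M (leaf _) V fits = runs (case-cons var (case-cons var (case-nil var var))) z≤n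
variables-runs M (flip t₀ t₁) V fits = runs
  (case-cons var (case-cons var (case-cons var (case-nil var (case-cons var
    (call (cons var (call (cons var var)
      (variables-runs M t₀ V (≤-trans (+-monoʳ-≤ (length V) (≤-trans (m≤m+n s₀ s₁) (m≤n+m _ 5))) fits))))
      (variables-runs M t₁ (variables t₀ V) (begin
         length (variables t₀ V) + s₁   ≤⟨ +-monoˡ-≤ s₁ (length-variables t₀ V) ⟩
         length V + s₀ + s₁             ≡⟨ +-assoc (length V) s₀ s₁ ⟩
         length V + (s₀ + s₁)           ≤⟨ +-monoʳ-≤ (length V) (m≤n+m (s₀ + s₁) 5) ⟩
         length V + (5 + (s₀ + s₁))     ≤⟨ fits ⟩
         M                              ∎))))))))
  (≤-trans (m≤m+n _ (13 + 5 * F)) (≤-reflexive (r s₀ s₁ F)))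
  where
  open ≤-Reasoning
  F = fixedToCost M
  s₀ = size (encodeRDT t₀) ; s₁ = size (encodeRDT t₁)
  r : ∀ a b f → 1 + (1 + a * (3 + f) + b * (3 + f)) + (13 + 5 * f) ≡ (5 + (a + b)) * (3 + f)
  r = solve-∀
variables-runs {n} M (query i t₀ t₁) V fits = go (fixedTo V i) refl lookup-runs
  where
  F = fixedToCost M
  W = insert i V
  s₀ = size (encodeRDT t₀) ; s₁ = size (encodeRDT t₁) ; s = size (encodeℕ (toℕ i))
  lookup-runs : Runs fn-fixedTo (cons (encodeℕ (toℕ i)) (encodeRestriction V)) (encodeMaybe (fixedTo V i)) F
  lookup-runs = weakenRuns (*-monoˡ-≤ (2 + M) (≤-trans (m≤m+n (length V) _) fits))
    (fixedTo-runs M V i (bits-index i M (≤-trans (≤-trans (≤-trans (m≤m+n s _) (m≤n+m _ 7)) (m≤n+m _ (length V))) fits)))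
  fits₁ : length W + (s₀ + s₁) ≤ M
  fits₁ = begin
    length W + (s₀ + s₁)               ≤⟨ +-monoˡ-≤ (s₀ + s₁) (length-insert i V) ⟩
    suc (length V + (s₀ + s₁))         ≡⟨ +-suc (length V) (s₀ + s₁) ⟨
    length V + (1 + (s₀ + s₁))         ≤⟨ +-monoʳ-≤ (length V) (≤-trans (m≤n+m _ s) (m≤n+m _ 7)) ⟩
    length V + (7 + (s + (1 + (s₀ + s₁)))) ≤⟨ fits ⟩
    M ∎
    where open ≤-Reasoning
  runs₀ : ∀ {U} → W ≡ U → Runs fn-variables (cons (encodeRDT t₀) (encodeRestriction U))
                                            (encodeRestriction (variables t₀ W)) (s₀ * (3 + F))
  runs₀ refl = variables-runs M t₀ W (≤-trans (+-monoʳ-≤ (length W) (m≤m+n s₀ s₁)) fits₁)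
  runs₁ : Runs fn-variables (cons (encodeRDT t₁) (encodeRestriction (variables t₀ W)))
                            (encodeRestriction (variables t₁ (variables t₀ W))) (s₁ * (3 + F))
  runs₁ = variables-runs M t₁ (variables t₀ W)
    (≤-trans (+-monoˡ-≤ s₁ (length-variables t₀ W)) (≤-trans (≤-reflexive (+-assoc (length W) s₀ s₁)) fits₁))
  bound : suc (suc (suc F + s₀ * (3 + F)) + s₁ * (3 + F)) ≤ (7 + (s + (1 + (s₀ + s₁)))) * (3 + F)
  bound = ≤-trans (m≤m+n _ ((7 + s) * (3 + F))) (≤-reflexive (r s s₀ s₁ F))
    where
    r : ∀ s a b f → 1 + (1 + (1 + f + a * (3 + f)) + b * (3 + f)) + (7 + s) * (3 + f) ≡ (7 + (s + (1 + (a + b)))) * (3 + f)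
    r = solve-∀
  go : ∀ m → fixedTo V i ≡ m → Runs fn-fixedTo (cons (encodeℕ (toℕ i)) (encodeRestriction V)) (encodeMaybe m) F →
       Runs fn-variables (cons (encodeRDT (query i t₀ t₁)) (encodeRestriction V))
            (encodeRestriction (variables t₁ (variables t₀ W))) ((7 + (s + (1 + (s₀ + s₁)))) * (3 + F))
  go (just _) same p = runs (case-cons var (case-cons var (case-cons var (case-cons var (case-cons var (case-cons var
    (call (cons var (call (cons var (case-cons (call (cons var var) p) var))
                          (runs₀ unchanged))) runs₁))))))) bound
    where
    unchanged : W ≡ V
    unchanged rewrite same = refl
  go nothing same p = runs (case-cons var (case-cons var (case-cons var (case-cons var (case-cons var (case-cons var
    (call (cons var (call (cons var (case-nil (call (cons var var) p) (cons (cons var nil) var)))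
                          (runs₀ added))) runs₁))))))) bound
    where
    added : W ≡ (i , false) ∷ V
    added rewrite same = refl

-- Running time of the best tree

constantCost : ℕ → ℕ → ℕ
constantCost M w = 2 + (w * nodeCost M + opCost M)

constant-runs : ∀ {n} M (R : RDT n) σ → length σ + weight R [] ≤ M → weight R [] + weight R [] ≤ M →
  Runs fn-constant (cons (encodeRDT R) (encodeRestriction σ)) (encodeCandidate (constant R σ)) (constantCost M (weight R []))
constant-runs M R σ fits fits₂ = runs
  (case-cons var (let′ (call (cons var (cons nil var)) (walk-runs M R [] σ fits))
    (cons (call (cons var var) (times-runs M μ μ (FitsIn-mono (times μ μ) fits₂
            (FitsIn-times (weight R []) (weight R []) μ μ (walk-fits R [] σ) (walk-fits R [] σ)))))
          (cons nil var))))
  ≤-refl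
  where μ = walk R [] σ

-- The score of a leaf is the square of a mean, and every level of queries
-- averages two scores: the bit lengths of the denominators add up, and one
-- more bit comes from the factor 2.
scoreBits : ℕ → ℕ → ℕ
scoreBits w zero    = w + w
scoreBits w (suc q) = suc (scoreBits w q + scoreBits w q)

2w≤scoreBits : ∀ w q → w + w ≤ scoreBits w q
2w≤scoreBits w zero    = ≤-refl
2w≤scoreBits w (suc q) = ≤-trans (2w≤scoreBits w q) (m≤n⇒m≤1+n (m≤m+n _ _))

scoreBits-mono : ∀ w {p q} → p ≤ q → scoreBits w p ≤ scoreBits w q
scoreBits-mono w {q = q} z≤n = 2w≤scoreBits w q
scoreBits-mono w (s≤s p≤q)   = s≤s (+-mono-≤ (scoreBits-mono w p≤q) (scoreBits-mono w p≤q))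

best-fits : ∀ {n} (R : RDT n) V q vs σ → FitsIn (scoreBits (weight R []) q) (proj₁ (best R V q vs σ))
constant-fits : ∀ {n} (R : RDT n) q σ → FitsIn (scoreBits (weight R []) q) (proj₁ (constant R σ))
constant-fits R q σ = FitsIn-mono (times μ μ) (2w≤scoreBits (weight R []) q)
  (FitsIn-times (weight R []) (weight R []) μ μ (walk-fits R [] σ) (walk-fits R [] σ))
  where μ = walk R [] σ
best-fits R V zero    vs             σ = constant-fits R zero σ
best-fits R V (suc q) []             σ = constant-fits R (suc q) σ
best-fits R V (suc q) ((i , _) ∷ vs) σ =
  better-elim (λ c → FitsIn (scoreBits (weight R []) (suc q)) (proj₁ c)) (branchOn i c₀ c₁) (best R V (suc q) vs σ)
    (FitsIn-average (scoreBits (weight R []) q) (scoreBits (weight R []) q) (proj₁ c₀) (proj₁ c₁) (best-fits R V q V _) (best-fits R V q V _))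
    (best-fits R V (suc q) vs σ)
  where
  c₀ = best R V q V ((i , false) ∷ σ)
  c₁ = best R V q V ((i , true) ∷ σ)

module _ {n} (M : ℕ) (R : RDT n) (V : Restriction n) where
  private
    w = weight R []
    A = opCost M
    γ = scoreBits w

  unitCost : ℕ
  unitCost = 3 + (constantCost M w + (A + A))

  -- With k variables the cost c(q) of a call at depth q satisfies
  -- c(q) = k (2 c(q-1) + O(1)) + O(1), which is at most (1 + 3 k)^q times the
  -- cost of the work outside recursive calls.
  levelCost : ℕ → ℕ
  levelCost q = (1 + 3 * length V) ^ q * unitCost

  -- The cost when l variables remain to be tried at the root.
  bestCost : ℕ → ℕ → ℕ
  bestCost zero    l = unitCost
  bestCost (suc q) l = (1 + 3 * l) * levelCost q

  bestCost-V : ∀ q → bestCost q (length V) ≡ levelCost q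
  bestCost-V zero    = sym (+-identityʳ unitCost)
  bestCost-V (suc q) = sym (*-assoc (1 + 3 * length V) ((1 + 3 * length V) ^ q) unitCost)

  levelCost-mono : ∀ {p q} → p ≤ q → levelCost p ≤ levelCost q
  levelCost-mono p≤q = *-monoˡ-≤ unitCost (^-monoʳ-≤ (1 + 3 * length V) p≤q)

  unitCost≤ : ∀ q → unitCost ≤ levelCost q
  unitCost≤ q = ≤-trans (≤-reflexive (sym (+-identityʳ unitCost))) (levelCost-mono (z≤n {q}))

  best-runs : ∀ q vs σ → length σ + (q + w) ≤ M → γ q + γ q ≤ M →
    Runs fn-best (cons (cons (encodeRDT R) (encodeRestriction V)) (cons (encodeUnary q) (cons (encodeRestriction vs) (encodeRestriction σ))))
         (encodeCandidate (best R V q vs σ)) (bestCost q (length vs))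
  best-runs zero vs σ fits fits₂ = runs
    (case-cons var (case-cons var (case-cons var (case-cons var (case-nil var
      (call (cons var var) (constant-runs M R σ fits (≤-trans (m≤m+n _ _) fits₂))))))))
    (s≤s (≤-trans (m≤m+n _ (A + A)) (m≤n+m _ 2)))
  best-runs (suc q) [] σ fits fits₂ = runs
    (case-cons var (case-cons var (case-cons var (case-cons var (case-cons var (case-nil var
      (call (cons var var) (constant-runs M R σ (≤-trans (+-monoʳ-≤ (length σ) (m≤n+m w (suc q))) fits)
        (≤-trans (2w≤scoreBits w (suc q)) (≤-trans (m≤m+n _ _) fits₂))))))))))
    (≤-trans (s≤s (≤-trans (m≤m+n _ (A + A)) (m≤n+m _ 2))) (≤-trans (unitCost≤ q) (≤-reflexive (sym (+-identityʳ _)))))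
  best-runs (suc q) ((i , c) ∷ vs) σ fits fits₂ = decide (leq (proj₁ branch) (proj₁ rest)) refl leq-run (best-runs (suc q) vs σ fits fits₂)
    where
    σ₀ = (i , false) ∷ σ
    σ₁ = (i , true) ∷ σ
    c₀ = best R V q V σ₀
    c₁ = best R V q V σ₁
    rest = best R V (suc q) vs σ
    branch = branchOn i c₀ c₁
    fits′ : suc (length σ) + (q + w) ≤ M
    fits′ = ≤-trans (≤-reflexive (sym (+-suc (length σ) (q + w)))) fits
    fits₂′ : γ q + γ q ≤ M
    fits₂′ = ≤-trans (n≤1+n _) (≤-trans (m≤m+n _ _) fits₂)
    branch-fits : FitsIn (γ (suc q)) (proj₁ branch)
    branch-fits = FitsIn-average (γ q) (γ q) (proj₁ c₀) (proj₁ c₁) (best-fits R V q V σ₀) (best-fits R V q V σ₁)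
    recursive : ∀ b → Runs fn-best (cons (cons (encodeRDT R) (encodeRestriction V))
                                       (cons (encodeUnary q) (cons (encodeRestriction V) (encodeRestriction ((i , b) ∷ σ)))))
         (encodeCandidate (best R V q V ((i , b) ∷ σ))) (levelCost q)
    recursive b = weakenRuns (≤-reflexive (bestCost-V q)) (best-runs q V ((i , b) ∷ σ) fits′ fits₂′)
    average-run : Runs fn-average (cons (encodeFrac (proj₁ c₀)) (encodeFrac (proj₁ c₁))) (encodeFrac (proj₁ branch)) A
    average-run = average-runs M (proj₁ c₀) (proj₁ c₁) (FitsIn-mono (proj₁ branch) (≤-trans (m≤m+n (γ (suc q)) _) fits₂) branch-fits)
    leq-run : Runs fn-leq (cons (encodeFrac (proj₁ branch)) (encodeFrac (proj₁ rest))) (encodeBool (leq (proj₁ branch) (proj₁ rest))) A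
    leq-run = leq-runs M (proj₁ branch) (proj₁ rest) (FitsIn-mono (times (proj₁ branch) (proj₁ rest)) fits₂
      (FitsIn-times (γ (suc q)) (γ (suc q)) (proj₁ branch) (proj₁ rest) branch-fits (best-fits R V (suc q) vs σ)))
    X = levelCost q
    Y = bestCost (suc q) (length vs)
    bound : suc (suc (suc (suc (suc Y + X) + X) + A) + A) ≤ bestCost (suc q) (suc (length vs))
    bound = begin
      suc (suc (suc (suc (suc Y + X) + X) + A) + A)  ≡⟨ r Y X A ⟩
      (5 + (A + A)) + (X + X + Y)            ≤⟨ +-monoˡ-≤ (X + X + Y) (≤-trans unit (unitCost≤ q)) ⟩
      X + (X + X + Y)                        ≡⟨ s X (length vs) ⟩
      (1 + 3 * suc (length vs)) * X          ∎
      where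
      open ≤-Reasoning
      unit : 5 + (A + A) ≤ unitCost
      unit = s≤s (s≤s (s≤s (+-monoˡ-≤ (A + A) (s≤s (s≤s z≤n)))))
      r : ∀ y x a → 1 + (1 + (1 + (1 + (1 + y + x) + x) + a) + a) ≡ (5 + (a + a)) + (x + x + y)
      r = solve-∀
      s : ∀ x l → x + (x + x + (1 + 3 * l) * x) ≡ (1 + 3 * (1 + l)) * x
      s = solve-∀
    decide : ∀ b → leq (proj₁ branch) (proj₁ rest) ≡ b →
      Runs fn-leq (cons (encodeFrac (proj₁ branch)) (encodeFrac (proj₁ rest))) (encodeBool b) A →
      Runs fn-best (cons (cons (encodeRDT R) (encodeRestriction V)) (cons (encodeUnary (suc q)) (cons (encodeRestriction vs) (encodeRestriction σ))))
         (encodeCandidate rest) Y →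
      Runs fn-best (cons (cons (encodeRDT R) (encodeRestriction V))
                         (cons (encodeUnary (suc q)) (cons (encodeRestriction ((i , c) ∷ vs)) (encodeRestriction σ))))
         (encodeCandidate (better branch rest)) (bestCost (suc q) (suc (length vs)))
    decide true le p rest-run rewrite le = runs
      (case-cons var (case-cons var (case-cons var (case-cons var (case-cons var (case-cons var (case-cons var
        (let′ (call (cons var (cons var (cons var var))) rest-run)
        (let′ (call (cons var (cons var (cons var (cons (cons var nil) var)))) (recursive false))
        (let′ (call (cons var (cons var (cons var (cons (cons var (cons nil nil)) var)))) (recursive true))
        (case-cons var (case-cons var (case-cons var
        (let′ (call (cons var var) average-run)
        (case-cons (call (cons var var) p) var)))))))))))))))
      bound
    decide false le p rest-run rewrite le = runs
      (case-cons var (case-cons var (case-cons var (case-cons var (case-cons var (case-cons var (case-cons var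
        (let′ (call (cons var (cons var (cons var var))) rest-run)
        (let′ (call (cons var (cons var (cons var (cons (cons var nil) var)))) (recursive false))
        (let′ (call (cons var (cons var (cons var (cons (cons var (cons nil nil)) var)))) (recursive true))
        (case-cons var (case-cons var (case-cons var
        (let′ (call (cons var var) average-run)
        (case-nil (call (cons var var) p) (cons var (cons (cons (cons nil nil) nil) (cons var (cons var var)))))))))))))))))))
      bound

-- The number of variables

-- Only absent variables are inserted, so a tree over n variables yields at
-- most n of them, however large the tree is.  The exponential part of the
-- running time then has base O(n).
Distinct : ∀ {n} → Restriction n → Set
Distinct []            = ⊤
Distinct ((i , _) ∷ V) = fixedTo V i ≡ nothing × Distinct V

insert-distinct : ∀ {n} i (V : Restriction n) → Distinct V → Distinct (insert i V)
insert-distinct i V distinct with fixedTo V i in free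
... | just _  = distinct
... | nothing = free , distinct

variables-distinct : ∀ {n} (t : RDT n) V → Distinct V → Distinct (variables t V)
variables-distinct (leaf _)        V d = d
variables-distinct (flip t₀ t₁)    V d = variables-distinct t₁ _ (variables-distinct t₀ V d)
variables-distinct (query i t₀ t₁) V d = variables-distinct t₁ _ (variables-distinct t₀ _ (insert-distinct i V d))

nth : ∀ {n} (V : Restriction n) → Fin (length V) → Fin n
nth ((i , _) ∷ V) zero    = i
nth (_ ∷ V)       (suc k) = nth V k

nth-Listed : ∀ {n} (V : Restriction n) k → Listed V (nth V k)
nth-Listed ((i , b) ∷ V) zero with fixedTo V i
... | just c  = c , refl
... | nothing with i ≟ i
...   | yes _ = b , refl
...   | no ≢  = contradiction refl ≢
nth-Listed (ib ∷ V) (suc k) = Listed-cons {V = V} (nth-Listed V k)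

nth-injective : ∀ {n} (V : Restriction n) → Distinct V → Injective _≡_ _≡_ (nth V)
nth-injective ((i , _) ∷ V) d          {zero}  {zero}  _    = refl
nth-injective ((i , _) ∷ V) (free , _) {zero}  {suc l} same
  with b , listed ← nth-Listed V l with () ← trans (sym free) (trans (cong (fixedTo V) same) listed)
nth-injective ((i , _) ∷ V) (free , _) {suc k} {zero}  same
  with b , listed ← nth-Listed V k with () ← trans (sym free) (trans (cong (fixedTo V) (sym same)) listed)
nth-injective ((i , _) ∷ V) (_ , d)    {suc k} {suc l} same = cong suc (nth-injective V d same)

length≤n : ∀ {n} (V : Restriction n) → Distinct V → length V ≤ n
length≤n V d = injective⇒≤ (nth-injective V d)

-- The size of the output

IndicesWithin : ∀ {n} → ℕ → Restriction n → Set
IndicesWithin s = All (λ ib → size (encodeℕ (toℕ (proj₁ ib))) ≤ s)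

variables-within : ∀ {n} s (t : RDT n) V → size (encodeRDT t) ≤ s → IndicesWithin s V → IndicesWithin s (variables t V)
variables-within s (leaf _)        V t≤s within = within
variables-within s (flip t₀ t₁)    V t≤s within =
  variables-within s t₁ _ (≤-trans (≤-trans (m≤n+m s₁ s₀) (m≤n+m _ 5)) t≤s)
    (variables-within s t₀ V (≤-trans (≤-trans (m≤m+n s₀ s₁) (m≤n+m _ 5)) t≤s) within)
  where s₀ = size (encodeRDT t₀) ; s₁ = size (encodeRDT t₁)
variables-within s (query i t₀ t₁) V t≤s within =
  variables-within s t₁ _ (≤-trans (≤-trans (m≤n+m s₁ s₀) (m≤n+m _ 1)) children≤s)
    (variables-within s t₀ _ (≤-trans (≤-trans (m≤m+n s₀ s₁) (m≤n+m _ 1)) children≤s) inserted)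
  where
  s₀ = size (encodeRDT t₀) ; s₁ = size (encodeRDT t₁) ; sᵢ = size (encodeℕ (toℕ i))
  children≤s : 1 + (s₀ + s₁) ≤ s
  children≤s = ≤-trans (≤-trans (m≤n+m _ sᵢ) (m≤n+m _ 7)) t≤s
  inserted : IndicesWithin s (insert i V)
  inserted with fixedTo V i
  ... | just _  = within
  ... | nothing = ≤-trans (≤-trans (m≤m+n sᵢ _) (m≤n+m _ 7)) t≤s ∷ within

-- A query adds at most 8 + s to the sizes of its subtrees, s being a bound
-- for the index.  With 8 + s added, sizes at most double from level to level.
best-size : ∀ {n} (R : RDT n) V s q vs σ → IndicesWithin s V → IndicesWithin s vs →
  size (encodeRDT (proj₂ (best R V q vs σ))) + (8 + s) ≤ 2 ^ q * (13 + s + 8 * weight R [])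
best-size {n} R V s = go
  where
  w = weight R []
  B = 13 + s + 8 * w
  leaf-size : ∀ q σ → size (encodeRDT (proj₂ (constant R σ))) + (8 + s) ≤ 2 ^ q * B
  leaf-size q σ = begin
    3 + (size (encodeℕ (num μ)) + size (encodeℕ (den μ))) + (8 + s)
      ≤⟨ +-monoˡ-≤ (8 + s) (+-monoʳ-≤ 3 (+-mono-≤ (size-encodeℕ w (num μ) (≤-<-trans (num≤den μ) fits)) (size-encodeℕ w (den μ) fits))) ⟩
    3 + ((1 + 4 * w) + (1 + 4 * w)) + (8 + s)  ≡⟨ r w s ⟩
    B                                          ≤⟨ m≤n*m B (2 ^ q) {{m^n≢0 2 q}} ⟩
    2 ^ q * B                                  ∎
    where
    open ≤-Reasoning
    μ = walk R [] σ
    fits = walk-fits R [] σ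
    r : ∀ w s → 3 + ((1 + 4 * w) + (1 + 4 * w)) + (8 + s) ≡ 13 + s + 8 * w
    r = solve-∀
  go : ∀ q vs σ → IndicesWithin s V → IndicesWithin s vs →
       size (encodeRDT (proj₂ (best R V q vs σ))) + (8 + s) ≤ 2 ^ q * B
  go zero    vs             σ inV _ = leaf-size 0 σ
  go (suc q) []             σ inV _ = leaf-size (suc q) σ
  go (suc q) ((i , _) ∷ vs) σ inV (i≤s ∷ invs) =
    better-elim (λ c → size (encodeRDT (proj₂ c)) + (8 + s) ≤ 2 ^ suc q * B)
      (branchOn i c₀ c₁) (best R V (suc q) vs σ) node-size (go (suc q) vs σ inV invs)
    where
    c₀ = best R V q V ((i , false) ∷ σ)
    c₁ = best R V q V ((i , true) ∷ σ)
    s₀ = size (encodeRDT (proj₂ c₀)) ; s₁ = size (encodeRDT (proj₂ c₁)) ; sᵢ = size (encodeℕ (toℕ i))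
    node-size : 7 + (sᵢ + (1 + (s₀ + s₁))) + (8 + s) ≤ 2 ^ suc q * B
    node-size = begin
      7 + (sᵢ + (1 + (s₀ + s₁))) + (8 + s)  ≤⟨ +-monoˡ-≤ (8 + s) (+-monoʳ-≤ 7 (+-monoˡ-≤ (1 + (s₀ + s₁)) i≤s)) ⟩
      7 + (s + (1 + (s₀ + s₁))) + (8 + s)   ≡⟨ r s s₀ s₁ ⟩
      (s₀ + (8 + s)) + (s₁ + (8 + s))       ≤⟨ +-mono-≤ (go q V _ inV inV) (go q V _ inV inV) ⟩
      2 ^ q * B + 2 ^ q * B                 ≡⟨ u (2 ^ q) B ⟩
      2 ^ suc q * B                         ∎
      where
      open ≤-Reasoning
      r : ∀ s a b → 7 + (s + (1 + (a + b))) + (8 + s) ≡ (a + (8 + s)) + (b + (8 + s))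
      r = solve-∀
      u : ∀ p b → p * b + p * b ≡ (2 * p) * b
      u = solve-∀

-- Running time of the search

module SearchRuns {n} (M : ℕ) (R : RDT n) (ε : Frac) where
  open Search R ε

  private
    w = weight R []
    w₂ = weight R (R ∷ [])
    A = opCost M
    γ = scoreBits w
    e = size (encodeFrac ε)

  searchCost : ℕ → ℕ
  searchCost q⋆ = 4 + (levelCost M R V q⋆ + (A + A))

  halfMoment-fits : FitsIn (suc (w₂ + 1)) halfMoment
  halfMoment-fits = FitsIn-average w₂ 1 (walk R (R ∷ []) []) nought (walk-fits R (R ∷ []) []) (s≤s (s≤s z≤n))

  module _ (q⋆ : ℕ) (accepted : accepts q⋆ ≡ true) (rejected : ∀ q → q < q⋆ → accepts q ≡ false)
           (depth-fits : q⋆ + w ≤ M) (score-fits : γ q⋆ + γ q⋆ ≤ M)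
           (test-fits : suc (w₂ + 1) + suc (e + γ q⋆) ≤ M) where

    -- Below q⋆ every test fails, so the search started at j recurses q⋆ - j times.
    search-runs : ∀ d j → j + d ≡ q⋆ →
      Runs fn-search (cons (cons (encodeRDT R) (encodeRestriction V)) (cons (encodeUnary j) (cons (encodeFrac halfMoment) (encodeFrac ε))))
                     (encodeRDT (proj₂ (candidate q⋆))) (suc d * searchCost q⋆)
    search-runs d j j+d≡q⋆ = go d j+d≡q⋆ (accepts j) refl test-run
      where
      j≤q⋆ : j ≤ q⋆
      j≤q⋆ = ≤-trans (m≤m+n j d) (≤-reflexive j+d≡q⋆)
      L = levelCost M R V q⋆
      s = proj₁ (candidate j)
      s-fits : FitsIn (γ q⋆) s
      s-fits = FitsIn-mono s (scoreBits-mono w j≤q⋆) (best-fits R V j V [])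
      best-run : Runs fn-best (cons (cons (encodeRDT R) (encodeRestriction V)) (cons (encodeUnary j) (cons (encodeRestriction V) nil)))
                      (encodeCandidate (candidate j)) L
      best-run = weakenRuns (≤-trans (≤-reflexive (bestCost-V M R V j)) (levelCost-mono M R V j≤q⋆))
        (best-runs M R V j V [] (≤-trans (+-monoˡ-≤ w j≤q⋆) depth-fits)
          (≤-trans (+-mono-≤ (scoreBits-mono w j≤q⋆) (scoreBits-mono w j≤q⋆)) score-fits))
      threshold-fits : FitsIn (suc (e + γ q⋆)) (average ε s)
      threshold-fits = FitsIn-average e (γ q⋆) ε s (FitsIn-size ε) s-fits
      average-run : Runs fn-average (cons (encodeFrac ε) (encodeFrac s)) (encodeFrac (average ε s)) A
      average-run = average-runs M ε s (FitsIn-mono (average ε s) (≤-trans (m≤n+m _ (suc (w₂ + 1))) test-fits) threshold-fits)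
      test-run : Runs fn-leq (cons (encodeFrac halfMoment) (encodeFrac (average ε s))) (encodeBool (accepts j)) A
      test-run = leq-runs M halfMoment (average ε s) (FitsIn-mono (times halfMoment (average ε s)) test-fits
        (FitsIn-times (suc (w₂ + 1)) (suc (e + γ q⋆)) halfMoment (average ε s) halfMoment-fits threshold-fits))
      go : ∀ d → j + d ≡ q⋆ → ∀ b → accepts j ≡ b →
           Runs fn-leq (cons (encodeFrac halfMoment) (encodeFrac (average ε s))) (encodeBool b) A →
           Runs fn-search (cons (cons (encodeRDT R) (encodeRestriction V)) (cons (encodeUnary j) (cons (encodeFrac halfMoment) (encodeFrac ε))))
                          (encodeRDT (proj₂ (candidate q⋆))) (suc d * searchCost q⋆)
      go zero eq false rejects p with () ← trans (sym rejects) (trans (cong accepts (trans (sym (+-identityʳ j)) eq)) accepted)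
      go (suc d) eq true accepts p with () ← trans (sym accepts) (rejected j (≤-trans (s≤s (m≤m+n j d)) (≤-reflexive (trans (sym (+-suc j d)) eq))))
      go zero eq true _ p = subst (λ q → Runs fn-search _ (encodeRDT (proj₂ (candidate q))) (1 * searchCost q⋆))
        (trans (sym (+-identityʳ j)) eq)
        (runs (case-cons var (case-cons var (case-cons var (case-cons var (let′ (call (cons var (cons var (cons var nil))) best-run)
           (case-cons var (case-cons (call (cons var (call (cons var var) average-run)) p) var)))))))
          (≤-trans (m≤m+n _ 1) (≤-reflexive (r L A))))
        where
        r : ∀ l a → 1 + (1 + (1 + l) + a + a) + 1 ≡ 1 * (4 + (l + (a + a)))
        r = solve-∀
      go (suc d) eq false _ p = runs
        (case-cons var (case-cons var (case-cons var (case-cons var (let′ (call (cons var (cons var (cons var nil))) best-run)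
           (case-cons var (case-nil (call (cons var (call (cons var var) average-run)) p)
              (call (cons var (cons (cons nil var) var)) (search-runs d (suc j) (trans (sym (+-suc j d)) eq))))))))))
        (≤-reflexive (r L A (suc d * searchCost q⋆)))
        where
        r : ∀ l a x → 1 + (1 + (1 + (1 + l) + a) + a + x) ≡ 4 + (l + (a + a)) + x
        r = solve-∀

    mainCost : ℕ
    mainCost = 4 + (size (encodeRDT R) * (3 + fixedToCost M) + (w₂ * nodeCost M + (A + suc q⋆ * searchCost q⋆)))

    main-runs : size (encodeRDT R) ≤ M →
      Runs fn-main (cons (encodeRDT R) (encodeFrac ε)) (encodeRDT (proj₂ (candidate q⋆))) mainCost
    main-runs size-fits = runs
      (case-cons var (let′ (call (cons var nil) (variables-runs M R [] size-fits))
        (let′ (call (cons (call (cons var (cons (cons var nil) nil)) (walk-runs M R (R ∷ []) [] moment-fits))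
                          (cons nil (cons nil nil)))
                    (average-runs M (walk R (R ∷ []) []) nought (FitsIn-mono halfMoment (≤-trans (m≤m+n (suc (w₂ + 1)) _) test-fits) halfMoment-fits)))
          (call (cons (cons var var) (cons nil (cons var var))) (search-runs q⋆ 0 refl)))))
      (≤-reflexive (r (size (encodeRDT R) * (3 + fixedToCost M)) (w₂ * nodeCost M) A (suc q⋆ * searchCost q⋆)))
      where
      moment-fits : w₂ ≤ M
      moment-fits = ≤-trans (≤-trans (≤-trans (m≤m+n w₂ 1) (n≤1+n _)) (m≤m+n _ _)) test-fits
      r : ∀ a b c d → 1 + (1 + (1 + (1 + a) + b) + c + d) ≡ 4 + (a + (b + (c + d)))
      r = solve-∀

-- Polynomial bounds

-- The running time is bounded by an explicit polynomial in one large number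
-- M.  As an expression it can be bounded by a single power of M once and for
-- all.
data Polynomial : Set where
  con : ℕ → Polynomial
  X   : Polynomial
  _:+_ _:*_ : Polynomial → Polynomial → Polynomial

infixl 6 _:+_
infixl 7 _:*_

_at_ : Polynomial → ℕ → ℕ
con k    at M = k
X        at M = M
(p :+ q) at M = (p at M) + (q at M)
(p :* q) at M = (p at M) * (q at M)

-- A constant k is at most 2^k, hence at most M^k when M is at least 2; the
-- successor for a sum absorbs a factor 2.
exponent : Polynomial → ℕ
exponent (con k)  = k
exponent X        = 1
exponent (p :+ q) = suc (exponent p + exponent q)
exponent (p :* q) = exponent p + exponent q

n<2^n : ∀ n → n < 2 ^ n
n<2^n zero    = s≤s z≤n
n<2^n (suc n) = begin
  suc (suc n)      ≤⟨ s≤s (n<2^n n) ⟩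
  suc (2 ^ n)      ≤⟨ +-monoˡ-≤ (2 ^ n) (m^n>0 2 n) ⟩
  2 ^ n + 2 ^ n    ≡⟨ cong (λ z → 2 ^ n + z) (+-identityʳ (2 ^ n)) ⟨
  2 ^ suc n        ∎
  where open ≤-Reasoning

at≤^ : ∀ p {M} → 2 ≤ M → p at M ≤ M ^ exponent p
at≤^ (con k) {M} 2≤M = ≤-trans (<⇒≤ (n<2^n k)) (^-monoˡ-≤ k 2≤M)
at≤^ X {M} 2≤M = ≤-reflexive (sym (*-identityʳ M))
at≤^ (p :+ q) {M} 2≤M = begin
  (p at M) + (q at M)            ≤⟨ +-mono-≤ (≤-trans (at≤^ p 2≤M) (^-monoʳ-≤ M (m≤m+n a b))) (≤-trans (at≤^ q 2≤M) (^-monoʳ-≤ M (m≤n+m b a))) ⟩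
  M ^ (a + b) + M ^ (a + b)      ≡⟨ cong (λ z → M ^ (a + b) + z) (+-identityʳ (M ^ (a + b))) ⟨
  2 * M ^ (a + b)                ≤⟨ *-monoˡ-≤ (M ^ (a + b)) 2≤M ⟩
  M ^ suc (a + b)                ∎
  where
  open ≤-Reasoning
  a = exponent p
  b = exponent q
  instance _ = >-nonZero {M} (<⇒≤ 2≤M)
at≤^ (p :* q) {M} 2≤M = ≤-trans (*-mono-≤ (at≤^ p 2≤M) (at≤^ q 2≤M)) (≤-reflexive (sym (^-distribˡ-+-* M (exponent p) (exponent q))))

-- The cost functions of the same names with every size, weight and branching
-- factor replaced by M; the last summand of the total is the output size.
addᵖ mulᵖ opᵖ fixedToᵖ nodeᵖ unitᵖ searchᵖ totalᵖ : Polynomial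
addᵖ     = X :* (con 2 :+ (X :+ X))
mulᵖ     = X :* (con 3 :+ (addᵖ :+ addᵖ))
opᵖ      = con 5 :+ (con 3 :* mulᵖ :+ con 2 :* addᵖ :+ X)
fixedToᵖ = X :* (con 2 :+ X)
nodeᵖ    = con 4 :+ (fixedToᵖ :+ opᵖ)
unitᵖ    = con 3 :+ ((con 2 :+ (X :* nodeᵖ :+ opᵖ)) :+ (opᵖ :+ opᵖ))
searchᵖ  = con 4 :+ (X :* unitᵖ :+ (opᵖ :+ opᵖ))
totalᵖ   = con callPrice :* (con 1 :+ (con 4 :+ (X :* (con 3 :+ fixedToᵖ) :+ (X :* nodeᵖ :+ (opᵖ :+ X :* searchᵖ)))))
           :+ X :* (con 13 :+ X :+ con 8 :* X)

least : ∀ (p : ℕ → Bool) n → p n ≡ true → ∃[ k ] (k ≤ n × p k ≡ true × (∀ i → i < k → p i ≡ false))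
least p n pn with p 0 in p0
... | true = 0 , z≤n , p0 , λ _ ()
least p zero    pn | false with () ← trans (sym p0) pn
least p (suc n) pn | false with k , k≤n , pk , below ← least (λ i → p (suc i)) n pn =
  suc k , s≤s k≤n , pk , λ { zero _ → p0 ; (suc i) (s≤s i<k) → below i i<k }

scoreBits≤ : ∀ w q → suc (scoreBits w q) ≤ 2 ^ q * suc (w + w)
scoreBits≤ w zero    = ≤-reflexive (sym (+-identityʳ _))
scoreBits≤ w (suc q) = begin
  2 + (scoreBits w q + scoreBits w q)         ≡⟨ r (scoreBits w q) ⟩
  2 * suc (scoreBits w q)                     ≤⟨ *-monoʳ-≤ 2 (scoreBits≤ w q) ⟩
  2 * (2 ^ q * suc (w + w))                   ≡⟨ *-assoc 2 (2 ^ q) (suc (w + w)) ⟨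
  2 ^ suc q * suc (w + w)                     ∎
  where
  open ≤-Reasoning
  r : ∀ a → 2 + (a + a) ≡ 2 * (1 + a)
  r = solve-∀

size≥1 : ∀ d → 1 ≤ size d
size≥1 nil        = ≤-refl
size≥1 (cons _ _) = s≤s z≤n

-- For n = 0 the bound q ≤ n forces q = 0, and both sides are 0^0.
^-monoʳ-q≤n : ∀ n {q a b} → q ≤ n → a ≤ b → n ^ (a * q) ≤ n ^ (b * q)
^-monoʳ-q≤n zero    {zero} {a} {b} z≤n a≤b = ≤-reflexive (cong (0 ^_) (trans (*-zeroʳ a) (sym (*-zeroʳ b))))
^-monoʳ-q≤n (suc n) {q} q≤n a≤b = ^-monoʳ-≤ (suc n) (*-monoˡ-≤ q a≤b)

-- For n ≥ 2 this holds because 3 n + 1 ≤ n³.  For n = 1 the bound q ≤ n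
-- leaves only (3 + 1)^1, which is the reason for the factor 4.
branching≤ : ∀ n q → q ≤ n → (1 + 3 * n) ^ q ≤ 4 * n ^ (3 * q)
branching≤ zero          zero       _       = s≤s z≤n
branching≤ (suc zero)    zero       _       = s≤s z≤n
branching≤ (suc zero)    (suc zero) _       = ≤-refl
branching≤ (suc zero)    (suc (suc _)) (s≤s ())
branching≤ n@(suc (suc m)) q        _       = begin
  (1 + 3 * n) ^ q    ≤⟨ ^-monoˡ-≤ q cube ⟩
  (n ^ 3) ^ q        ≡⟨ ^-*-assoc n 3 q ⟩
  n ^ (3 * q)        ≤⟨ m≤n*m (n ^ (3 * q)) 4 ⟩
  4 * n ^ (3 * q)    ∎
  where
  open ≤-Reasoning
  cube : 1 + 3 * n ≤ n ^ 3
  cube = ≤-trans (m≤m+n (1 + 3 * (2 + m)) (1 + 9 * m + 6 * (m * m) + m * (m * m))) (≤-reflexive (r m))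
    where
    r : ∀ m → 1 + 3 * (2 + m) + (1 + 9 * m + 6 * (m * m) + m * (m * m)) ≡ (2 + m) * ((2 + m) * ((2 + m) * 1))
    r = solve-∀

2^q≤branching : ∀ n q → q ≤ n → 2 ^ q ≤ (1 + 3 * n) ^ q
2^q≤branching n zero    _   = ≤-refl
2^q≤branching (suc n) (suc q) _ = ^-monoˡ-≤ (suc q) (≤-trans (m≤m+n 2 (2 + 3 * n)) (≤-reflexive (r n)))
  where
  r : ∀ n → 2 + (2 + 3 * n) ≡ 1 + 3 * (1 + n)
  r = solve-∀

-- The power of 4 absorbs the factor from branching≤, raised to 3 e; the
-- exponent of n is 3 q there, and becomes 9 e q.
constantFor : ℕ → ℕ
constantFor e = 4 ^ (3 * e) + 9 * e

final-bound : ∀ e n q Z → q ≤ n → 1 ≤ Z →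
  let Y = Z * (1 + 3 * n) ^ q in (Y ^ 3) ^ e ≤ constantFor e * Z ^ constantFor e * n ^ (constantFor e * q)
final-bound e n q Z q≤n 1≤Z = begin
  ((Z * B) ^ 3) ^ e                     ≡⟨ ^-*-assoc (Z * B) 3 e ⟩
  (Z * B) ^ t                           ≡⟨ ^-distribʳ-* t Z B ⟩
  Z ^ t * B ^ t                         ≤⟨ *-mono-≤ (^-monoʳ-≤ Z t≤c) power ⟩
  Z ^ c * (c * n ^ (c * q))             ≡⟨ r (Z ^ c) c (n ^ (c * q)) ⟩
  c * Z ^ c * n ^ (c * q)               ∎
  where
  open ≤-Reasoning
  instance _ = >-nonZero {Z} 1≤Z
  B = (1 + 3 * n) ^ q
  t = 3 * e
  c = constantFor e
  t≤c : t ≤ c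
  t≤c = ≤-trans (*-monoˡ-≤ e {3} {9} (s≤s (s≤s (s≤s z≤n)))) (m≤n+m (9 * e) (4 ^ t))
  r : ∀ a b d → a * (b * d) ≡ b * a * d
  r = solve-∀
  ^-distribʳ-* : ∀ k a b → (a * b) ^ k ≡ a ^ k * b ^ k
  ^-distribʳ-* zero    a b = refl
  ^-distribʳ-* (suc k) a b = trans (cong (a * b *_) (^-distribʳ-* k a b)) (u a b (a ^ k) (b ^ k))
    where
    u : ∀ a b x y → a * b * (x * y) ≡ a * x * (b * y)
    u = solve-∀
  power : B ^ t ≤ c * n ^ (c * q)
  power = begin
    B ^ t                               ≤⟨ ^-monoˡ-≤ t (branching≤ n q q≤n) ⟩
    (4 * n ^ (3 * q)) ^ t               ≡⟨ ^-distribʳ-* t 4 (n ^ (3 * q)) ⟩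
    4 ^ t * (n ^ (3 * q)) ^ t           ≡⟨ cong (4 ^ t *_) (^-*-assoc n (3 * q) t) ⟩
    4 ^ t * n ^ (3 * q * t)             ≡⟨ cong (λ i → 4 ^ t * n ^ i) (regroup q e) ⟩
    4 ^ t * n ^ (9 * e * q)             ≤⟨ *-mono-≤ (m≤m+n (4 ^ t) (9 * e)) (^-monoʳ-q≤n n q≤n (m≤n+m (9 * e) (4 ^ t))) ⟩
    c * n ^ (c * q)                     ∎
    where
    regroup : ∀ q e → 3 * q * (3 * e) ≡ 9 * e * q
    regroup = solve-∀

-- Correctness within the time bound

Solved : ∀ {n} → ℕ → RDT n → ℚᵘ → Set
Solved {n} c R ε = ∃[ q⋆ ] (IsLeast (Approximable ε R) q⋆ ×
  ∃[ D ] (Returns instanceOpt On encodeInput R ε Output encodeRDT (tree {n} D)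
            Within (c * (size (encodeRDT R) + size (encodeℚ ε)) ^ c * n ^ (c * q⋆)) ×
          queryComplexity (tree D) ≤ q⋆ ×
          Approximates ε D R))

-- Every bit length, list length, weight and branching factor met during the
-- run is at most M = Y³, where Y is the input size times (1 + 3 n)^q⋆.
solves : ∀ e → (∀ {M} → 2 ≤ M → totalᵖ at M ≤ M ^ e) →
         ∀ {n} (R : RDT n) (ε : Frac) → 0ℚᵘ ℚᵘ.≤ toℚ ε → Solved (constantFor e) R (toℚ ε)
solves e poly {n} R ε 0≤ε
  with q⋆ , q⋆≤n , accepted , rejected ← least (Search.accepts R ε) n (Search.Approximable-accepted R ε n (Approximable-n R 0≤ε))
  = q⋆ , (approximable , minimal) , tree-of q⋆ , (time , run , time≤) , best-depth R V q⋆ V [] , accepted-Approximates q⋆ accepted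
  where
  open Search R ε
  open SearchRuns
  c = constantFor e
  approximable : Approximable (toℚ ε) R q⋆
  approximable = tree-of q⋆ , best-depth R V q⋆ V [] , accepted-Approximates q⋆ accepted
  minimal : ∀ j → Approximable (toℚ ε) R j → q⋆ ≤ j
  minimal j approx = ≮⇒≥ λ j<q⋆ → true≢false (trans (sym (Approximable-accepted j approx)) (rejected j j<q⋆))
    where
    true≢false : true ≢ false
    true≢false ()
  S = size (encodeRDT R)
  E = size (encodeFrac ε)
  Z = S + E
  B = (1 + 3 * n) ^ q⋆
  Y = Z * B
  M = Y ^ 3
  w = weight R []
  w₂ = weight R (R ∷ [])
  4≤Z : 4 ≤ Z
  4≤Z = +-mono-≤ (size≥1 (encodeRDT R)) (s≤s (+-mono-≤ (size≥1 (encodeℕ (num ε))) (size≥1 (encodeℕ (den ε)))))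
  B≥1 : 1 ≤ B
  B≥1 = m^n>0 (1 + 3 * n) q⋆
  instance
    _ : NonZero B
    _ = >-nonZero B≥1
    _ : NonZero Z
    _ = >-nonZero (≤-trans (s≤s z≤n) 4≤Z)
  Z≤Y : Z ≤ Y
  Z≤Y = m≤m*n Z B
  B≤Y : B ≤ Y
  B≤Y = m≤n*m B Z
  4≤Y : 4 ≤ Y
  4≤Y = ≤-trans 4≤Z Z≤Y
  instance
    _ : NonZero Y
    _ = >-nonZero (≤-trans (s≤s z≤n) 4≤Y)
  -- The test for acceptance handles the largest numbers: their bit lengths are
  -- quadratic in the input size, for the second moment, or linear in Y.
  room : 3 * (Y * Y) + 4 * Y ≤ M
  room = begin
    3 * (Y * Y) + 4 * Y    ≤⟨ +-monoʳ-≤ (3 * (Y * Y)) (*-monoˡ-≤ Y 4≤Y) ⟩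
    3 * (Y * Y) + Y * Y    ≡⟨ r (Y * Y) ⟩
    4 * (Y * Y)            ≤⟨ *-monoˡ-≤ (Y * Y) 4≤Y ⟩
    Y * (Y * Y)            ≡⟨ u Y ⟩
    M                      ∎
    where
    open ≤-Reasoning
    r : ∀ a → 3 * a + a ≡ 4 * a
    r = solve-∀
    u : ∀ y → y * (y * y) ≡ y * (y * (y * 1))
    u = solve-∀
  Y≤M : Y ≤ M
  Y≤M = ≤-trans (≤-trans (m≤m+n Y _) (m≤n+m (4 * Y) (3 * (Y * Y)))) room
  ZZ≤YY : Z * Z ≤ Y * Y
  ZZ≤YY = *-mono-≤ Z≤Y Z≤Y
  S≤Z : S ≤ Z
  S≤Z = m≤m+n S E
  w≤Z : w ≤ Z
  w≤Z = ≤-trans (weight≤size R) S≤Z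
  w₂≤ : w₂ ≤ Z * Z
  w₂≤ = ≤-trans (weight≤size* R R) (*-mono-≤ S≤Z (≤-trans (≤-reflexive (+-comm 1 S)) (+-monoʳ-≤ S (size≥1 (encodeFrac ε)))))
  2^q≤B : 2 ^ q⋆ ≤ B
  2^q≤B = 2^q≤branching n q⋆ q⋆≤n
  q⋆<B : q⋆ < B
  q⋆<B = <-≤-trans (n<2^n q⋆) 2^q≤B
  γ = scoreBits w q⋆
  γ< : suc γ ≤ 3 * Y
  γ< = begin
    suc γ                   ≤⟨ scoreBits≤ w q⋆ ⟩
    2 ^ q⋆ * suc (w + w)    ≤⟨ *-mono-≤ 2^q≤B (s≤s (+-mono-≤ w≤Z w≤Z)) ⟩
    B * suc (Z + Z)         ≤⟨ *-monoʳ-≤ B (+-monoˡ-≤ (Z + Z) (≤-trans (s≤s z≤n) 4≤Z)) ⟩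
    B * (Z + (Z + Z))       ≡⟨ r B Z ⟩
    3 * (Z * B)             ∎
    where
    open ≤-Reasoning
    r : ∀ b z → b * (z + (z + z)) ≡ 3 * (z * b)
    r = solve-∀
  Y≤YY : Y ≤ Y * Y
  Y≤YY = m≤m*n Y Y
  depth-fits : q⋆ + w ≤ M
  depth-fits = begin
    q⋆ + w                  ≤⟨ +-mono-≤ (≤-trans (<⇒≤ q⋆<B) B≤Y) (≤-trans w≤Z Z≤Y) ⟩
    Y + Y                   ≤⟨ +-monoʳ-≤ Y (m≤m+n Y _) ⟩
    4 * Y                   ≤⟨ m≤n+m (4 * Y) (3 * (Y * Y)) ⟩
    3 * (Y * Y) + 4 * Y     ≤⟨ room ⟩
    M                       ∎
    where open ≤-Reasoning
  score-fits : γ + γ ≤ M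
  score-fits = begin
    γ + γ                   ≤⟨ +-mono-≤ γ≤3Y γ≤3Y ⟩
    3 * Y + 3 * Y           ≤⟨ +-mono-≤ (*-monoʳ-≤ 3 Y≤YY) (*-monoˡ-≤ Y {3} {4} (s≤s (s≤s (s≤s z≤n)))) ⟩
    3 * (Y * Y) + 4 * Y     ≤⟨ room ⟩
    M                       ∎
    where
    open ≤-Reasoning
    γ≤3Y = ≤-trans (n≤1+n γ) γ<
  test-fits : suc (w₂ + 1) + suc (E + γ) ≤ M
  test-fits = begin
    suc (w₂ + 1) + suc (E + γ)     ≡⟨ r w₂ E γ ⟩
    w₂ + (2 + E) + suc γ           ≤⟨ +-mono-≤ (+-mono-≤ (≤-trans w₂≤ ZZ≤YY) (+-mono-≤ 2≤Y (≤-trans (m≤n+m E S) Z≤Y))) γ< ⟩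
    Y * Y + (Y + Y) + 3 * Y        ≡⟨ u (Y * Y) Y ⟩
    Y * Y + Y + 4 * Y              ≤⟨ +-monoˡ-≤ (4 * Y) (+-monoʳ-≤ (Y * Y) (≤-trans Y≤YY (m≤m+n (Y * Y) _))) ⟩
    3 * (Y * Y) + 4 * Y            ≤⟨ room ⟩
    M                              ∎
    where
    open ≤-Reasoning
    2≤Y : 2 ≤ Y
    2≤Y = ≤-trans (s≤s (s≤s z≤n)) 4≤Y
    r : ∀ a b c → 1 + (a + 1) + (1 + (b + c)) ≡ a + (2 + b) + (1 + c)
    r = solve-∀
    u : ∀ a y → a + (y + y) + 3 * y ≡ a + y + 4 * y
    u = solve-∀
  size-fits : S ≤ M
  size-fits = ≤-trans S≤Z (≤-trans Z≤Y Y≤M)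
  w≤M = ≤-trans (≤-trans w≤Z Z≤Y) Y≤M
  w₂≤M : w₂ ≤ M
  w₂≤M = ≤-trans (≤-trans (m≤m+n w₂ 1) (n≤1+n _)) (≤-trans (m≤m+n _ _) test-fits)
  timed-main = timedCall (main-runs M R ε q⋆ accepted rejected depth-fits score-fits test-fits size-fits)
  time = proj₁ timed-main
  run = proj₁ (proj₂ timed-main)
  calls = mainCost M R ε q⋆ accepted rejected depth-fits score-fits test-fits
  k≤n : length V ≤ n
  k≤n = length≤n V (variables-distinct R [] tt)
  level≤ : levelCost M R V q⋆ ≤ M * (unitᵖ at M)
  level≤ = *-mono-≤ (≤-trans (≤-trans (^-monoˡ-≤ q⋆ (s≤s (*-monoʳ-≤ 3 k≤n))) B≤Y) Y≤M)
    (+-monoʳ-≤ 3 (+-monoˡ-≤ (opCost M + opCost M) (+-monoʳ-≤ 2 (+-monoˡ-≤ (opCost M) (*-monoˡ-≤ (nodeCost M) w≤M)))))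
  calls≤ : calls ≤ 4 + (M * (3 + fixedToCost M) + (M * nodeCost M + (opCost M + M * (searchᵖ at M))))
  calls≤ = +-monoʳ-≤ 4 (+-mono-≤ (*-monoˡ-≤ (3 + fixedToCost M) size-fits)
    (+-mono-≤ (*-monoˡ-≤ (nodeCost M) w₂≤M)
      (+-monoʳ-≤ (opCost M) (*-mono-≤ (≤-trans q⋆<B (≤-trans B≤Y Y≤M))
        (+-monoʳ-≤ 4 (+-monoˡ-≤ (opCost M + opCost M) level≤))))))
  output≤ : size (encodeRDT (tree (tree-of q⋆))) ≤ M * (13 + M + 8 * M)
  output≤ = begin
    size (encodeRDT (tree (tree-of q⋆)))          ≤⟨ m≤m+n _ (8 + S) ⟩
    _                                             ≤⟨ best-size R V S q⋆ V [] V-within V-within ⟩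
    2 ^ q⋆ * (13 + S + 8 * w)                     ≤⟨ *-mono-≤ (≤-trans 2^q≤B (≤-trans B≤Y Y≤M)) (+-mono-≤ (+-monoʳ-≤ 13 size-fits) (*-monoʳ-≤ 8 w≤M)) ⟩
    M * (13 + M + 8 * M)                          ∎
    where
    open ≤-Reasoning
    V-within = variables-within S R [] ≤-refl []
  time≤ : time + size (encodeRDT (tree (tree-of q⋆))) ≤ c * Z ^ c * n ^ (c * q⋆)
  time≤ = begin
    time + size (encodeRDT (tree (tree-of q⋆)))  ≤⟨ +-mono-≤ (≤-trans (proj₂ (proj₂ timed-main)) (*-monoʳ-≤ callPrice (s≤s calls≤))) output≤ ⟩
    totalᵖ at M                                  ≤⟨ poly (≤-trans (s≤s (s≤s z≤n)) (≤-trans 4≤Y Y≤M)) ⟩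
    M ^ e                                        ≤⟨ final-bound e n q⋆ Z q⋆≤n (≤-trans (s≤s z≤n) 4≤Z) ⟩
    c * Z ^ c * n ^ (c * q⋆)                     ∎
    where open ≤-Reasoning

theorem2 : ∃[ instanceOpt ] ∃[ c ]
    (∀ (n q : ℕ) (R : RDT n) → queryComplexity R ≤ q →
    ∀ (ε : ℚᵘ) → 0ℚᵘ ℚᵘ.< ε → ε ℚᵘ.< ½ →
    ∃[ q⋆ ] (IsLeast (Approximable ε R) q⋆ ×
    ∃[ D ] (Returns instanceOpt On encodeInput R ε Output encodeRDT (tree {n} D)
    Within (c * (size (encodeRDT R) + size (encodeℚ ε)) ^ c * n ^ (c * q⋆)) ×
    queryComplexity (tree D) ≤ q⋆ ×
    Approximates ε D R)))
theorem2 = instanceOpt , constantFor (exponent totalᵖ) , λ n _ R _ ε 0<ε ε<½ →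
  let 0≤ε = ℚᵘ.<⇒≤ 0<ε
      ε≤1 = ℚᵘ.≤-trans (ℚᵘ.<⇒≤ ε<½) (*≤* (ℤ.+≤+ (s≤s z≤n)))
      same = toℚ-fraction ε 0≤ε ε≤1
  in subst (Solved (constantFor (exponent totalᵖ)) R) same
       (solves (exponent totalᵖ) (at≤^ totalᵖ) R (fraction ε 0≤ε ε≤1) (subst (0ℚᵘ ℚᵘ.≤_) (sym same) 0≤ε))
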